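{- Let $n\ge 5$. Among all $n$-vertex bicyclic graphs having exactly two cycles, the graph $S_n^{3,3}$ has the minimum degree resistance distance, i.e. $D_R(G)\ge D_R(S_n^{3,3})$ for every such graph $G$, and $$D_R(S_n^{3,3})=3n^2-\frac{13}{3}n-\frac{32}{3}.$$
   Context: All graphs are finite, simple and connected. For vertices $u,v$ of a graph $G$, the resistance distance $r(u,v)$ is the effective resistance between $u$ and $v$ in the electrical network obtained from $G$ by replacing every edge by a unit resistor. The degree resistance distance of $G$ is $D_R(G)=\sum_{\{u,v\}\subseteq V(G)}[d(u)+d(v)]\,r(u,v)$, where $d(u)$ is the degree of $u$ and the sum runs over unordered pairs of distinct vertices. A bicyclic graph is a connected graph with $|E(G)|=|V(G)|+1$. $S_n^{3,3}$ is the graph obtained from two triangles sharing exactly one common vertex by attaching $n-5$ pendent edges to that common vertex. -}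

module Defs where

open import Data.Nat as ℕ using (ℕ; zero; suc; _<ᵇ_; _≡ᵇ_)
open import Data.Nat.DivMod using (_%_; m%n<n)
open import Data.Fin as Fin using (Fin; toℕ; fromℕ<)
open import Data.Bool using (Bool; true; false; if_then_else_; _∧_; _∨_)
open import Data.Integer as ℤ using (ℤ)
open import Data.Rational as ℚ using (ℚ; _/_; 0ℚ; 1ℚ)
open import Data.Product using (Σ; ∃; _×_; _,_)
open import Data.Sum using (_⊎_)
open import Relation.Binary.PropositionalEquality using (_≡_)
open import Relation.Nullary using (¬_)

Graph : ℕ → Set
Graph n = Fin n → Fin n → Bool

IsSimple : ∀ {n} → Graph n → Set
IsSimple {n} G = (∀ i j → G i j ≡ G j i) × (∀ i → G i i ≡ false)

Σℕ : ∀ {n} → (Fin n → ℕ) → ℕ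
Σℕ {zero} f = 0
Σℕ {suc n} f = f Fin.zero ℕ.+ Σℕ (λ i → f (Fin.suc i))

Σℚ : ∀ {n} → (Fin n → ℚ) → ℚ
Σℚ {zero} f = 0ℚ
Σℚ {suc n} f = f Fin.zero ℚ.+ Σℚ (λ i → f (Fin.suc i))

b2ℕ : Bool → ℕ
b2ℕ true = 1
b2ℕ false = 0

ℕtoℚ : ℕ → ℚ
ℕtoℚ k = ℤ.+ k / 1

deg : ∀ {n} → Graph n → Fin n → ℕ
deg G i = Σℕ (λ j → b2ℕ (G i j))

numEdges : ∀ {n} → Graph n → ℕ
numEdges G = Σℕ (λ i → Σℕ (λ j → b2ℕ ((toℕ i <ᵇ toℕ j) ∧ G i j)))

data Walk {n} (G : Graph n) : Fin n → Fin n → Set where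
  nil  : ∀ {u} → Walk G u u
  cons : ∀ {u w v} → G u w ≡ true → Walk G w v → Walk G u v

Connected : ∀ {n} → Graph n → Set
Connected {n} G = ∀ (u v : Fin n) → Walk G u v

-- cycles, identified with their edge sets
EdgeSet : ℕ → Set
EdgeSet n = Fin n → Fin n → Bool

_≐_ : ∀ {n} → EdgeSet n → EdgeSet n → Set
C ≐ D = ∀ u v → C u v ≡ D u v

cnext : ∀ {m} → Fin (suc m) → Fin (suc m)
cnext {m} i = fromℕ< (m%n<n (suc (toℕ i)) (suc m))

IsCycle : ∀ {n} → Graph n → EdgeSet n → Set
IsCycle {n} G C =
  Σ ℕ λ m → Σ (Fin (3 ℕ.+ m) → Fin n) λ f →
    (∀ i j → f i ≡ f j → i ≡ j) ×
    (∀ i → G (f i) (f (cnext i)) ≡ true) ×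
    (∀ u v → C u v ≡ true →
       ∃ λ i → (f i ≡ u × f (cnext i) ≡ v) ⊎ (f i ≡ v × f (cnext i) ≡ u)) ×
    (∀ i → C (f i) (f (cnext i)) ≡ true × C (f (cnext i)) (f i) ≡ true)

ExactlyTwoCycles : ∀ {n} → Graph n → Set
ExactlyTwoCycles G =
  ∃ λ C₁ → ∃ λ C₂ → IsCycle G C₁ × IsCycle G C₂ × ¬ (C₁ ≐ C₂) ×
    (∀ C → IsCycle G C → C ≐ C₁ ⊎ C ≐ C₂)

laplacian : ∀ {n} → Graph n → (Fin n → ℚ) → Fin n → ℚ
laplacian G φ w = Σℚ (λ x → if G w x then φ w ℚ.- φ x else 0ℚ)

current : ∀ {n} → Fin n → Fin n → Fin n → ℚ
current u v w =
  if toℕ w ≡ᵇ toℕ u then 1ℚ else (if toℕ w ≡ᵇ toℕ v then ℚ.- 1ℚ else 0ℚ)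

-- r is the effective resistance between u and v (unit resistors on every edge):
-- the potential difference between u and v when a unit current flows from u to v
-- (Kirchhoff's current law + Ohm's law at every vertex).
IsResistance : ∀ {n} → Graph n → Fin n → Fin n → ℚ → Set
IsResistance G u v r =
  ∃ λ φ → (∀ w → laplacian G φ w ≡ current u v w) × r ≡ φ u ℚ.- φ v

HasDR : ∀ {n} → Graph n → ℚ → Set
HasDR {n} G x =
  ∃ λ (R : Fin n → Fin n → ℚ) →
    (∀ u v → (toℕ u ℕ.< toℕ v) → IsResistance G u v (R u v)) ×
    x ≡ Σℚ (λ u → Σℚ (λ v →
          if toℕ u <ᵇ toℕ v then ℕtoℚ (deg G u ℕ.+ deg G v) ℚ.* R u v else 0ℚ))

-- S_n^{3,3}: vertex 0 is the common vertex, triangles 0-1-2 and 0-3-4,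
-- vertices 5, …, n-1 pendent at 0.
edgeS : ℕ → ℕ → Bool
edgeS zero (suc b) = true
edgeS 1 2 = true
edgeS 3 4 = true
edgeS _ _ = false

S33 : (n : ℕ) → Graph n
S33 n i j = if toℕ i <ᵇ toℕ j then edgeS (toℕ i) (toℕ j)
            else (if toℕ j <ᵇ toℕ i then edgeS (toℕ j) (toℕ i) else false)

DRvalue : ℕ → ℚ
DRvalue n = ℕtoℚ (3 ℕ.* (n ℕ.* n)) ℚ.- (ℤ.+ 13 / 3) ℚ.* ℕtoℚ n ℚ.- ℤ.+ 32 / 3

{-# OPTIONS --safe #-}
module Submission where

{-
Every edge of a connected graph with n + 1 edges and exactly two cycles is a bridge or lies on exactly one
of the cycles, and G minus a cycle (or a bridge) falls apart into one branch per vertex of the cycle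
(endpoint of the bridge).  Splitting the energy of a unit current accordingly gives

  r(u,v) = #{bridges separating u and v} + Σ_C k (g - k) / g,

where g is the length of C and k the distance along C of the branches of u and v; only "≥" is needed.
Summing d(u) r(u,v) over ordered pairs, a bridge contributes at least 3n and a cycle of length g at least
(g² - 1)(4n + 2 - 2g) / 6, because branches are nonempty and their attachment vertices have degree at least
1 (bridge) or 2 (cycle).  As there are n + 1 - g₁ - g₂ bridges, the bound becomes a polynomial inequality,
which is an equality for g₁ = g₂ = 3.
-}

open import Defs
open import Data.Nat as ℕ using (ℕ; zero; suc; _≤_; z≤n; s≤s)
import Data.Nat.Properties as ℕₚ
open import Data.Nat.DivMod using (_%_; m%n<n; m<n⇒m%n≡m; m≤n⇒[n∸m]%m≡n%m; %-distribˡ-+; m%n%n≡m%n; [m+n]%n≡m%n)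
import Data.Integer as ℤ
import Data.Integer.Properties as ℤₚ
open import Data.Fin as Fin using (Fin; toℕ; fromℕ<)
import Data.Fin.Properties as Finₚ
open import Data.Bool using (Bool; true; false; if_then_else_; _∧_; not; T)
import Data.Bool.Properties as Boolₚ
open import Data.Rational using (ℚ; _/_; 0ℚ; 1ℚ; ½; _+_; _*_; _-_; -_; 1/_; toℚᵘ; nonNegative; positive; NonZero; Positive) renaming (_≤_ to _≤ℚ_; _≟_ to _≟ℚ_)
import Data.Rational.Properties as ℚₚ
import Data.Rational.Unnormalised as ℚᵘ
import Data.Rational.Unnormalised.Properties as ℚᵘₚ
open import Data.Maybe using (Maybe; just; nothing)
open import Data.Empty using (⊥; ⊥-elim)
open import Data.Unit using (tt)
open import Data.Product using (∃; _×_; _,_; proj₁; proj₂)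
open import Data.Sum using (_⊎_; inj₁; inj₂)
open import Function using (case_of_; _∘′_)
open import Function.Bundles using (Equivalence)
open import Relation.Nullary using (¬_; Dec; yes; no; does)
open import Relation.Nullary.Decidable using (_×-dec_; _⊎-dec_; dec-true; dec-false)
open import Relation.Binary using (tri<; tri≈; tri>)
open import Relation.Binary.PropositionalEquality
open import Tactic.RingSolver.Core.AlmostCommutativeRing using (AlmostCommutativeRing; fromCommutativeRing)
open import Tactic.RingSolver using (solve-∀)

-- No potential of `G` is ever computed. Testing Kirchhoff's law against a function that is constant
-- on branches annihilates every edge outside the chosen cycle or bridge, so it measures net current
-- through that cycle or bridge alone. For a bridge this fixes the potential drop. For a cycle, the
-- initial segments of positions fix all drops up to one common constant, and minimising the sum of
-- squares over that constant gives k (g - k) / g. Taking the potential itself as test function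
-- shows that the total energy is r(u,v).
--
-- Edge-disjointness of the cycles and separation of their branches both rest on one fact: removing
-- two edges of a cycle separates the ends of each.
--
-- The closing inequality compares costs per edge: a bridge costs 3n, a triangle 16 (n - 1) / 3, and
-- a cycle of length 3 + m at least 3nm more than a triangle. So the total is at least 3n (n - 5) +
-- 32 (n - 1) / 3 however the n + 1 edges are distributed.

ℚ-ring : AlmostCommutativeRing _ _
ℚ-ring = fromCommutativeRing ℚₚ.+-*-commutativeRing λ x → zero? (0ℚ ≟ℚ x)
  where
  zero? : ∀ {x} → Dec (0ℚ ≡ x) → Maybe (0ℚ ≡ x)
  zero? (yes p) = just p
  zero? (no _) = nothing

-- Order arithmetic in ℚ and the embedding of ℕ

0≤-* : ∀ {p q} → 0ℚ ≤ℚ p → 0ℚ ≤ℚ q → 0ℚ ≤ℚ p * q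
0≤-* {p} {q} 0≤p 0≤q =
  ℚₚ.nonNegative⁻¹ (p * q) {{ℚₚ.nonNeg*nonNeg⇒nonNeg p {{nonNegative 0≤p}} q {{nonNegative 0≤q}}}}

0≤-+ : ∀ {p q} → 0ℚ ≤ℚ p → 0ℚ ≤ℚ q → 0ℚ ≤ℚ p + q
0≤-+ = ℚₚ.+-mono-≤

0≤-square : ∀ p → 0ℚ ≤ℚ p * p
0≤-square p with ℚₚ.≤-total 0ℚ p
... | inj₁ 0≤p = 0≤-* 0≤p 0≤p
... | inj₂ p≤0 = subst (0ℚ ≤ℚ_) (neg² p) (0≤-* 0≤-p 0≤-p)
  where
  neg² : ∀ p → (- p) * (- p) ≡ p * p
  neg² = solve-∀ ℚ-ring
  0≤-p : 0ℚ ≤ℚ - p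
  0≤-p = ℚₚ.neg-antimono-≤ p≤0

-- The main inequalities take this form: the difference is rewritten by the ring solver into a
-- visibly nonnegative expression `r`.
≤-from-difference : ∀ {p q r} → 0ℚ ≤ℚ r → q - p ≡ r → p ≤ℚ q
≤-from-difference {p} {q} 0≤r eq =
  subst₂ _≤ℚ_ (ℚₚ.+-identityʳ p) (p+[q-p] p q)
    (ℚₚ.+-monoʳ-≤ p (subst (0ℚ ≤ℚ_) (sym eq) 0≤r))
  where
  p+[q-p] : ∀ p q → p + (q - p) ≡ q
  p+[q-p] = solve-∀ ℚ-ring

difference-nonneg : ∀ {p q} → p ≤ℚ q → 0ℚ ≤ℚ q - p
difference-nonneg {p} {q} p≤q =
  subst (_≤ℚ q - p) (ℚₚ.+-inverseʳ p) (ℚₚ.+-monoˡ-≤ (- p) p≤q)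

*-monoˡ-≤ : ∀ {p q r} → 0ℚ ≤ℚ r → p ≤ℚ q → r * p ≤ℚ r * q
*-monoˡ-≤ {r = r} 0≤r = ℚₚ.*-monoˡ-≤-nonNeg r {{nonNegative 0≤r}}

private
  toℚᵘ-ι : ∀ k → toℚᵘ (ℕtoℚ k) ℚᵘ.≃ ℚᵘ.mkℚᵘ (ℤ.+ k) 0
  toℚᵘ-ι k = ℚₚ.toℚᵘ-fromℚᵘ (ℚᵘ.mkℚᵘ (ℤ.+ k) 0)

-- `_/_` normalises its fraction, which is stuck on open terms, so additivity is checked on
-- unnormalised fractions with denominator 1.
ℕtoℚ-+ : ∀ a b → ℕtoℚ (a ℕ.+ b) ≡ ℕtoℚ a + ℕtoℚ b
ℕtoℚ-+ a b = ℚₚ.toℚᵘ-injective (begin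
  toℚᵘ (ℕtoℚ (a ℕ.+ b))                             ≈⟨ toℚᵘ-ι (a ℕ.+ b) ⟩
  ℚᵘ.mkℚᵘ (ℤ.+ (a ℕ.+ b)) 0                         ≈⟨ ℚᵘ.*≡* (cong (ℤ._* ℤ.+ 1) (cong₂ ℤ._+_ (sym (ℤₚ.*-identityʳ (ℤ.+ a))) (sym (ℤₚ.*-identityʳ (ℤ.+ b))))) ⟩
  ℚᵘ.mkℚᵘ (ℤ.+ a) 0 ℚᵘ.+ ℚᵘ.mkℚᵘ (ℤ.+ b) 0          ≈⟨ ℚᵘₚ.+-cong (ℚᵘₚ.≃-sym (toℚᵘ-ι a)) (ℚᵘₚ.≃-sym (toℚᵘ-ι b)) ⟩
  toℚᵘ (ℕtoℚ a) ℚᵘ.+ toℚᵘ (ℕtoℚ b)                  ≈⟨ ℚᵘₚ.≃-sym (ℚₚ.toℚᵘ-homo-+ (ℕtoℚ a) (ℕtoℚ b)) ⟩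
  toℚᵘ (ℕtoℚ a + ℕtoℚ b)                            ∎)
  where open ℚᵘₚ.≃-Reasoning

ℕtoℚ-* : ∀ a b → ℕtoℚ (a ℕ.* b) ≡ ℕtoℚ a * ℕtoℚ b
ℕtoℚ-* zero b = sym (ℚₚ.*-zeroˡ (ℕtoℚ b))
ℕtoℚ-* (suc a) b = begin
  ℕtoℚ (b ℕ.+ a ℕ.* b)           ≡⟨ ℕtoℚ-+ b (a ℕ.* b) ⟩
  ℕtoℚ b + ℕtoℚ (a ℕ.* b)        ≡⟨ cong (ℕtoℚ b +_) (ℕtoℚ-* a b) ⟩
  ℕtoℚ b + ℕtoℚ a * ℕtoℚ b       ≡⟨ [1+a]b (ℕtoℚ a) (ℕtoℚ b) ⟩
  (1ℚ + ℕtoℚ a) * ℕtoℚ b         ≡⟨ cong (_* ℕtoℚ b) (sym (ℕtoℚ-+ 1 a)) ⟩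
  ℕtoℚ (suc a) * ℕtoℚ b          ∎
  where
  open ≡-Reasoning
  [1+a]b : ∀ a b → b + a * b ≡ (1ℚ + a) * b
  [1+a]b = solve-∀ ℚ-ring

ℕtoℚ-suc : ∀ a → ℕtoℚ (suc a) ≡ 1ℚ + ℕtoℚ a
ℕtoℚ-suc = ℕtoℚ-+ 1

0≤ℕtoℚ : ∀ k → 0ℚ ≤ℚ ℕtoℚ k
0≤ℕtoℚ zero = ℚₚ.≤-refl
0≤ℕtoℚ (suc k) = subst (0ℚ ≤ℚ_) (sym (ℕtoℚ-suc k)) (0≤-+ {1ℚ} (ℚₚ.nonNegative⁻¹ 1ℚ) (0≤ℕtoℚ k))

-- Finite sums

Σ-cong : ∀ {n} {f g : Fin n → ℚ} → (∀ i → f i ≡ g i) → Σℚ f ≡ Σℚ g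
Σ-cong {zero} eq = refl
Σ-cong {suc n} eq = cong₂ _+_ (eq Fin.zero) (Σ-cong (λ i → eq (Fin.suc i)))

Σ-zero : ∀ n → Σℚ {n} (λ _ → 0ℚ) ≡ 0ℚ
Σ-zero zero = refl
Σ-zero (suc n) = trans (ℚₚ.+-identityˡ _) (Σ-zero n)

Σ-+ : ∀ {n} (f g : Fin n → ℚ) → Σℚ (λ i → f i + g i) ≡ Σℚ f + Σℚ g
Σ-+ {zero} f g = refl
Σ-+ {suc n} f g = trans (cong (f Fin.zero + g Fin.zero +_) (Σ-+ (λ i → f (Fin.suc i)) (λ i → g (Fin.suc i)))) (interchange (f Fin.zero) (g Fin.zero) _ _)
  where
  interchange : ∀ a b c d → (a + b) + (c + d) ≡ (a + c) + (b + d)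
  interchange = solve-∀ ℚ-ring

Σ-*ˡ : ∀ {n} c (f : Fin n → ℚ) → Σℚ (λ i → c * f i) ≡ c * Σℚ f
Σ-*ˡ {zero} c f = sym (ℚₚ.*-zeroʳ c)
Σ-*ˡ {suc n} c f = trans (cong (c * f Fin.zero +_) (Σ-*ˡ c (λ i → f (Fin.suc i)))) (sym (ℚₚ.*-distribˡ-+ c _ _))

Σ-*ʳ : ∀ {n} c (f : Fin n → ℚ) → Σℚ (λ i → f i * c) ≡ Σℚ f * c
Σ-*ʳ c f = trans (Σ-cong (λ i → ℚₚ.*-comm (f i) c)) (trans (Σ-*ˡ c f) (ℚₚ.*-comm c (Σℚ f)))

Σ-- : ∀ {n} (f g : Fin n → ℚ) → Σℚ (λ i → f i - g i) ≡ Σℚ f - Σℚ g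
Σ-- {zero} f g = refl
Σ-- {suc n} f g = trans (cong (f Fin.zero - g Fin.zero +_) (Σ-- (λ i → f (Fin.suc i)) (λ i → g (Fin.suc i)))) (interchange (f Fin.zero) (g Fin.zero) _ _)
  where
  interchange : ∀ a b c d → (a - b) + (c - d) ≡ (a + c) - (b + d)
  interchange = solve-∀ ℚ-ring

Σ-const : ∀ n c → Σℚ {n} (λ _ → c) ≡ ℕtoℚ n * c
Σ-const zero c = sym (ℚₚ.*-zeroˡ c)
Σ-const (suc n) c = begin
  c + Σℚ {n} (λ _ → c)     ≡⟨ cong (c +_) (Σ-const n c) ⟩
  c + ℕtoℚ n * c           ≡⟨ [1+a]b (ℕtoℚ n) c ⟩
  (1ℚ + ℕtoℚ n) * c        ≡⟨ cong (_* c) (sym (ℕtoℚ-suc n)) ⟩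
  ℕtoℚ (suc n) * c         ∎
  where
  open ≡-Reasoning
  [1+a]b : ∀ a b → b + a * b ≡ (1ℚ + a) * b
  [1+a]b = solve-∀ ℚ-ring

Σ-swap : ∀ {m n} (f : Fin m → Fin n → ℚ) → Σℚ (λ i → Σℚ (λ j → f i j)) ≡ Σℚ (λ j → Σℚ (λ i → f i j))
Σ-swap {zero} {n} f = sym (Σ-zero n)
Σ-swap {suc m} f = trans (cong (Σℚ (f Fin.zero) +_) (Σ-swap (λ i → f (Fin.suc i)))) (sym (Σ-+ (f Fin.zero) _))

Σ-mono : ∀ {n} {f g : Fin n → ℚ} → (∀ i → f i ≤ℚ g i) → Σℚ f ≤ℚ Σℚ g
Σ-mono {zero} le = ℚₚ.≤-refl
Σ-mono {suc n} le = ℚₚ.+-mono-≤ (le Fin.zero) (Σ-mono (λ i → le (Fin.suc i)))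

Σ-nonneg : ∀ {n} {f : Fin n → ℚ} → (∀ i → 0ℚ ≤ℚ f i) → 0ℚ ≤ℚ Σℚ f
Σ-nonneg {n} {f} le = subst (_≤ℚ Σℚ f) (Σ-zero n) (Σ-mono le)

ℕtoℚ-Σ : ∀ {n} (f : Fin n → ℕ) → ℕtoℚ (Σℕ f) ≡ Σℚ (λ i → ℕtoℚ (f i))
ℕtoℚ-Σ {zero} f = refl
ℕtoℚ-Σ {suc n} f = trans (ℕtoℚ-+ (f Fin.zero) _) (cong (ℕtoℚ (f Fin.zero) +_) (ℕtoℚ-Σ (λ i → f (Fin.suc i))))

-- Recursion on both indices matches the unfolding of `Σℚ` and lets `δ` compute on the named
-- vertices of the extremal graph.
δ : ∀ {n} → Fin n → Fin n → ℚ
δ Fin.zero Fin.zero = 1ℚ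
δ Fin.zero (Fin.suc j) = 0ℚ
δ (Fin.suc i) Fin.zero = 0ℚ
δ (Fin.suc i) (Fin.suc j) = δ i j

δ-refl : ∀ {n} (i : Fin n) → δ i i ≡ 1ℚ
δ-refl Fin.zero = refl
δ-refl (Fin.suc i) = δ-refl i

δ-≢ : ∀ {n} {i j : Fin n} → i ≢ j → δ i j ≡ 0ℚ
δ-≢ {i = Fin.zero} {Fin.zero} ne with () ← ne refl
δ-≢ {i = Fin.zero} {Fin.suc j} ne = refl
δ-≢ {i = Fin.suc i} {Fin.zero} ne = refl
δ-≢ {i = Fin.suc i} {Fin.suc j} ne = δ-≢ (λ eq → ne (cong Fin.suc eq))

δ-sym : ∀ {n} (i j : Fin n) → δ i j ≡ δ j i
δ-sym Fin.zero Fin.zero = refl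
δ-sym Fin.zero (Fin.suc j) = refl
δ-sym (Fin.suc i) Fin.zero = refl
δ-sym (Fin.suc i) (Fin.suc j) = δ-sym i j

Σ-δ : ∀ {n} (i : Fin n) (f : Fin n → ℚ) → Σℚ (λ j → δ i j * f j) ≡ f i
Σ-δ {suc n} Fin.zero f = begin
  1ℚ * f Fin.zero + Σℚ (λ j → 0ℚ * f (Fin.suc j))
    ≡⟨ cong₂ _+_ (ℚₚ.*-identityˡ (f Fin.zero)) (trans (Σ-cong (λ j → ℚₚ.*-zeroˡ (f (Fin.suc j)))) (Σ-zero n)) ⟩
  f Fin.zero + 0ℚ  ≡⟨ ℚₚ.+-identityʳ _ ⟩
  f Fin.zero       ∎
  where open ≡-Reasoning
Σ-δ {suc n} (Fin.suc i) f = begin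
  0ℚ * f Fin.zero + Σℚ (λ j → δ i j * f (Fin.suc j))
    ≡⟨ cong₂ _+_ (ℚₚ.*-zeroˡ (f Fin.zero)) (Σ-δ i (λ j → f (Fin.suc j))) ⟩
  0ℚ + f (Fin.suc i)  ≡⟨ ℚₚ.+-identityˡ _ ⟩
  f (Fin.suc i)       ∎
  where open ≡-Reasoning

Σ-δ-1 : ∀ {n} (i : Fin n) → Σℚ (λ j → δ i j) ≡ 1ℚ
Σ-δ-1 i = trans (Σ-cong (λ j → sym (ℚₚ.*-identityʳ (δ i j)))) (Σ-δ i (λ _ → 1ℚ))

𝟙 : Bool → ℚ
𝟙 b = if b then 1ℚ else 0ℚ

0≤𝟙 : ∀ b → 0ℚ ≤ℚ 𝟙 b
0≤𝟙 true = ℚₚ.nonNegative⁻¹ 1ℚ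
0≤𝟙 false = ℚₚ.≤-refl

if-𝟙 : ∀ b q → (if b then q else 0ℚ) ≡ 𝟙 b * q
if-𝟙 true q = sym (ℚₚ.*-identityˡ q)
if-𝟙 false q = sym (ℚₚ.*-zeroˡ q)

b2ℕ-𝟙 : ∀ b → ℕtoℚ (b2ℕ b) ≡ 𝟙 b
b2ℕ-𝟙 true = refl
b2ℕ-𝟙 false = refl

true≢false : ∀ {b} → b ≡ true → b ≡ false → ⊥
true≢false refl ()

∧-split : ∀ {a b} → a ∧ b ≡ true → a ≡ true × b ≡ true
∧-split {true} {true} refl = refl , refl

does-sound : ∀ {ℓ} {P : Set ℓ} (p? : Dec P) → does p? ≡ true → P
does-sound (yes p) refl = p

-- Walks and geodesics

_⊆ᴳ_ : ∀ {n} → Graph n → Graph n → Set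
H ⊆ᴳ G = ∀ {u v} → H u v ≡ true → G u v ≡ true

Symmetric : ∀ {n} → Graph n → Set
Symmetric G = ∀ u v → G u v ≡ G v u

module _ {n} {G : Graph n} where

  infixr 5 _++ʷ_
  _++ʷ_ : ∀ {u v w} → Walk G u v → Walk G v w → Walk G u w
  nil ++ʷ q = q
  cons e p ++ʷ q = cons e (p ++ʷ q)

  reverseʷ : Symmetric G → ∀ {u v} → Walk G u v → Walk G v u
  reverseʷ sy nil = nil
  reverseʷ sy (cons {u} {w} e p) = reverseʷ sy p ++ʷ cons (trans (sy w u) e) nil

  arcʷ : (F : ℕ → Fin n) (a k : ℕ) → (∀ i → a ℕ.≤ i → i ℕ.< k ℕ.+ a → G (F i) (F (suc i)) ≡ true) →
         Walk G (F a) (F (k ℕ.+ a))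
  arcʷ F a zero e = nil
  arcʷ F a (suc k) e =
    arcʷ F a k (λ i a≤i i<k+a → e i a≤i (ℕₚ.m<n⇒m<1+n i<k+a)) ++ʷ
    cons (e (k ℕ.+ a) (ℕₚ.m≤n+m a k) ℕₚ.≤-refl) nil

map-walk : ∀ {n} {G H : Graph n} → H ⊆ᴳ G → ∀ {u v} → Walk H u v → Walk G u v
map-walk sub nil = nil
map-walk sub (cons e p) = cons (sub e) (map-walk sub p)

module _ {n} (H : Graph n) (t : Fin n) where

  -- Fixing the length makes existence of a walk decidable by finite search, which is what allows a
  -- shortest one to be chosen.
  WalkOfLength : ℕ → Fin n → Set
  WalkOfLength zero v = v ≡ t
  WalkOfLength (suc k) v = ∃ λ w → H v w ≡ true × WalkOfLength k w

  walkOfLength? : ∀ k v → Dec (WalkOfLength k v)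
  walkOfLength? zero v = v Fin.≟ t
  walkOfLength? (suc k) v = Finₚ.any? (λ w → (H v w Boolₚ.≟ true) ×-dec walkOfLength? k w)

  Distance : Fin n → ℕ → Set
  Distance v k = WalkOfLength k v × (∀ j → j ℕ.< k → ¬ WalkOfLength j v)

  distance-unique : ∀ {v k l} → Distance v k → Distance v l → k ≡ l
  distance-unique {k = k} {l} (wk , k-min) (wl , l-min) with ℕₚ.<-cmp k l
  ... | tri< k<l _ _ = ⊥-elim (l-min k k<l wk)
  ... | tri≈ _ k≡l _ = k≡l
  ... | tri> _ _ l<k = ⊥-elim (k-min l l<k wl)

  distance-step : ∀ {v k} → Distance v (suc k) → ∃ λ w → H v w ≡ true × Distance w k
  distance-step ((w , e , p) , min) = w , e , p , λ j j<k q → min (suc j) (s≤s j<k) (w , e , q)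

  -- Least-number search, bounded by the length of the given walk.
  walk⇒distance : ∀ {v} → Walk H v t → ∃ (Distance v)
  walk⇒distance {v} p = search′ (toLength p)
    where
    toLength : ∀ {v} → Walk H v t → ∃ λ k → WalkOfLength k v
    toLength nil = zero , refl
    toLength (cons {w = w} e p) = suc (proj₁ (toLength p)) , w , e , proj₂ (toLength p)
    search : ∀ k → ∃ (Distance v) ⊎ (∀ j → j ℕ.< k → ¬ WalkOfLength j v)
    search zero = inj₂ λ _ ()
    search (suc k) with search k
    ... | inj₁ d = inj₁ d
    ... | inj₂ none with walkOfLength? k v
    ... | yes q = inj₁ (k , q , none)
    ... | no ¬q = inj₂ λ j j<1+k q → case-≤ j (ℕₚ.m<1+n⇒m<n∨m≡n j<1+k) q
      where
      case-≤ : ∀ j → j ℕ.< k ⊎ j ≡ k → ¬ WalkOfLength j v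
      case-≤ j (inj₁ j<k) = none j j<k
      case-≤ j (inj₂ refl) = ¬q
    search′ : (∃ λ k → WalkOfLength k v) → ∃ (Distance v)
    search′ (k , q) with search k
    ... | inj₁ d = d
    ... | inj₂ none = k , q , none

  -- Recording the exact remaining distance `L ∸ i` at position `i` makes distinctness of the
  -- vertices immediate. Values of `f` beyond `L` are arbitrary.
  Geodesic : Fin n → ℕ → Set
  Geodesic a L = ∃ λ (f : ℕ → Fin n) → f 0 ≡ a ×
    (∀ i → i ℕ.≤ L → Distance (f i) (L ℕ.∸ i)) × (∀ i → i ℕ.< L → H (f i) (f (suc i)) ≡ true)

  geodesic : ∀ L {a} → Distance a L → Geodesic a L
  geodesic zero {a} d = (λ _ → a) , refl , (λ { zero z≤n → d }) , λ _ ()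
  geodesic (suc L) {a} d with distance-step d
  ... | w , e , dw with geodesic L dw
  ... | f , f0 , dist , edge =
    (λ { zero → a ; (suc i) → f i }) , refl ,
    (λ { zero _ → d ; (suc i) (s≤s i≤L) → dist i i≤L }) ,
    (λ { zero _ → trans (cong (H a) f0) e ; (suc i) (s≤s i<L) → edge i i<L })

-- Cycles

edgeOf? : ∀ {n} (x y u v : Fin n) → Dec ((x ≡ u × y ≡ v) ⊎ (x ≡ v × y ≡ u))
edgeOf? x y u v = ((x Fin.≟ u) ×-dec (y Fin.≟ v)) ⊎-dec ((x Fin.≟ v) ×-dec (y Fin.≟ u))

abstract
  edgeOf : ∀ {n} → Fin n → Fin n → EdgeSet n
  edgeOf x y u v = does (edgeOf? x y u v)

  edgeOf-true : ∀ {n} {x y u v : Fin n} → (x ≡ u × y ≡ v) ⊎ (x ≡ v × y ≡ u) → edgeOf x y u v ≡ true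
  edgeOf-true {x = x} {y} {u} {v} = dec-true (edgeOf? x y u v)

  edgeOf-false : ∀ {n} {x y u v : Fin n} → ¬ ((x ≡ u × y ≡ v) ⊎ (x ≡ v × y ≡ u)) → edgeOf x y u v ≡ false
  edgeOf-false {x = x} {y} {u} {v} = dec-false (edgeOf? x y u v)

  edgeOf-sound : ∀ {n} {x y u v : Fin n} → edgeOf x y u v ≡ true → (x ≡ u × y ≡ v) ⊎ (x ≡ v × y ≡ u)
  edgeOf-sound {x = x} {y} {u} {v} = does-sound (edgeOf? x y u v)

  edgeOf-sym : ∀ {n} (x y : Fin n) → Symmetric (edgeOf x y)
  edgeOf-sym x y u v = Boolₚ.∨-comm (does (x Fin.≟ u) ∧ does (y Fin.≟ v)) _

edgeOf-self : ∀ {n} (x y : Fin n) → edgeOf x y x y ≡ true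
edgeOf-self x y = edgeOf-true (inj₁ (refl , refl))

infixl 6 _∖_

abstract
  _∖_ : ∀ {n} → Graph n → EdgeSet n → Graph n
  (G ∖ D) u v = G u v ∧ not (D u v)

  ∖-⊆ : ∀ {n} {G : Graph n} {D : EdgeSet n} {u v} → (G ∖ D) u v ≡ true → G u v ≡ true
  ∖-⊆ {G = G} {D} {u} {v} e = proj₁ (∧-split {G u v} e)

  ∖-removes : ∀ {n} {G : Graph n} {D : EdgeSet n} {u v} → (G ∖ D) u v ≡ true → D u v ≡ false
  ∖-removes {G = G} {D} {u} {v} e with D u v | ∧-split {G u v} e
  ... | false | _ = refl
  ... | true | ()

  ∖-removed : ∀ {n} {G : Graph n} {D : EdgeSet n} {u v} → D u v ≡ true → (G ∖ D) u v ≡ false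
  ∖-removed {G = G} {u = u} {v} d rewrite d = Boolₚ.∧-zeroʳ (G u v)

  ∖-keeps : ∀ {n} {G : Graph n} {D : EdgeSet n} {u v} → G u v ≡ true → D u v ≡ false → (G ∖ D) u v ≡ true
  ∖-keeps e d rewrite e | d = refl

  ∖-sym : ∀ {n} {G : Graph n} {D : EdgeSet n} → Symmetric G → Symmetric D → Symmetric (G ∖ D)
  ∖-sym gs ds u v = cong₂ (λ a b → a ∧ not b) (gs u v) (ds u v)

cnext-< : ∀ {m} (i : Fin (suc m)) → toℕ i ℕ.< m → toℕ (cnext i) ≡ suc (toℕ i)
cnext-< {m} i i<m = trans (Finₚ.toℕ-fromℕ< _) (m<n⇒m%n≡m (s≤s i<m))

cnext-last : ∀ {m} (i : Fin (suc m)) → toℕ i ≡ m → toℕ (cnext i) ≡ 0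
cnext-last {m} i i≡m = trans (Finₚ.toℕ-fromℕ< _) (trans (cong (λ k → suc k % suc m) i≡m) (n%n m))
  where
  n%n : ∀ m → suc m % suc m ≡ 0
  n%n m = trans (sym (m≤n⇒[n∸m]%m≡n%m (ℕₚ.≤-refl {suc m}))) (cong (_% suc m) (ℕₚ.n∸n≡0 (suc m)))

-- A shortest walk from `a` to `t` in `H` has distinct vertices, and the edge `ta` closes it into a
-- cycle. The last conclusion records where the edges of the cycle come from, so that it can be
-- shown to avoid prescribed edges.
cycle-through : ∀ {n} {G H : Graph n} (a t : Fin n) → H ⊆ᴳ G → G t a ≡ true → H a t ≡ false → a ≢ t → Walk H a t →
  ∃ λ C → IsCycle G C × C a t ≡ true ×
    (∀ u v → C u v ≡ true → H u v ≡ true ⊎ H v u ≡ true ⊎ edgeOf a t u v ≡ true)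
cycle-through {n} {G} {H} a t sub Gta Hat a≢t p with walk⇒distance H t p
-- Lengths 0 and 1 are excluded by `a≢t` and `Hat`; length `2 + m` yields the `3 + m` vertices that
-- `IsCycle` demands.
... | zero , (a≡t , _) = ⊥-elim (a≢t a≡t)
... | suc zero , ((_ , e , refl) , _) = ⊥-elim (true≢false e Hat)
... | suc (suc m) , d with geodesic H t (suc (suc m)) d
... | f , f0 , dist , edge = C , (m , F , F-inj , F-edge , C-sound , F-C) , C-at , C-in
  where
  L = suc (suc m)
  F : Fin (suc L) → Fin n
  F i = f (toℕ i)
  i≤L : ∀ (i : Fin (suc L)) → toℕ i ℕ.≤ L
  i≤L i = ℕₚ.<⇒≤pred (Finₚ.toℕ<n i)
  fL : f L ≡ t
  fL = proj₁ (subst (Distance H t (f L)) (ℕₚ.n∸n≡0 L) (dist L ℕₚ.≤-refl))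
  F-inj : ∀ i j → F i ≡ F j → i ≡ j
  F-inj i j eq = Finₚ.toℕ-injective (ℕₚ.∸-cancelˡ-≡ (i≤L i) (i≤L j)
    (distance-unique H t (dist (toℕ i) (i≤L i))
      (subst (λ x → Distance H t x (L ℕ.∸ toℕ j)) (sym eq) (dist (toℕ j) (i≤L j)))))
  -- Every step lies in `H` except the one at the last position, where `cnext` wraps round and the
  -- closing edge from `t` to `a` is used.
  F-step : ∀ i → H (F i) (F (cnext i)) ≡ true ⊎ (F i ≡ t × F (cnext i) ≡ a)
  F-step i with ℕₚ.m≤n⇒m<n∨m≡n (i≤L i)
  ... | inj₁ i<L = inj₁ (trans (cong (λ k → H (F i) (f k)) (cnext-< i i<L)) (edge (toℕ i) i<L))
  ... | inj₂ i≡L = inj₂ (trans (cong f i≡L) fL , trans (cong f (cnext-last i i≡L)) f0)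
  F-edge : ∀ i → G (F i) (F (cnext i)) ≡ true
  F-edge i with F-step i
  ... | inj₁ e = sub e
  ... | inj₂ (eq₁ , eq₂) = trans (cong₂ G eq₁ eq₂) Gta
  On : Fin n → Fin n → Fin (suc L) → Set
  On u v i = (F i ≡ u × F (cnext i) ≡ v) ⊎ (F i ≡ v × F (cnext i) ≡ u)
  on? : ∀ u v → Dec (∃ (On u v))
  on? u v = Finₚ.any? (λ i → edgeOf? (F i) (F (cnext i)) u v)
  C : EdgeSet n
  C u v = does (on? u v)
  C-sound : ∀ u v → C u v ≡ true → ∃ (On u v)
  C-sound u v = does-sound (on? u v)
  F-C : ∀ i → C (F i) (F (cnext i)) ≡ true × C (F (cnext i)) (F i) ≡ true
  F-C i = dec-true (on? _ _) (i , inj₁ (refl , refl)) , dec-true (on? _ _) (i , inj₂ (refl , refl))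
  C-at : C a t ≡ true
  C-at = dec-true (on? a t) (Fin.fromℕ L , inj₂
    ( trans (cong f (Finₚ.toℕ-fromℕ L)) fL
    , trans (cong f (cnext-last (Fin.fromℕ L) (Finₚ.toℕ-fromℕ L))) f0))
  C-in : ∀ u v → C u v ≡ true → H u v ≡ true ⊎ H v u ≡ true ⊎ edgeOf a t u v ≡ true
  C-in u v e with C-sound u v e
  ... | i , o with F-step i
  C-in u v e | i , inj₁ (refl , refl) | inj₁ h = inj₁ h
  C-in u v e | i , inj₂ (refl , refl) | inj₁ h = inj₂ (inj₁ h)
  C-in u v e | i , inj₁ (refl , refl) | inj₂ (p₁ , p₂) = inj₂ (inj₂ (edgeOf-true (inj₂ (sym p₂ , sym p₁))))
  C-in u v e | i , inj₂ (refl , refl) | inj₂ (p₁ , p₂) = inj₂ (inj₂ (edgeOf-true (inj₁ (sym p₂ , sym p₁))))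

-- Rotations of a cyclic index set

module Shift {m} (i : Fin (suc m)) where

  -- Moves the distinguished position `i` to 0, so that an arc of the cycle starting after `i`
  -- becomes an interval of natural numbers.
  shift : ℕ → Fin (suc m)
  shift k = fromℕ< (m%n<n (toℕ i ℕ.+ k) (suc m))

  toℕ-shift : ∀ k → toℕ (shift k) ≡ (toℕ i ℕ.+ k) % suc m
  toℕ-shift k = Finₚ.toℕ-fromℕ< _

  shift-0 : shift 0 ≡ i
  shift-0 = Finₚ.toℕ-injective (trans (toℕ-shift 0)
    (trans (cong (_% suc m) (ℕₚ.+-identityʳ (toℕ i))) (m<n⇒m%n≡m (Finₚ.toℕ<n i))))

  shift-suc : ∀ k → cnext (shift k) ≡ shift (suc k)
  shift-suc k = Finₚ.toℕ-injective (begin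
    toℕ (cnext (shift k))                              ≡⟨ Finₚ.toℕ-fromℕ< _ ⟩
    suc (toℕ (shift k)) % suc m                        ≡⟨ cong (λ x → suc x % suc m) (toℕ-shift k) ⟩
    (1 ℕ.+ x % suc m) % suc m                          ≡⟨ %-distribˡ-+ 1 (x % suc m) (suc m) ⟩
    (1 % suc m ℕ.+ x % suc m % suc m) % suc m          ≡⟨ cong (λ y → (1 % suc m ℕ.+ y) % suc m) (m%n%n≡m%n x (suc m)) ⟩
    (1 % suc m ℕ.+ x % suc m) % suc m                  ≡⟨ sym (%-distribˡ-+ 1 x (suc m)) ⟩
    suc x % suc m                                      ≡⟨ cong (_% suc m) (sym (ℕₚ.+-suc (toℕ i) k)) ⟩
    (toℕ i ℕ.+ suc k) % suc m                          ≡⟨ sym (toℕ-shift (suc k)) ⟩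
    toℕ (shift (suc k))                                ∎)
    where
    open ≡-Reasoning
    x = toℕ i ℕ.+ k

  shift-period : shift (suc m) ≡ shift 0
  shift-period = Finₚ.toℕ-injective (begin
    toℕ (shift (suc m))            ≡⟨ toℕ-shift (suc m) ⟩
    (toℕ i ℕ.+ suc m) % suc m      ≡⟨ [m+n]%n≡m%n (toℕ i) (suc m) ⟩
    toℕ i % suc m                  ≡⟨ cong (_% suc m) (sym (ℕₚ.+-identityʳ (toℕ i))) ⟩
    (toℕ i ℕ.+ 0) % suc m          ≡⟨ sym (toℕ-shift 0) ⟩
    toℕ (shift 0)                  ∎)
    where open ≡-Reasoning

  -- Both summands are below `suc m`, so at most one wrap occurs; this replaces the remainder by two
  -- linear cases.
  shift-value : ∀ k → k ℕ.< suc m →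
    toℕ i ℕ.+ k ≡ toℕ (shift k) ⊎ toℕ i ℕ.+ k ≡ suc m ℕ.+ toℕ (shift k)
  shift-value k k<g with toℕ i ℕ.+ k ℕ.<? suc m
  ... | yes lt = inj₁ (sym (trans (toℕ-shift k) (m<n⇒m%n≡m lt)))
  ... | no ¬lt = inj₂ (begin
    toℕ i ℕ.+ k                                     ≡⟨ sym (ℕₚ.m+[n∸m]≡n g≤) ⟩
    suc m ℕ.+ (toℕ i ℕ.+ k ℕ.∸ suc m)               ≡⟨ cong (suc m ℕ.+_) (sym (m<n⇒m%n≡m rest<)) ⟩
    suc m ℕ.+ (toℕ i ℕ.+ k ℕ.∸ suc m) % suc m       ≡⟨ cong (suc m ℕ.+_) (m≤n⇒[n∸m]%m≡n%m g≤) ⟩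
    suc m ℕ.+ (toℕ i ℕ.+ k) % suc m                 ≡⟨ cong (suc m ℕ.+_) (sym (toℕ-shift k)) ⟩
    suc m ℕ.+ toℕ (shift k)                         ∎)
    where
    open ≡-Reasoning
    g≤ = ℕₚ.≮⇒≥ ¬lt
    rest< : toℕ i ℕ.+ k ℕ.∸ suc m ℕ.< suc m
    rest< = ℕₚ.m<n+o⇒m∸n<o (toℕ i ℕ.+ k) (suc m) (ℕₚ.+-mono-< (Finₚ.toℕ<n i) k<g)

  private
    wrap : ∀ k l {x y} → l ℕ.< suc m → toℕ i ℕ.+ k ≡ x → toℕ i ℕ.+ l ≡ suc m ℕ.+ y → x ≡ y → ⊥
    wrap k l l<g refl q refl = ℕₚ.<⇒≱ l<g (subst (suc m ℕ.≤_) (sym l≡) (ℕₚ.m≤m+n (suc m) k))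
      where
      l≡ : l ≡ suc m ℕ.+ k
      l≡ = ℕₚ.+-cancelˡ-≡ (toℕ i) l (suc m ℕ.+ k) (trans q (begin
        suc m ℕ.+ (toℕ i ℕ.+ k)  ≡⟨ sym (ℕₚ.+-assoc (suc m) (toℕ i) k) ⟩
        suc m ℕ.+ toℕ i ℕ.+ k    ≡⟨ cong (ℕ._+ k) (ℕₚ.+-comm (suc m) (toℕ i)) ⟩
        toℕ i ℕ.+ suc m ℕ.+ k    ≡⟨ ℕₚ.+-assoc (toℕ i) (suc m) k ⟩
        toℕ i ℕ.+ (suc m ℕ.+ k)  ∎))
        where open ≡-Reasoning

  shift-injective : ∀ {k l} → k ℕ.< suc m → l ℕ.< suc m → shift k ≡ shift l → k ≡ l
  shift-injective {k} {l} k<g l<g eq with shift-value k k<g | shift-value l l<g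
  ... | inj₁ p | inj₁ q = ℕₚ.+-cancelˡ-≡ (toℕ i) k l (trans p (trans (cong toℕ eq) (sym q)))
  ... | inj₂ p | inj₂ q = ℕₚ.+-cancelˡ-≡ (toℕ i) k l (trans p (trans (cong (λ x → suc m ℕ.+ toℕ x) eq) (sym q)))
  ... | inj₂ p | inj₁ q = ⊥-elim (wrap l k k<g q p (cong toℕ (sym eq)))
  ... | inj₁ p | inj₂ q = ⊥-elim (wrap k l l<g p q (cong toℕ eq))

  shift-surjective : ∀ j → ∃ λ k → k ℕ.< suc m × shift k ≡ j
  shift-surjective j with toℕ i ℕ.≤? toℕ j
  ... | yes i≤j = toℕ j ℕ.∸ toℕ i , ℕₚ.≤-<-trans (ℕₚ.m∸n≤m (toℕ j) (toℕ i)) (Finₚ.toℕ<n j) ,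
    Finₚ.toℕ-injective (trans (toℕ-shift _)
      (trans (cong (_% suc m) (ℕₚ.m+[n∸m]≡n i≤j)) (m<n⇒m%n≡m (Finₚ.toℕ<n j))))
  -- Here `j` precedes `i` and is reached only after wrapping once.
  ... | no i≰j = suc m ℕ.∸ toℕ i ℕ.+ toℕ j ,
    (begin-strict
      suc m ℕ.∸ toℕ i ℕ.+ toℕ j     <⟨ ℕₚ.+-monoʳ-< (suc m ℕ.∸ toℕ i) (ℕₚ.≰⇒> i≰j) ⟩
      suc m ℕ.∸ toℕ i ℕ.+ toℕ i     ≡⟨ ℕₚ.m∸n+n≡m i≤g ⟩
      suc m                         ∎) ,
    Finₚ.toℕ-injective (trans (toℕ-shift _) (trans (cong (_% suc m) i+k)
      (trans ([m+n]%n≡m%n (toℕ j) (suc m)) (m<n⇒m%n≡m (Finₚ.toℕ<n j)))))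
    where
    open ℕₚ.≤-Reasoning
    i≤g : toℕ i ℕ.≤ suc m
    i≤g = ℕₚ.<⇒≤ (Finₚ.toℕ<n i)
    i+k : toℕ i ℕ.+ (suc m ℕ.∸ toℕ i ℕ.+ toℕ j) ≡ toℕ j ℕ.+ suc m
    i+k = trans (sym (ℕₚ.+-assoc (toℕ i) (suc m ℕ.∸ toℕ i) (toℕ j)))
      (trans (cong (ℕ._+ toℕ j) (ℕₚ.m+[n∸m]≡n i≤g)) (ℕₚ.+-comm (suc m) (toℕ j)))

≢true : ∀ {b} → ¬ (b ≡ true) → b ≡ false
≢true {true} h = ⊥-elim (h refl)
≢true {false} h = refl

edgeOf-swap : ∀ {n} {x y a b : Fin n} → edgeOf x y a b ≡ true → edgeOf y x a b ≡ true
edgeOf-swap h with edgeOf-sound h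
... | inj₁ (p , q) = edgeOf-true (inj₂ (q , p))
... | inj₂ (p , q) = edgeOf-true (inj₁ (q , p))

-- Parametrised cycles and their edges

module OnCycle {n} {G : Graph n} {C : EdgeSet n} (isCycle : IsCycle G C) where

  m : ℕ
  m = proj₁ isCycle

  g : ℕ
  g = 3 ℕ.+ m

  f : Fin g → Fin n
  f = proj₁ (proj₂ isCycle)

  f-injective : ∀ i j → f i ≡ f j → i ≡ j
  f-injective = proj₁ (proj₂ (proj₂ isCycle))

  f-edge : ∀ i → G (f i) (f (cnext i)) ≡ true
  f-edge = proj₁ (proj₂ (proj₂ (proj₂ isCycle)))

  C-sound : ∀ u v → C u v ≡ true → ∃ λ i → (f i ≡ u × f (cnext i) ≡ v) ⊎ (f i ≡ v × f (cnext i) ≡ u)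
  C-sound = proj₁ (proj₂ (proj₂ (proj₂ (proj₂ isCycle))))

  C-edge : ∀ i → C (f i) (f (cnext i)) ≡ true
  C-edge i = proj₁ (proj₂ (proj₂ (proj₂ (proj₂ (proj₂ isCycle)))) i)

  C-edge′ : ∀ i → C (f (cnext i)) (f i) ≡ true
  C-edge′ i = proj₂ (proj₂ (proj₂ (proj₂ (proj₂ (proj₂ isCycle)))) i)

  C-sym-true : ∀ {u v} → C u v ≡ true → C v u ≡ true
  C-sym-true {u} {v} c with C-sound u v c
  ... | i , inj₁ (refl , refl) = C-edge′ i
  ... | i , inj₂ (refl , refl) = C-edge i

  C-sym : Symmetric C
  C-sym u v with C u v in p | C v u in q
  ... | true | true = refl
  ... | false | false = refl
  ... | true | false = ⊥-elim (true≢false (C-sym-true p) q)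
  ... | false | true = ⊥-elim (true≢false (C-sym-true q) p)

  C⊆G : Symmetric G → C ⊆ᴳ G
  C⊆G G-sym {u} {v} c with C-sound u v c
  ... | i , inj₁ (refl , refl) = f-edge i
  ... | i , inj₂ (refl , refl) = trans (G-sym _ _) (f-edge i)

  cnext-≢ : ∀ i → cnext i ≢ i
  cnext-≢ i eq = case shift-injective {1} {0} (s≤s (s≤s (z≤n {suc m}))) (s≤s (z≤n {2 ℕ.+ m}))
      (trans (sym (shift-suc 0)) (trans (cong cnext shift-0) (trans eq (sym shift-0)))) of λ ()
    where open Shift i

  -- This is where length at least 3 matters: on two positions, both would carry the same undirected
  -- edge and `e-distinct` would fail.
  cnext²-≢ : ∀ i → cnext (cnext i) ≢ i
  cnext²-≢ i eq = case shift-injective {2} {0} (s≤s (s≤s (s≤s (z≤n {m})))) (s≤s (z≤n {2 ℕ.+ m}))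
      (trans (sym (shift-suc 1)) (trans (cong cnext (sym (shift-suc 0)))
        (trans (cong (λ k → cnext (cnext k)) shift-0) (trans eq (sym shift-0))))) of λ ()
    where open Shift i

  e : Fin g → EdgeSet n
  e i = edgeOf (f i) (f (cnext i))

  e-distinct : ∀ {i j} → i ≢ j → e i (f j) (f (cnext j)) ≡ false
  e-distinct {i} {j} i≢j = edgeOf-false λ
    { (inj₁ (p , _)) → i≢j (f-injective i j p)
    ; (inj₂ (p , q)) → cnext²-≢ i (trans (cong cnext (f-injective _ j q)) (sym (f-injective i _ p))) }

  f-arc : ∀ {H : Graph n} i a b → a ℕ.≤ b →
    (∀ k → a ℕ.≤ k → k ℕ.< b → H (f (Shift.shift i k)) (f (cnext (Shift.shift i k))) ≡ true) →
    Walk H (f (Shift.shift i a)) (f (Shift.shift i b))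
  f-arc {H} i a b a≤b edge = subst (λ x → Walk H (F a) (F x)) (ℕₚ.m∸n+n≡m a≤b)
    (arcʷ F a (b ℕ.∸ a) λ k a≤k k<b → trans (cong (λ x → H (F k) (f x)) (sym (shift-suc k)))
      (edge k a≤k (subst (k ℕ.<_) (ℕₚ.m∸n+n≡m a≤b) k<b)))
    where
    open Shift i
    F : ℕ → Fin n
    F k = f (shift k)

-- Structure of a graph with exactly two cycles

module _ {n} {G : Graph n} (G-sym : Symmetric G) where

  module OneOfTwoCycles {C C′ : EdgeSet n} (isCycle : IsCycle G C)
    (only : ∀ K → IsCycle G K → K ≐ C ⊎ K ≐ C′) where

    open OnCycle {G = G} isCycle

    -- Otherwise G has a cycle through the i-th edge avoiding the j-th, and one through the j-th
    -- avoiding the i-th; together with C these are three different cycles.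
    two-edge-cut : ∀ {i j} → i ≢ j → ¬ Walk (G ∖ e i ∖ e j) (f i) (f (cnext i))
    two-edge-cut {i} {j} i≢j p = contradict (cycle-at i H-i p) (cycle-at j H-j q)
      where
      open Shift i
      H : Graph n
      H = G ∖ e i ∖ e j
      H-sym : Symmetric H
      H-sym = ∖-sym (∖-sym G-sym (edgeOf-sym (f i) _)) (edgeOf-sym (f j) _)
      H-edge : ∀ {k} → k ≢ i → k ≢ j → H (f k) (f (cnext k)) ≡ true
      H-edge {k} k≢i k≢j = ∖-keeps (∖-keeps (f-edge k) (e-distinct (k≢i ∘′ sym))) (e-distinct (k≢j ∘′ sym))
      H-i : H (f i) (f (cnext i)) ≡ false
      H-i = ≢true λ h → true≢false (edgeOf-self (f i) (f (cnext i))) (∖-removes (∖-⊆ h))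
      H-j : H (f j) (f (cnext j)) ≡ false
      H-j = ∖-removed (edgeOf-self (f j) (f (cnext j)))
      t = proj₁ (shift-surjective j)
      t<g = proj₁ (proj₂ (shift-surjective j))
      shift-t = proj₂ (proj₂ (shift-surjective j))
      0<t : 0 ℕ.< t
      0<t = ℕₚ.n≢0⇒n>0 λ t≡0 → i≢j (trans (sym shift-0) (trans (cong shift (sym t≡0)) shift-t))
      shift-≢i : ∀ {k} → 0 ℕ.< k → k ℕ.< g → shift k ≢ i
      shift-≢i 0<k k<g eq = ℕₚ.<⇒≢ 0<k (sym (shift-injective k<g (s≤s z≤n) (trans eq (sym shift-0))))
      shift-≢j : ∀ {k} → k ≢ t → k ℕ.< g → shift k ≢ j
      shift-≢j k≢t k<g eq = k≢t (shift-injective k<g t<g (trans eq (sym shift-t)))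
      arc₁ : Walk H (f (shift 1)) (f (shift t))
      arc₁ = f-arc i 1 t 0<t λ k 0<k k<t →
        H-edge (shift-≢i 0<k (ℕₚ.<-trans k<t t<g)) (shift-≢j (ℕₚ.<⇒≢ k<t) (ℕₚ.<-trans k<t t<g))
      arc₂ : Walk H (f (shift (suc t))) (f (shift g))
      arc₂ = f-arc i (suc t) g t<g λ k t<k k<g →
        H-edge (shift-≢i (ℕₚ.≤-<-trans z≤n t<k) k<g) (shift-≢j (λ k≡t → ℕₚ.<⇒≢ t<k (sym k≡t)) k<g)
      -- The ends of the `j`-th edge are joined by going backwards along the cycle from `f j` to
      -- `f (cnext i)`, crossing to `f i` by the reverse of `p`, and continuing backwards to
      -- `f (cnext j)`.
      q : Walk H (f j) (f (cnext j))
      q = subst₂ (Walk H) (cong f shift-t) (cong f (trans (sym (shift-suc t)) (cong cnext shift-t)))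
        (reverseʷ H-sym arc₁ ++ʷ
         subst₂ (Walk H) (cong f (trans (cong cnext (sym shift-0)) (shift-suc 0)))
           (cong f (trans (sym shift-0) (sym shift-period))) (reverseʷ H-sym p) ++ʷ
         reverseʷ H-sym arc₂)
      H⊆G : H ⊆ᴳ G
      H⊆G h = ∖-⊆ (∖-⊆ h)
      CycleThrough : Fin g → Set
      CycleThrough k = ∃ λ K → IsCycle G K × K (f k) (f (cnext k)) ≡ true ×
        (∀ u v → K u v ≡ true → H u v ≡ true ⊎ H v u ≡ true ⊎ e k u v ≡ true)
      cycle-at : ∀ k → H (f k) (f (cnext k)) ≡ false → Walk H (f k) (f (cnext k)) → CycleThrough k
      cycle-at k h w = cycle-through (f k) (f (cnext k)) H⊆G (trans (G-sym _ _) (f-edge k)) h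
        (λ eq → cnext-≢ k (sym (f-injective k _ eq))) w
      avoids : ∀ (K : EdgeSet n) {k l} → k ≢ l → H (f l) (f (cnext l)) ≡ false →
        (∀ u v → K u v ≡ true → H u v ≡ true ⊎ H v u ≡ true ⊎ e k u v ≡ true) → ¬ (K (f l) (f (cnext l)) ≡ true)
      avoids K k≢l h K-in c with K-in _ _ c
      ... | inj₁ h′ = true≢false h′ h
      ... | inj₂ (inj₁ h′) = true≢false (trans (H-sym _ _) h′) h
      ... | inj₂ (inj₂ same) = true≢false same (e-distinct k≢l)
      contradict : CycleThrough i → CycleThrough j → ⊥
      contradict (K₁ , c₁ , i∈K₁ , K₁-in) (K₂ , c₂ , j∈K₂ , K₂-in) = three (only K₁ c₁) (only K₂ c₂)
        where
        j∉K₁ = avoids K₁ i≢j H-j K₁-in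
        i∉K₂ = avoids K₂ (λ eq → i≢j (sym eq)) H-i K₂-in
        three : K₁ ≐ C ⊎ K₁ ≐ C′ → K₂ ≐ C ⊎ K₂ ≐ C′ → ⊥
        three (inj₁ K₁≐C) _ = j∉K₁ (trans (K₁≐C _ _) (C-edge j))
        three (inj₂ _) (inj₁ K₂≐C) = i∉K₂ (trans (K₂≐C _ _) (C-edge i))
        three (inj₂ K₁≐C′) (inj₂ K₂≐C′) = i∉K₂ (trans (K₂≐C′ _ _) (trans (sym (K₁≐C′ _ _)) i∈K₁))

    ∖C⊆ : ∀ i j → (G ∖ C) ⊆ᴳ (G ∖ e i ∖ e j)
    ∖C⊆ i j {u} {v} h = ∖-keeps (∖-keeps (∖-⊆ h) (not-e i)) (not-e j)
      where
      not-e : ∀ k → e k u v ≡ false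
      not-e k = edgeOf-false λ
        { (inj₁ (refl , refl)) → true≢false (C-edge k) (∖-removes h)
        ; (inj₂ (refl , refl)) → true≢false (C-edge′ k) (∖-removes h) }

    -- A walk from `f i` to `f j` off the cycle, followed by the arc from `f j` back to
    -- `f (cnext i)`, joins the ends of the `i`-th edge while avoiding both that edge and the one
    -- entering `f i`, against `two-edge-cut`.
    separated : ∀ {i j} → i ≢ j → ¬ Walk (G ∖ C) (f i) (f j)
    separated {i} {j} i≢j w = two-edge-cut {i} {p} (λ i≡p → p≢i (sym i≡p))
      (map-walk (∖C⊆ i p) w ++ʷ subst₂ (Walk H) (cong f shift-k) (cong f (trans (sym (shift-suc 0)) (cong cnext shift-0)))
        (reverseʷ H-sym arc))
      where
      open Shift i
      -- The predecessor of `i`. The arc used below ends at rotation `k`, at most `g - 1`, so it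
      -- never traverses the edge at `p`.
      p : Fin g
      p = shift (2 ℕ.+ m)
      H : Graph n
      H = G ∖ e i ∖ e p
      H-sym : Symmetric H
      H-sym = ∖-sym (∖-sym G-sym (edgeOf-sym (f i) _)) (edgeOf-sym (f p) _)
      k = proj₁ (shift-surjective j)
      k<g = proj₁ (proj₂ (shift-surjective j))
      shift-k = proj₂ (proj₂ (shift-surjective j))
      0<k : 0 ℕ.< k
      0<k = ℕₚ.n≢0⇒n>0 λ k≡0 → i≢j (trans (sym shift-0) (trans (cong shift (sym k≡0)) shift-k))
      shift-≢ : ∀ {a b} → a ℕ.< b → b ℕ.< g → shift b ≢ shift a
      shift-≢ a<b b<g eq = ℕₚ.<⇒≢ a<b (sym (shift-injective b<g (ℕₚ.<-trans a<b b<g) eq))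
      p≢i : p ≢ i
      p≢i eq = shift-≢ (s≤s z≤n) ℕₚ.≤-refl (trans eq (sym shift-0))
      arc : Walk H (f (shift 1)) (f (shift k))
      arc = f-arc i 1 k 0<k λ l 0<l l<k → let l<g = ℕₚ.<-trans l<k k<g in
        ∖-keeps (∖-keeps (f-edge (shift l))
          (e-distinct (λ eq → shift-≢ 0<l l<g (sym (trans shift-0 eq)))))
          (e-distinct (shift-≢ (ℕₚ.<-≤-trans l<k (ℕₚ.<⇒≤pred k<g)) ℕₚ.≤-refl))

    -- If `xy` were an edge of `C` outside `C′`, then `C′` without the shared edge `uv` would join
    -- the ends of `uv` avoiding both `uv` and `xy`, two edges of `C`; this contradicts
    -- `two-edge-cut`.
    common-edge⇒⊆ : IsCycle G C′ → ∀ {u v} → C u v ≡ true → C′ u v ≡ true → C ⊆ᴳ C′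
    common-edge⇒⊆ isCycle′ {u} {v} c c′ {x} {y} d with C′ x y in C′xy
    ... | true = refl
    ... | false with C-sound u v c | C-sound x y d | OnCycle.C-sound {G = G} isCycle′ u v c′
    ... | i , i-at | j , j-at | i′ , i′-at = ⊥-elim (two-edge-cut i≢j (orient i-at i′-at))
      where
      open OnCycle {G = G} isCycle′ using () renaming (f to f′; e to e′; g to g′; f-edge to f-edge′; f-arc to f-arc′; C-sym to C′-sym; C-edge to C′-edge; e-distinct to e′-distinct)
      open Shift i′
      ej∉C′ : C′ (f j) (f (cnext j)) ≡ false
      ej∉C′ = at j-at
        where
        at : (f j ≡ x × f (cnext j) ≡ y) ⊎ (f j ≡ y × f (cnext j) ≡ x) → C′ (f j) (f (cnext j)) ≡ false
        at (inj₁ (p , q)) = trans (cong₂ C′ p q) C′xy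
        at (inj₂ (p , q)) = trans (cong₂ C′ p q) (trans (C′-sym y x) C′xy)
      ei∈C′ : C′ (f i) (f (cnext i)) ≡ true
      ei∈C′ = at i-at
        where
        at : (f i ≡ u × f (cnext i) ≡ v) ⊎ (f i ≡ v × f (cnext i) ≡ u) → C′ (f i) (f (cnext i)) ≡ true
        at (inj₁ (p , q)) = trans (cong₂ C′ p q) c′
        at (inj₂ (p , q)) = trans (cong₂ C′ p q) (trans (C′-sym v u) c′)
      i≢j : i ≢ j
      i≢j refl = true≢false ei∈C′ ej∉C′
      H : Graph n
      H = G ∖ e i ∖ e j
      H-sym : Symmetric H
      H-sym = ∖-sym (∖-sym G-sym (edgeOf-sym (f i) _)) (edgeOf-sym (f j) _)
      not-ej : ∀ {a b} → C′ a b ≡ true → e j a b ≡ false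
      not-ej c = edgeOf-false λ
        { (inj₁ (refl , refl)) → true≢false c ej∉C′
        ; (inj₂ (refl , refl)) → true≢false (trans (C′-sym _ _) c) ej∉C′ }
      ei≗e′i′ : ∀ {a b} → e i a b ≡ true → e′ i′ a b ≡ true
      ei≗e′i′ {a} {b} h = relabel i-at i′-at h
        where
        relabel : (f i ≡ u × f (cnext i) ≡ v) ⊎ (f i ≡ v × f (cnext i) ≡ u) →
          (f′ i′ ≡ u × f′ (cnext i′) ≡ v) ⊎ (f′ i′ ≡ v × f′ (cnext i′) ≡ u) →
          edgeOf (f i) (f (cnext i)) a b ≡ true → edgeOf (f′ i′) (f′ (cnext i′)) a b ≡ true
        relabel (inj₁ (p , q)) (inj₁ (p′ , q′)) h rewrite p | q | p′ | q′ = h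
        relabel (inj₂ (p , q)) (inj₂ (p′ , q′)) h rewrite p | q | p′ | q′ = h
        relabel (inj₁ (p , q)) (inj₂ (p′ , q′)) h rewrite p | q | p′ | q′ = edgeOf-swap h
        relabel (inj₂ (p , q)) (inj₁ (p′ , q′)) h rewrite p | q | p′ | q′ = edgeOf-swap h
      -- Once round `C′`, from the far end of the shared edge back to its start. The
      -- parametrisations of `C` and `C′` may traverse that edge in equal or opposite directions,
      -- hence the four cases of `orient`.
      walk′ : Walk H (f′ (cnext i′)) (f′ i′)
      walk′ = subst₂ (Walk H) (cong f′ (trans (sym (shift-suc 0)) (cong cnext shift-0))) (cong f′ (trans shift-period shift-0))
        (f-arc′ i′ 1 g′ (s≤s z≤n) λ k 0<k k<g → ∖-keeps
          (∖-keeps (f-edge′ (shift k)) (≢true λ h → true≢false (ei≗e′i′ h)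
            (e′-distinct (λ eq → ℕₚ.<⇒≢ 0<k (shift-injective (s≤s z≤n) k<g (trans shift-0 eq))))))
          (not-ej (C′-edge (shift k))))
      orient : (f i ≡ u × f (cnext i) ≡ v) ⊎ (f i ≡ v × f (cnext i) ≡ u) →
        (f′ i′ ≡ u × f′ (cnext i′) ≡ v) ⊎ (f′ i′ ≡ v × f′ (cnext i′) ≡ u) → Walk H (f i) (f (cnext i))
      orient (inj₁ (p , q)) (inj₁ (p′ , q′)) = subst₂ (Walk H) (trans p′ (sym p)) (trans q′ (sym q)) (reverseʷ H-sym walk′)
      orient (inj₂ (p , q)) (inj₂ (p′ , q′)) = subst₂ (Walk H) (trans p′ (sym p)) (trans q′ (sym q)) (reverseʷ H-sym walk′)
      orient (inj₁ (p , q)) (inj₂ (p′ , q′)) = subst₂ (Walk H) (trans q′ (sym p)) (trans p′ (sym q)) walk′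
      orient (inj₂ (p , q)) (inj₁ (p′ , q′)) = subst₂ (Walk H) (trans q′ (sym p)) (trans p′ (sym q)) walk′

  module _ {C C′ : EdgeSet n} (isCycle : IsCycle G C) (isCycle′ : IsCycle G C′)
    (only : ∀ K → IsCycle G K → K ≐ C ⊎ K ≐ C′) where

    -- The hypotheses are symmetric in the two cycles, so one common edge gives both inclusions.
    cycles-disjoint : ¬ (C ≐ C′) → ∀ {u v} → C u v ≡ true → C′ u v ≡ true → ⊥
    cycles-disjoint C≭C′ c c′ = C≭C′ λ x y → same x y
      where
      swap : ∀ K → IsCycle G K → K ≐ C′ ⊎ K ≐ C
      swap K isK with only K isK
      ... | inj₁ eq = inj₂ eq
      ... | inj₂ eq = inj₁ eq
      ⊆₁ : C ⊆ᴳ C′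
      ⊆₁ = OneOfTwoCycles.common-edge⇒⊆ isCycle only isCycle′ c c′
      ⊆₂ : C′ ⊆ᴳ C
      ⊆₂ = OneOfTwoCycles.common-edge⇒⊆ isCycle′ swap isCycle c′ c
      same : ∀ x y → C x y ≡ C′ x y
      same x y with C x y in p | C′ x y in q
      ... | true | true = refl
      ... | false | false = refl
      ... | true | false = ⊥-elim (true≢false (⊆₁ p) q)
      ... | false | true = ⊥-elim (true≢false (⊆₂ q) p)

    -- A detour around `xy` would close up to a cycle through `xy`, which would have to be `C` or
    -- `C′`.
    other-edge-bridge : (∀ i → G i i ≡ false) → ∀ {x y} → G x y ≡ true → C x y ≡ false → C′ x y ≡ false →
      ¬ Walk (G ∖ edgeOf x y) x y
    other-edge-bridge G-irr {x} {y} Gxy Cxy C′xy w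
      with cycle-through x y (λ h → ∖-⊆ h) (trans (G-sym y x) Gxy) removed x≢y w
      where
      removed : (G ∖ edgeOf x y) x y ≡ false
      removed = ∖-removed (edgeOf-self x y)
      x≢y : x ≢ y
      x≢y refl = true≢false Gxy (G-irr x)
    ... | K , isK , Kxy , _ with only K isK
    ... | inj₁ eq = true≢false (trans (sym (eq x y)) Kxy) Cxy
    ... | inj₂ eq = true≢false (trans (sym (eq x y)) Kxy) C′xy

-- Branches of a subgraph

-- The form in which removal of `D` is exploited: a function `h ∘ β` changes only across edges of
-- `D`, and `β-f` gives its values at the attachment vertices.
record Branching {n} (G : Graph n) (D : EdgeSet n) {g} (f : Fin g → Fin n) : Set where
  field
    D⊆G : D ⊆ᴳ G
    β : Fin n → Fin g
    β-f : ∀ i → β (f i) ≡ i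
    β-const : ∀ {u v} → (G ∖ D) u v ≡ true → β u ≡ β v

-- The label of a vertex is read off a walk towards `f Fin.zero`. It depends on the walk a priori;
-- `separated` shows that vertices joined outside `D` receive equal labels.
branching : ∀ {n} {G : Graph n} {D : EdgeSet n} {g} (f : Fin (suc g) → Fin n) →
  Symmetric G → Symmetric D → Connected G → D ⊆ᴳ G →
  (∀ {u v} → D u v ≡ true → ∃ λ i → f i ≡ u) → (∀ {i j} → i ≢ j → ¬ Walk (G ∖ D) (f i) (f j)) →
  Branching G D f
branching {n} {G} {D} {g} f G-sym D-sym connected D⊆G ends separated = record
  { D⊆G = D⊆G
  ; β = β
  ; β-f = λ i → sym (joined⇒≡ (to-β (f i)))
  ; β-const = λ {u} {v} h → joined⇒≡ (reverseʷ H-sym (to-β u) ++ʷ cons h (to-β v))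
  }
  where
  H : Graph n
  H = G ∖ D
  H-sym : Symmetric H
  H-sym = ∖-sym G-sym D-sym
  -- The walk is cut just before its first step in `D`, where it stands at some `f i`; with no such
  -- step it runs on to `f Fin.zero`.
  exit : ∀ {v} → Walk G v (f Fin.zero) → ∃ λ i → Walk H v (f i)
  exit nil = Fin.zero , nil
  exit (cons {u} {w} e p) with D u w in d
  ... | true = proj₁ (ends d) , subst (Walk H u) (sym (proj₂ (ends d))) nil
  ... | false = proj₁ (exit p) , cons (∖-keeps e d) (proj₂ (exit p))
  β : Fin n → Fin (suc g)
  β v = proj₁ (exit (connected v (f Fin.zero)))
  to-β : ∀ v → Walk H v (f (β v))
  to-β v = proj₂ (exit (connected v (f Fin.zero)))
  joined⇒≡ : ∀ {i j} → Walk H (f i) (f j) → i ≡ j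
  joined⇒≡ {i} {j} w with i Fin.≟ j
  ... | yes eq = eq
  ... | no ne = ⊥-elim (separated ne w)

-- Energy

ΣΣ-cong : ∀ {m n} {f g : Fin m → Fin n → ℚ} → (∀ i j → f i j ≡ g i j) →
  Σℚ (λ i → Σℚ (f i)) ≡ Σℚ (λ i → Σℚ (g i))
ΣΣ-cong eq = Σ-cong λ i → Σ-cong (eq i)

ΣΣ-+ : ∀ {m n} (f g : Fin m → Fin n → ℚ) →
  Σℚ (λ i → Σℚ (λ j → f i j + g i j)) ≡ Σℚ (λ i → Σℚ (f i)) + Σℚ (λ i → Σℚ (g i))
ΣΣ-+ f g = trans (Σ-cong λ i → Σ-+ (f i) (g i)) (Σ-+ (λ i → Σℚ (f i)) (λ i → Σℚ (g i)))

ΣΣ-*ˡ : ∀ {m n} c (f : Fin m → Fin n → ℚ) → Σℚ (λ i → Σℚ (λ j → c * f i j)) ≡ c * Σℚ (λ i → Σℚ (f i))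
ΣΣ-*ˡ c f = trans (Σ-cong λ i → Σ-*ˡ c (f i)) (Σ-*ˡ c (λ i → Σℚ (f i)))

ΣΣ-mono : ∀ {m n} {f g : Fin m → Fin n → ℚ} → (∀ i j → f i j ≤ℚ g i j) →
  Σℚ (λ i → Σℚ (f i)) ≤ℚ Σℚ (λ i → Σℚ (g i))
ΣΣ-mono le = Σ-mono λ i → Σ-mono (le i)

δ-true : ∀ {n} {i j : Fin n} → i ≡ j → δ i j ≡ 1ℚ
δ-true {i = i} refl = δ-refl i

ΣΣ-δδ : ∀ {m n} (a : Fin m) (b : Fin n) (k : Fin m → Fin n → ℚ) →
  Σℚ (λ i → Σℚ (λ j → (δ a i * δ b j) * k i j)) ≡ k a b
ΣΣ-δδ a b k = begin
  Σℚ (λ i → Σℚ (λ j → (δ a i * δ b j) * k i j))  ≡⟨ ΣΣ-cong (λ i j → ℚₚ.*-assoc (δ a i) (δ b j) (k i j)) ⟩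
  Σℚ (λ i → Σℚ (λ j → δ a i * (δ b j * k i j)))  ≡⟨ Σ-cong (λ i → trans (Σ-*ˡ (δ a i) (λ j → δ b j * k i j)) (cong (δ a i *_) (Σ-δ b (k i)))) ⟩
  Σℚ (λ i → δ a i * k i b)                       ≡⟨ Σ-δ a (λ i → k i b) ⟩
  k a b                                          ∎
  where open ≡-Reasoning

≡ᵇ-true : ∀ {n} {i j : Fin n} → i ≡ j → (toℕ i ℕ.≡ᵇ toℕ j) ≡ true
≡ᵇ-true {i = i} refl = Boolₚ.T-≡ .Equivalence.to (ℕₚ.≡⇒≡ᵇ (toℕ i) (toℕ i) refl)

≡ᵇ-false : ∀ {n} {i j : Fin n} → i ≢ j → (toℕ i ℕ.≡ᵇ toℕ j) ≡ false
≡ᵇ-false {i = i} {j} ne with toℕ i ℕ.≡ᵇ toℕ j in eq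
... | false = refl
... | true = ⊥-elim (ne (Finₚ.toℕ-injective (ℕₚ.≡ᵇ⇒≡ (toℕ i) (toℕ j) (subst T (sym eq) tt))))

current-δ : ∀ {n} {u v : Fin n} → u ≢ v → ∀ w → current u v w ≡ δ u w - δ v w
current-δ {u = u} {v} u≢v w with w Fin.≟ u | w Fin.≟ v
... | yes refl | _ rewrite ≡ᵇ-true {i = w} refl | δ-refl w | δ-≢ {i = v} {w} (λ eq → u≢v (sym eq)) = refl
... | no w≢u | yes refl rewrite ≡ᵇ-false w≢u | ≡ᵇ-true {i = w} refl | δ-refl w | δ-≢ u≢v = refl
... | no w≢u | no w≢v rewrite ≡ᵇ-false w≢u | ≡ᵇ-false w≢v | δ-≢ {i = u} {w} (λ eq → w≢u (sym eq)) | δ-≢ {i = v} {w} (λ eq → w≢v (sym eq)) = refl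

2ℚ : ℚ
2ℚ = ℕtoℚ 2

-- Runs over ordered pairs, so an undirected edge counts twice; this is the source of most factors
-- `2ℚ` and `½` below.
edgeSum : ∀ {n} → EdgeSet n → (Fin n → Fin n → ℚ) → ℚ
edgeSum D k = Σℚ (λ w → Σℚ (λ x → 𝟙 (D w x) * k w x))

module _ {n} {G : Graph n} (G-sym : Symmetric G) {u v : Fin n} (u≢v : u ≢ v)
  (φ : Fin n → ℚ) (kirchhoff : ∀ w → laplacian G φ w ≡ current u v w) where

  -- Summation by parts. With `ψ` equal to `φ` it gives the energy; with `ψ` constant on branches it
  -- gives the current through a cut.
  green : ∀ (ψ : Fin n → ℚ) → edgeSum G (λ w x → (ψ w - ψ x) * (φ w - φ x)) ≡ 2ℚ * (ψ u - ψ v)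
  green ψ = begin
    edgeSum G (λ w x → (ψ w - ψ x) * (φ w - φ x))
      ≡⟨ ΣΣ-cong (λ w x → split (𝟙 (G w x)) (ψ w) (ψ x) (φ w) (φ x)) ⟩
    Σℚ (λ w → Σℚ (λ x → a w x + 𝟙 (G w x) * (ψ x * (φ x - φ w))))
      ≡⟨ ΣΣ-+ a (λ w x → 𝟙 (G w x) * (ψ x * (φ x - φ w))) ⟩
    Σℚ (λ w → Σℚ (a w)) + Σℚ (λ w → Σℚ (λ x → 𝟙 (G w x) * (ψ x * (φ x - φ w))))
      ≡⟨ cong (Σℚ (λ w → Σℚ (a w)) +_) (trans (ΣΣ-cong λ w x → cong (λ b → 𝟙 b * (ψ x * (φ x - φ w))) (G-sym w x)) (sym (Σ-swap a))) ⟩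
    Σℚ (λ w → Σℚ (a w)) + Σℚ (λ w → Σℚ (a w))
      ≡⟨ cong₂ _+_ source source ⟩
    (ψ u - ψ v) + (ψ u - ψ v)
      ≡⟨ twice (ψ u - ψ v) ⟩
    2ℚ * (ψ u - ψ v) ∎
    where
    open ≡-Reasoning
    a : Fin n → Fin n → ℚ
    a w x = 𝟙 (G w x) * (ψ w * (φ w - φ x))
    split : ∀ b p q r s → b * ((p - q) * (r - s)) ≡ b * (p * (r - s)) + b * (q * (s - r))
    split = solve-∀ ℚ-ring
    twice : ∀ p → p + p ≡ 2ℚ * p
    twice = solve-∀ ℚ-ring
    pull : ∀ b p q → b * (p * q) ≡ p * (b * q)
    pull = solve-∀ ℚ-ring
    distrib : ∀ p q r → r * (p - q) ≡ p * r - q * r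
    distrib = solve-∀ ℚ-ring
    source : Σℚ (λ w → Σℚ (a w)) ≡ ψ u - ψ v
    source = begin
      Σℚ (λ w → Σℚ (a w))
        ≡⟨ Σ-cong (λ w → trans (Σ-cong λ x → pull (𝟙 (G w x)) (ψ w) (φ w - φ x)) (Σ-*ˡ (ψ w) (λ x → 𝟙 (G w x) * (φ w - φ x)))) ⟩
      Σℚ (λ w → ψ w * Σℚ (λ x → 𝟙 (G w x) * (φ w - φ x)))
        ≡⟨ Σ-cong (λ w → cong (ψ w *_) (trans (Σ-cong λ x → sym (if-𝟙 (G w x) _)) (trans (kirchhoff w) (current-δ u≢v w)))) ⟩
      Σℚ (λ w → ψ w * (δ u w - δ v w))
        ≡⟨ Σ-cong (λ w → distrib (δ u w) (δ v w) (ψ w)) ⟩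
      Σℚ (λ w → δ u w * ψ w - δ v w * ψ w)
        ≡⟨ Σ-- (λ w → δ u w * ψ w) (λ w → δ v w * ψ w) ⟩
      Σℚ (λ w → δ u w * ψ w) - Σℚ (λ w → δ v w * ψ w)
        ≡⟨ cong₂ _-_ (Σ-δ u ψ) (Σ-δ v ψ) ⟩
      ψ u - ψ v ∎

  module _ {D : EdgeSet n} {g} {f : Fin g → Fin n} (branches : Branching G D f) where
    open Branching branches

    -- Edges outside `D` stay within a branch, where `h ∘ β` does not vary, so they drop out of
    -- Green's identity.
    branch-green : ∀ (h : Fin g → ℚ) →
      edgeSum D (λ w x → (h (β w) - h (β x)) * (φ w - φ x)) ≡ 2ℚ * (h (β u) - h (β v))
    branch-green h = trans (ΣΣ-cong λ w x → sym (term w x)) (green (λ w → h (β w)))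
      where
      term : ∀ w x → 𝟙 (G w x) * ((h (β w) - h (β x)) * (φ w - φ x)) ≡ 𝟙 (D w x) * ((h (β w) - h (β x)) * (φ w - φ x))
      term w x with G w x in Gwx | D w x in Dwx
      ... | true | true = refl
      ... | false | false = refl
      ... | false | true = ⊥-elim (true≢false (D⊆G Dwx) Gwx)
      ... | true | false rewrite β-const (∖-keeps {G = G} {D} Gwx Dwx) = vanish (h (β x)) (φ w - φ x)
        where
        vanish : ∀ p q → 1ℚ * ((p - p) * q) ≡ 0ℚ * ((p - p) * q)
        vanish = solve-∀ ℚ-ring

-- Order indicator and the cycle kernel

le : ∀ {g} → Fin g → Fin g → ℚ
le Fin.zero j = 1ℚ
le (Fin.suc i) Fin.zero = 0ℚ
le (Fin.suc i) (Fin.suc j) = le i j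

le-≤ : ∀ {g} {i j : Fin g} → toℕ i ℕ.≤ toℕ j → le i j ≡ 1ℚ
le-≤ {i = Fin.zero} p = refl
le-≤ {i = Fin.suc i} {Fin.suc j} (s≤s p) = le-≤ p

le-> : ∀ {g} {i j : Fin g} → toℕ j ℕ.< toℕ i → le i j ≡ 0ℚ
le-> {i = Fin.suc i} {Fin.zero} p = refl
le-> {i = Fin.suc i} {Fin.suc j} (s≤s p) = le-> p

-- Around the cycle the indicator of the segment from 0 to `j` falls once, after `j`, and rises
-- once, at the wrap. As a test function it therefore compares the drop at `j` with the drop at the
-- last position.
le-cnext : ∀ {m} (l j : Fin (suc m)) → le l j - le (cnext l) j ≡ δ j l - δ (Fin.fromℕ m) l
le-cnext {m} l j with toℕ l ℕ.<? m
... | no l≮m = case l≡last of λ { refl → begin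
    le last j - le (cnext last) j   ≡⟨ cong (λ q → le last j - q) (le-≤ {i = cnext last} (subst (ℕ._≤ toℕ j) (sym (cnext-last last (Finₚ.toℕ-fromℕ m))) z≤n)) ⟩
    le last j - 1ℚ                  ≡⟨ cong₂ _-_ (at-last j) (sym (δ-refl last)) ⟩
    δ j last - δ last last          ∎ }
  where
  open ≡-Reasoning
  last = Fin.fromℕ m
  l≡last : l ≡ last
  l≡last = Finₚ.toℕ-injective (trans (ℕₚ.≤-antisym (ℕₚ.<⇒≤pred (Finₚ.toℕ<n l)) (ℕₚ.≮⇒≥ l≮m)) (sym (Finₚ.toℕ-fromℕ m)))
  at-last : ∀ j → le last j ≡ δ j last
  at-last j with j Fin.≟ last
  ... | yes refl = trans (le-≤ {i = last} {last} ℕₚ.≤-refl) (sym (δ-refl last))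
  ... | no j≢last = trans (le-> {i = last} {j} (ℕₚ.≤∧≢⇒< (subst (toℕ j ℕ.≤_) (sym (Finₚ.toℕ-fromℕ m)) (ℕₚ.<⇒≤pred (Finₚ.toℕ<n j))) (λ eq → j≢last (Finₚ.toℕ-injective eq)))) (sym (δ-≢ j≢last))
... | yes l<m = trans (inner (ℕₚ.<-cmp (toℕ l) (toℕ j)))
    (trans (sym (ℚₚ.+-identityʳ (δ j l))) (cong (λ q → δ j l - q) (sym (δ-≢ last≢l))))
  where
  last≢l : Fin.fromℕ m ≢ l
  last≢l eq = ℕₚ.<-irrefl (trans (sym (cong toℕ eq)) (Finₚ.toℕ-fromℕ m)) l<m
  next = cnext-< l l<m
  inner : _ → le l j - le (cnext l) j ≡ δ j l
  inner (tri< l<j l≢j _) = trans (cong₂ _-_ (le-≤ {i = l} (ℕₚ.<⇒≤ l<j)) (le-≤ {i = cnext l} (subst (ℕ._≤ toℕ j) (sym next) l<j)))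
    (sym (δ-≢ λ eq → l≢j (cong toℕ (sym eq))))
  inner (tri≈ _ l≡j _) = trans (cong₂ _-_ (le-≤ {i = l} (ℕₚ.≤-reflexive l≡j)) (le-> {i = cnext l} (subst (toℕ j ℕ.<_) (sym next) (s≤s (ℕₚ.≤-reflexive (sym l≡j))))))
    (sym (δ-true (Finₚ.toℕ-injective (sym l≡j))))
  inner (tri> _ l≢j j<l) = trans (cong₂ _-_ (le-> {i = l} j<l) (le-> {i = cnext l} (subst (toℕ j ℕ.<_) (sym next) (ℕₚ.m<n⇒m<1+n j<l))))
    (sym (δ-≢ λ eq → l≢j (cong toℕ (sym eq))))

-- The unit flow from `i` to `j` along the arc that does not use the wrapping edge: 1 or -1 between
-- the two positions, 0 elsewhere.
step : ∀ {g} → Fin g → Fin g → Fin g → ℚ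
step i j l = le i l - le j l

-- k (g - k) for k = |i - j|.
κ : ∀ {g} → Fin g → Fin g → ℚ
κ {g} i j = ℕtoℚ g * Σℚ (λ l → step i j l * step i j l) - Σℚ (step i j) * Σℚ (step i j)

-- `κ` is the minimum over `c` of the right-hand side. The discarded square is that of the sum of
-- `y`, which vanishes for potential drops around a closed cycle, so nothing is lost there.
κ-≤ : ∀ {g} (i j : Fin g) (y : Fin g → ℚ) c → (∀ l → y l ≡ c + step i j l) →
  κ i j ≤ℚ ℕtoℚ g * Σℚ (λ l → y l * y l)
κ-≤ {g} i j y c y≡ = ≤-from-difference (0≤-square (N * c + S)) (begin
  N * Σℚ (λ l → y l * y l) - (N * Q - S * S)
    ≡⟨ cong (λ z → N * z - (N * Q - S * S)) (begin
      Σℚ (λ l → y l * y l)                                  ≡⟨ Σ-cong (λ l → trans (cong₂ _*_ (y≡ l) (y≡ l)) (expand c (s l))) ⟩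
      Σℚ (λ l → (c * c + (2ℚ * c) * s l) + s l * s l)       ≡⟨ Σ-+ (λ l → c * c + (2ℚ * c) * s l) (λ l → s l * s l) ⟩
      Σℚ (λ l → c * c + (2ℚ * c) * s l) + Q                 ≡⟨ cong (_+ Q) (Σ-+ (λ _ → c * c) (λ l → (2ℚ * c) * s l)) ⟩
      (Σℚ {g} (λ _ → c * c) + Σℚ (λ l → (2ℚ * c) * s l)) + Q    ≡⟨ cong (_+ Q) (cong₂ _+_ (Σ-const g (c * c)) (Σ-*ˡ (2ℚ * c) s)) ⟩
      (N * (c * c) + (2ℚ * c) * S) + Q                      ∎) ⟩
  N * ((N * (c * c) + (2ℚ * c) * S) + Q) - (N * Q - S * S)
    ≡⟨ complete-square N c S Q ⟩
  (N * c + S) * (N * c + S) ∎)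
  where
  open ≡-Reasoning
  s = step i j
  N = ℕtoℚ g
  S = Σℚ s
  Q = Σℚ (λ l → s l * s l)
  expand : ∀ c s → (c + s) * (c + s) ≡ (c * c + (2ℚ * c) * s) + s * s
  expand = solve-∀ ℚ-ring
  complete-square : ∀ N c S Q → N * ((N * (c * c) + (2ℚ * c) * S) + Q) - (N * Q - S * S) ≡ (N * c + S) * (N * c + S)
  complete-square = solve-∀ ℚ-ring

edgeSum-edgeOf : ∀ {n} {x y : Fin n} → x ≢ y → ∀ k → edgeSum (edgeOf x y) k ≡ k x y + k y x
edgeSum-edgeOf {n} {x} {y} x≢y k = begin
  edgeSum (edgeOf x y) k
    ≡⟨ ΣΣ-cong (λ w z → trans (cong (_* k w z) (edge-δ w z)) (ℚₚ.*-distribʳ-+ (k w z) (δ x w * δ y z) (δ y w * δ x z))) ⟩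
  Σℚ (λ w → Σℚ (λ z → (δ x w * δ y z) * k w z + (δ y w * δ x z) * k w z))
    ≡⟨ ΣΣ-+ (λ w z → (δ x w * δ y z) * k w z) (λ w z → (δ y w * δ x z) * k w z) ⟩
  Σℚ (λ w → Σℚ (λ z → (δ x w * δ y z) * k w z)) + Σℚ (λ w → Σℚ (λ z → (δ y w * δ x z) * k w z))
    ≡⟨ cong₂ _+_ (ΣΣ-δδ x y k) (ΣΣ-δδ y x k) ⟩
  k x y + k y x ∎
  where
  open ≡-Reasoning
  edge-δ : ∀ w z → 𝟙 (edgeOf x y w z) ≡ δ x w * δ y z + δ y w * δ x z
  edge-δ w z with edgeOf x y w z in eq
  edge-δ w z | true with edgeOf-sound eq
  ... | inj₁ (refl , refl) rewrite δ-refl x | δ-refl y | δ-≢ x≢y | δ-≢ (λ e → x≢y (sym e)) = refl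
  ... | inj₂ (refl , refl) rewrite δ-refl x | δ-refl y | δ-≢ x≢y | δ-≢ (λ e → x≢y (sym e)) = refl
  edge-δ w z | false = sym (trans (cong₂ _+_ (product x y (λ p → inj₁ p)) (product y x (λ { (p , q) → inj₂ (q , p) }))) refl)
    where
    product : ∀ a b → (a ≡ w × b ≡ z → (x ≡ w × y ≡ z) ⊎ (x ≡ z × y ≡ w)) → δ a w * δ b z ≡ 0ℚ
    product a b on with a Fin.≟ w | b Fin.≟ z
    ... | yes p | yes q = ⊥-elim (true≢false (edgeOf-true (on (p , q))) eq)
    ... | no p | _ = trans (cong (_* δ b z) (δ-≢ p)) (ℚₚ.*-zeroˡ (δ b z))
    ... | yes _ | no q = trans (cong (δ a w *_) (δ-≢ q)) (ℚₚ.*-zeroʳ (δ a w))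

Σ-𝟙-unique : ∀ {n} {g} (i₀ : Fin g) (D : Fin g → EdgeSet n) {w x} → D i₀ w x ≡ true →
  (∀ i → i ≢ i₀ → D i w x ≡ false) → Σℚ (λ i → 𝟙 (D i w x)) ≡ 1ℚ
Σ-𝟙-unique i₀ D {w} {x} on off = trans (Σ-cong single) (Σ-δ-1 i₀)
  where
  single : ∀ i → 𝟙 (D i w x) ≡ δ i₀ i
  single i with i Fin.≟ i₀
  ... | yes refl = trans (cong 𝟙 on) (sym (δ-refl i₀))
  ... | no i≢i₀ = trans (cong 𝟙 (off i i≢i₀)) (sym (δ-≢ λ eq → i≢i₀ (sym eq)))

module _ {n} {G : Graph n} {C : EdgeSet n} (isCycle : IsCycle G C) where
  open OnCycle {G = G} isCycle

  -- An edge of `C` occupies exactly one position: existence is `C-sound`, uniqueness is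
  -- `e-distinct`.
  cycle-edges : ∀ w x → 𝟙 (C w x) ≡ Σℚ (λ i → 𝟙 (e i w x))
  cycle-edges w x with C w x in c
  ... | false = sym (trans (Σ-cong (λ i → cong 𝟙 (edgeOf-false (off i)))) (Σ-zero g))
    where
    off : ∀ i → ¬ ((f i ≡ w × f (cnext i) ≡ x) ⊎ (f i ≡ x × f (cnext i) ≡ w))
    off i (inj₁ (refl , refl)) = true≢false (C-edge i) c
    off i (inj₂ (refl , refl)) = true≢false (C-edge′ i) c
  ... | true with C-sound w x c
  ... | i₀ , on = sym (Σ-𝟙-unique i₀ e (edgeOf-true on) λ i i≢i₀ → ≢true λ h → clash on i i≢i₀ h)
    where
    clash : (f i₀ ≡ w × f (cnext i₀) ≡ x) ⊎ (f i₀ ≡ x × f (cnext i₀) ≡ w) → ∀ i → i ≢ i₀ → ¬ (e i w x ≡ true)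
    clash (inj₁ (refl , refl)) i i≢i₀ h = true≢false h (e-distinct i≢i₀)
    clash (inj₂ (refl , refl)) i i≢i₀ h = true≢false (trans (edgeOf-sym (f i) (f (cnext i)) _ _) h) (e-distinct i≢i₀)

  edgeSum-cycle : ∀ k → edgeSum C k ≡ Σℚ (λ i → k (f i) (f (cnext i)) + k (f (cnext i)) (f i))
  edgeSum-cycle k = begin
    edgeSum C k
      ≡⟨ ΣΣ-cong (λ w x → trans (cong (_* k w x) (cycle-edges w x)) (sym (Σ-*ʳ (k w x) (λ i → 𝟙 (e i w x))))) ⟩
    Σℚ (λ w → Σℚ (λ x → Σℚ (λ i → 𝟙 (e i w x) * k w x)))
      ≡⟨ Σ-cong (λ w → Σ-swap (λ x i → 𝟙 (e i w x) * k w x)) ⟩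
    Σℚ (λ w → Σℚ (λ i → Σℚ (λ x → 𝟙 (e i w x) * k w x)))
      ≡⟨ Σ-swap (λ w i → Σℚ (λ x → 𝟙 (e i w x) * k w x)) ⟩
    Σℚ (λ i → edgeSum (e i) k)
      ≡⟨ Σ-cong (λ i → edgeSum-edgeOf (λ eq → cnext-≢ i (sym (f-injective i _ eq))) k) ⟩
    Σℚ (λ i → k (f i) (f (cnext i)) + k (f (cnext i)) (f i)) ∎
    where open ≡-Reasoning

half-cancel : ∀ {p q} → 2ℚ * p ≡ 2ℚ * q → p ≡ q
half-cancel {p} {q} eq = trans (sym (halve p)) (trans (cong (½ *_) eq) (halve q))
  where
  halve : ∀ p → ½ * (2ℚ * p) ≡ p
  halve = solve-∀ ℚ-ring

sq : ℚ → ℚ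
sq p = p * p

module _ {n} {G : Graph n} (G-sym : Symmetric G) {u v : Fin n} (u≢v : u ≢ v)
  (φ : Fin n → ℚ) (kirchhoff : ∀ w → laplacian G φ w ≡ current u v w) where

  -- The indicator of the branch at `x` as test function: the whole unit current crosses the bridge
  -- if `u` and `v` lie on different sides, and none does otherwise.
  bridge-energy : ∀ {f : Fin 2 → Fin n} → let x = f Fin.zero ; y = f (Fin.suc Fin.zero) in
    x ≢ y → (branches : Branching G (edgeOf x y) f) → let open Branching branches in
    sq (φ x - φ y) ≡ sq (le (β u) Fin.zero - le (β v) Fin.zero)
  bridge-energy {f} x≢y branches = cong sq (half-cancel {φ x - φ y} {h (β u) - h (β v)} (begin
    2ℚ * (φ x - φ y)                               ≡⟨ double (φ x) (φ y) ⟩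
    (1ℚ - 0ℚ) * (φ x - φ y) + (0ℚ - 1ℚ) * (φ y - φ x)   ≡⟨ sym (cong₂ (λ p q → (p - q) * (φ x - φ y) + (q - p) * (φ y - φ x)) (h-f Fin.zero) (h-f (Fin.suc Fin.zero))) ⟩
    k x y + k y x                                  ≡⟨ sym (edgeSum-edgeOf x≢y k) ⟩
    edgeSum (edgeOf x y) k                         ≡⟨ branch-green G-sym u≢v φ kirchhoff branches h ⟩
    2ℚ * (h (β u) - h (β v))                       ∎))
    where
    open ≡-Reasoning
    open Branching branches
    x = f Fin.zero
    y = f (Fin.suc Fin.zero)
    h : Fin 2 → ℚ
    h i = le i Fin.zero
    h-f : ∀ i → h (β (f i)) ≡ h i
    h-f i = cong h (β-f i)
    k : Fin n → Fin n → ℚ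
    k w z = (h (β w) - h (β z)) * (φ w - φ z)
    double : ∀ p q → 2ℚ * (p - q) ≡ (1ℚ - 0ℚ) * (p - q) + (0ℚ - 1ℚ) * (q - p)
    double = solve-∀ ℚ-ring

  module _ {C : EdgeSet n} (isCycle : IsCycle G C) (branches : Branching G C (OnCycle.f {G = G} isCycle)) where
    open OnCycle {G = G} isCycle
    open Branching branches

    drop : Fin g → ℚ
    drop l = φ (f l) - φ (f (cnext l))

    -- Testing against the segment up to position `j` leaves only the drops at `j` and at the last
    -- position; their difference is the net current entering the branches of that segment.
    drop-step : ∀ l → drop l ≡ drop (Fin.fromℕ _) + step (β u) (β v) l
    drop-step j = begin
      drop j                                     ≡⟨ sym (re-add (drop j) (drop last)) ⟩
      drop last + (drop j - drop last)           ≡⟨ cong (drop last +_) (half-cancel jump) ⟩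
      drop last + step (β u) (β v) j             ∎
      where
      open ≡-Reasoning
      last = Fin.fromℕ (2 ℕ.+ m)
      re-add : ∀ p q → q + (p - q) ≡ p
      re-add = solve-∀ ℚ-ring
      h : Fin g → ℚ
      h i = le i j
      k : Fin n → Fin n → ℚ
      k w z = (h (β w) - h (β z)) * (φ w - φ z)
      double : ∀ a b p q → (a - b) * (p - q) + (b - a) * (q - p) ≡ 2ℚ * ((a - b) * (p - q))
      double = solve-∀ ℚ-ring
      distrib : ∀ a b p → 2ℚ * ((a - b) * p) ≡ 2ℚ * (a * p - b * p)
      distrib = solve-∀ ℚ-ring
      jump : 2ℚ * (drop j - drop last) ≡ 2ℚ * (h (β u) - h (β v))
      jump = begin
        2ℚ * (drop j - drop last)
          ≡⟨ cong (2ℚ *_) (sym (cong₂ _-_ (Σ-δ j drop) (Σ-δ last drop))) ⟩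
        2ℚ * (Σℚ (λ l → δ j l * drop l) - Σℚ (λ l → δ last l * drop l))
          ≡⟨ cong (2ℚ *_) (sym (Σ-- (λ l → δ j l * drop l) (λ l → δ last l * drop l))) ⟩
        2ℚ * Σℚ (λ l → δ j l * drop l - δ last l * drop l)
          ≡⟨ sym (Σ-*ˡ 2ℚ (λ l → δ j l * drop l - δ last l * drop l)) ⟩
        Σℚ (λ l → 2ℚ * (δ j l * drop l - δ last l * drop l))
          ≡⟨ Σ-cong (λ l → trans (sym (distrib (δ j l) (δ last l) (drop l))) (cong (λ q → 2ℚ * (q * drop l)) (sym (le-cnext l j)))) ⟩
        Σℚ (λ l → 2ℚ * ((h l - h (cnext l)) * drop l))
          ≡⟨ Σ-cong (λ l → sym (trans (double (h (β (f l))) (h (β (f (cnext l)))) (φ (f l)) (φ (f (cnext l))))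
               (cong₂ (λ a b → 2ℚ * ((h a - h b) * drop l)) (β-f l) (β-f (cnext l))))) ⟩
        Σℚ (λ l → k (f l) (f (cnext l)) + k (f (cnext l)) (f l))
          ≡⟨ sym (edgeSum-cycle {G = G} isCycle k) ⟩
        edgeSum C k
          ≡⟨ branch-green G-sym u≢v φ kirchhoff branches h ⟩
        2ℚ * (h (β u) - h (β v)) ∎

    -- Stated with the factor `g`, as `κ` is free of division; the factor `2ℚ` comes from ordered
    -- pairs.
    cycle-energy : 2ℚ * κ (β u) (β v) ≤ℚ ℕtoℚ g * edgeSum C (λ w x → sq (φ w - φ x))
    cycle-energy = subst (2ℚ * κ (β u) (β v) ≤ℚ_) (trans (pull (ℕtoℚ g) _) (cong (ℕtoℚ g *_) (begin
        2ℚ * Σℚ (λ l → drop l * drop l)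
          ≡⟨ sym (Σ-*ˡ 2ℚ (λ l → drop l * drop l)) ⟩
        Σℚ (λ l → 2ℚ * (drop l * drop l))
          ≡⟨ Σ-cong (λ l → double (φ (f l)) (φ (f (cnext l)))) ⟩
        Σℚ (λ l → sq (φ (f l) - φ (f (cnext l))) + sq (φ (f (cnext l)) - φ (f l)))
          ≡⟨ sym (edgeSum-cycle {G = G} isCycle (λ w x → sq (φ w - φ x))) ⟩
        edgeSum C (λ w x → sq (φ w - φ x)) ∎)))
      (*-monoˡ-≤ (0≤ℕtoℚ 2) (κ-≤ (β u) (β v) drop (drop (Fin.fromℕ _)) drop-step))
      where
      open ≡-Reasoning
      pull : ∀ N q → 2ℚ * (N * q) ≡ N * (2ℚ * q)
      pull = solve-∀ ℚ-ring
      double : ∀ p q → 2ℚ * ((p - q) * (p - q)) ≡ (p - q) * (p - q) + (q - p) * (q - p)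
      double = solve-∀ ℚ-ring

-- Row sums of the cycle kernel

Σ-le : ∀ {g} (i : Fin g) → Σℚ (le i) ≡ ℕtoℚ g - ℕtoℚ (toℕ i)
Σ-le {suc g} Fin.zero = trans (cong (1ℚ +_) (trans (Σ-const g 1ℚ) (ℚₚ.*-identityʳ (ℕtoℚ g))))
  (trans (sym (ℕtoℚ-suc g)) (sym (ℚₚ.+-identityʳ (ℕtoℚ (suc g)))))
Σ-le {suc g} (Fin.suc i) = begin
  0ℚ + Σℚ (le i)                                      ≡⟨ cong (0ℚ +_) (Σ-le i) ⟩
  0ℚ + (ℕtoℚ g - ℕtoℚ (toℕ i))                        ≡⟨ shift-both (ℕtoℚ g) (ℕtoℚ (toℕ i)) ⟩
  (1ℚ + ℕtoℚ g) - (1ℚ + ℕtoℚ (toℕ i))                 ≡⟨ sym (cong₂ _-_ (ℕtoℚ-suc g) (ℕtoℚ-suc (toℕ i))) ⟩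
  ℕtoℚ (suc g) - ℕtoℚ (suc (toℕ i))                   ∎
  where
  open ≡-Reasoning
  shift-both : ∀ a b → 0ℚ + (a - b) ≡ (1ℚ + a) - (1ℚ + b)
  shift-both = solve-∀ ℚ-ring

Σ-step : ∀ {g} (i j : Fin g) → Σℚ (step i j) ≡ ℕtoℚ (toℕ j) - ℕtoℚ (toℕ i)
Σ-step {g} i j = trans (Σ-- (le i) (le j)) (trans (cong₂ _-_ (Σ-le i) (Σ-le j)) (cancel (ℕtoℚ g) (ℕtoℚ (toℕ i)) (ℕtoℚ (toℕ j))))
  where
  cancel : ∀ a b c → (a - b) - (a - c) ≡ c - b
  cancel = solve-∀ ℚ-ring

-- Equals the absolute difference of the positions, because the entries of `step` are 0, 1 and -1;
-- in this form it satisfies a recursion on both indices.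
dist : ∀ {g} → Fin g → Fin g → ℚ
dist i j = Σℚ (λ l → sq (step i j l))

dist-0j : ∀ {g} (j : Fin (suc g)) → dist Fin.zero j ≡ ℕtoℚ (toℕ j)
dist-0j {g} j = begin
  Σℚ (λ l → sq (1ℚ - le j l))       ≡⟨ Σ-cong (λ l → complement j l) ⟩
  Σℚ (λ l → 1ℚ - le j l)            ≡⟨ Σ-step Fin.zero j ⟩
  ℕtoℚ (toℕ j) - 0ℚ                 ≡⟨ ℚₚ.+-identityʳ (ℕtoℚ (toℕ j)) ⟩
  ℕtoℚ (toℕ j)                      ∎
  where
  open ≡-Reasoning
  complement : ∀ {g} (j l : Fin g) → sq (1ℚ - le j l) ≡ 1ℚ - le j l
  complement Fin.zero l = refl
  complement (Fin.suc j) Fin.zero = refl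
  complement (Fin.suc j) (Fin.suc l) = complement j l

sq-step-sym : ∀ {g} (i j l : Fin g) → sq (step i j l) ≡ sq (step j i l)
sq-step-sym i j l = flip (le i l) (le j l)
  where
  flip : ∀ p q → (p - q) * (p - q) ≡ (q - p) * (q - p)
  flip = solve-∀ ℚ-ring

dist-sym : ∀ {g} (i j : Fin g) → dist i j ≡ dist j i
dist-sym i j = Σ-cong (sq-step-sym i j)

dist-suc : ∀ {g} (i j : Fin g) → dist (Fin.suc i) (Fin.suc j) ≡ dist i j
dist-suc i j = ℚₚ.+-identityˡ (dist i j)

-- The offset `c` makes the induction possible: peeling off the first term replaces `c` by `c + 1ℚ`.
Σ-from : ∀ n c → 2ℚ * Σℚ {n} (λ j → c + ℕtoℚ (toℕ j)) ≡ ℕtoℚ n * (2ℚ * c + ℕtoℚ n - 1ℚ)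
Σ-from zero c = sym (ℚₚ.*-zeroˡ (2ℚ * c + 0ℚ - 1ℚ))
Σ-from (suc n) c = begin
  2ℚ * ((c + 0ℚ) + Σℚ {n} (λ j → c + ℕtoℚ (suc (toℕ j))))
    ≡⟨ cong (λ q → 2ℚ * ((c + 0ℚ) + q)) (Σ-cong {n} (λ j → trans (cong (c +_) (ℕtoℚ-suc (toℕ j))) (sym (ℚₚ.+-assoc c 1ℚ (ℕtoℚ (toℕ j)))))) ⟩
  2ℚ * ((c + 0ℚ) + S)
    ≡⟨ ℚₚ.*-distribˡ-+ 2ℚ (c + 0ℚ) S ⟩
  2ℚ * (c + 0ℚ) + 2ℚ * S
    ≡⟨ cong (2ℚ * (c + 0ℚ) +_) (Σ-from n (c + 1ℚ)) ⟩
  2ℚ * (c + 0ℚ) + ℕtoℚ n * (2ℚ * (c + 1ℚ) + ℕtoℚ n - 1ℚ)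
    ≡⟨ arith c (ℕtoℚ n) ⟩
  (1ℚ + ℕtoℚ n) * (2ℚ * c + (1ℚ + ℕtoℚ n) - 1ℚ)
    ≡⟨ cong (λ N → N * (2ℚ * c + N - 1ℚ)) (sym (ℕtoℚ-suc n)) ⟩
  ℕtoℚ (suc n) * (2ℚ * c + ℕtoℚ (suc n) - 1ℚ) ∎
  where
  open ≡-Reasoning
  S = Σℚ {n} (λ j → (c + 1ℚ) + ℕtoℚ (toℕ j))
  arith : ∀ c n → 2ℚ * (c + 0ℚ) + n * (2ℚ * (c + 1ℚ) + n - 1ℚ) ≡ (1ℚ + n) * (2ℚ * c + (1ℚ + n) - 1ℚ)
  arith = solve-∀ ℚ-ring

6ℚ : ℚ
6ℚ = ℕtoℚ 6

-- Again the offset moves with the induction, here to `c - 1ℚ`; it is later set to a position on the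
-- cycle.
Σ-sq-from : ∀ n c → 6ℚ * Σℚ {n} (λ j → sq (ℕtoℚ (toℕ j) - c)) ≡
  ℕtoℚ n * (6ℚ * (c * c) - 6ℚ * c * (ℕtoℚ n - 1ℚ) + (ℕtoℚ n - 1ℚ) * (2ℚ * ℕtoℚ n - 1ℚ))
Σ-sq-from zero c = trans (ℚₚ.*-zeroʳ 6ℚ) (sym (ℚₚ.*-zeroˡ (6ℚ * (c * c) - 6ℚ * c * (0ℚ - 1ℚ) + (0ℚ - 1ℚ) * (2ℚ * 0ℚ - 1ℚ))))
Σ-sq-from (suc n) c = begin
  6ℚ * (sq (0ℚ - c) + Σℚ {n} (λ j → sq (ℕtoℚ (suc (toℕ j)) - c)))
    ≡⟨ cong (λ q → 6ℚ * (sq (0ℚ - c) + q)) (Σ-cong {n} (λ j → cong sq (trans (cong (_- c) (ℕtoℚ-suc (toℕ j))) (regroup (ℕtoℚ (toℕ j)) c)))) ⟩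
  6ℚ * (sq (0ℚ - c) + S)
    ≡⟨ ℚₚ.*-distribˡ-+ 6ℚ (sq (0ℚ - c)) S ⟩
  6ℚ * sq (0ℚ - c) + 6ℚ * S
    ≡⟨ cong (6ℚ * sq (0ℚ - c) +_) (Σ-sq-from n (c - 1ℚ)) ⟩
  _ ≡⟨ arith c (ℕtoℚ n) ⟩
  closed (1ℚ + ℕtoℚ n)
    ≡⟨ cong closed (sym (ℕtoℚ-suc n)) ⟩
  closed (ℕtoℚ (suc n)) ∎
  where
  open ≡-Reasoning
  S = Σℚ {n} (λ j → sq (ℕtoℚ (toℕ j) - (c - 1ℚ)))
  closed : ℚ → ℚ
  closed n = n * (6ℚ * (c * c) - 6ℚ * c * (n - 1ℚ) + (n - 1ℚ) * (2ℚ * n - 1ℚ))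
  regroup : ∀ j c → (1ℚ + j) - c ≡ j - (c - 1ℚ)
  regroup = solve-∀ ℚ-ring
  arith : ∀ c n → 6ℚ * ((0ℚ - c) * (0ℚ - c)) + n * (6ℚ * ((c - 1ℚ) * (c - 1ℚ)) - 6ℚ * (c - 1ℚ) * (n - 1ℚ) + (n - 1ℚ) * (2ℚ * n - 1ℚ))
    ≡ (1ℚ + n) * (6ℚ * (c * c) - 6ℚ * c * ((1ℚ + n) - 1ℚ) + ((1ℚ + n) - 1ℚ) * (2ℚ * (1ℚ + n) - 1ℚ))
  arith = solve-∀ ℚ-ring

-- Two triangular numbers, one for each side of `i`.
Σ-dist : ∀ {g} (i : Fin g) → let N = ℕtoℚ g ; I = ℕtoℚ (toℕ i) in
  2ℚ * Σℚ (dist i) ≡ I * (I + 1ℚ) + (N - I - 1ℚ) * (N - I)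
Σ-dist {suc g} Fin.zero = begin
  2ℚ * Σℚ (dist {suc g} Fin.zero)                       ≡⟨ cong (2ℚ *_) (Σ-cong {suc g} (λ j → trans (dist-0j j) (sym (ℚₚ.+-identityˡ (ℕtoℚ (toℕ j)))))) ⟩
  2ℚ * Σℚ {suc g} (λ j → 0ℚ + ℕtoℚ (toℕ j))             ≡⟨ Σ-from (suc g) 0ℚ ⟩
  ℕtoℚ (suc g) * (2ℚ * 0ℚ + ℕtoℚ (suc g) - 1ℚ)          ≡⟨ arith (ℕtoℚ (suc g)) ⟩
  0ℚ * (0ℚ + 1ℚ) + (ℕtoℚ (suc g) - 0ℚ - 1ℚ) * (ℕtoℚ (suc g) - 0ℚ) ∎
  where
  open ≡-Reasoning
  arith : ∀ n → n * (2ℚ * 0ℚ + n - 1ℚ) ≡ 0ℚ * (0ℚ + 1ℚ) + (n - 0ℚ - 1ℚ) * (n - 0ℚ)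
  arith = solve-∀ ℚ-ring
Σ-dist {suc g} (Fin.suc i) = begin
  2ℚ * (dist (Fin.suc i) Fin.zero + Σℚ (λ j → dist (Fin.suc i) (Fin.suc j)))
    ≡⟨ cong (2ℚ *_) (cong₂ _+_ (trans (dist-sym (Fin.suc i) Fin.zero) (trans (dist-0j (Fin.suc i)) (ℕtoℚ-suc (toℕ i)))) (Σ-cong (dist-suc i))) ⟩
  2ℚ * ((1ℚ + I) + Σℚ (dist i))
    ≡⟨ ℚₚ.*-distribˡ-+ 2ℚ (1ℚ + I) (Σℚ (dist i)) ⟩
  2ℚ * (1ℚ + I) + 2ℚ * Σℚ (dist i)
    ≡⟨ cong (2ℚ * (1ℚ + I) +_) (Σ-dist i) ⟩
  2ℚ * (1ℚ + I) + (I * (I + 1ℚ) + (N - I - 1ℚ) * (N - I))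
    ≡⟨ arith I N ⟩
  (1ℚ + I) * ((1ℚ + I) + 1ℚ) + ((1ℚ + N) - (1ℚ + I) - 1ℚ) * ((1ℚ + N) - (1ℚ + I))
    ≡⟨ sym (cong₂ (λ N I → I * (I + 1ℚ) + (N - I - 1ℚ) * (N - I)) (ℕtoℚ-suc g) (ℕtoℚ-suc (toℕ i))) ⟩
  _ ∎
  where
  open ≡-Reasoning
  N = ℕtoℚ g
  I = ℕtoℚ (toℕ i)
  arith : ∀ I N → 2ℚ * (1ℚ + I) + (I * (I + 1ℚ) + (N - I - 1ℚ) * (N - I)) ≡
    (1ℚ + I) * ((1ℚ + I) + 1ℚ) + ((1ℚ + N) - (1ℚ + I) - 1ℚ) * ((1ℚ + N) - (1ℚ + I))
  arith = solve-∀ ℚ-ring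

-- The sum of k (g - k) over all distances k, independent of `i` by rotational symmetry; in the
-- computation this shows as the cancellation of `I` in `arith`.
κ-row : ∀ {g} (i : Fin g) → 6ℚ * Σℚ (κ i) ≡ ℕtoℚ g * (ℕtoℚ g * ℕtoℚ g - 1ℚ)
κ-row {g} i = begin
  6ℚ * Σℚ (κ i)
    ≡⟨ cong (6ℚ *_) (trans (Σ-- (λ j → N * dist i j) (λ j → Σℚ (step i j) * Σℚ (step i j)))
         (cong₂ _-_ (Σ-*ˡ N (dist i)) (Σ-cong (λ j → cong sq (Σ-step i j))))) ⟩
  6ℚ * (N * Σℚ (dist i) - Σℚ {g} (λ j → sq (ℕtoℚ (toℕ j) - I)))
    ≡⟨ rearrange N (Σℚ (dist i)) (Σℚ {g} (λ j → sq (ℕtoℚ (toℕ j) - I))) ⟩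
  ℕtoℚ 3 * N * (2ℚ * Σℚ (dist i)) - 6ℚ * Σℚ {g} (λ j → sq (ℕtoℚ (toℕ j) - I))
    ≡⟨ cong₂ (λ p q → ℕtoℚ 3 * N * p - q) (Σ-dist i) (Σ-sq-from g I) ⟩
  _ ≡⟨ arith N I ⟩
  N * (N * N - 1ℚ) ∎
  where
  open ≡-Reasoning
  N = ℕtoℚ g
  I = ℕtoℚ (toℕ i)
  rearrange : ∀ N d s → 6ℚ * (N * d - s) ≡ ℕtoℚ 3 * N * (2ℚ * d) - 6ℚ * s
  rearrange = solve-∀ ℚ-ring
  arith : ∀ N I → ℕtoℚ 3 * N * (I * (I + 1ℚ) + (N - I - 1ℚ) * (N - I)) - N * (6ℚ * (I * I) - 6ℚ * I * (N - 1ℚ) + (N - 1ℚ) * (2ℚ * N - 1ℚ))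
    ≡ N * (N * N - 1ℚ)
  arith = solve-∀ ℚ-ring

κ-sym : ∀ {g} (i j : Fin g) → κ i j ≡ κ j i
κ-sym {g} i j = cong₂ _-_ (cong (ℕtoℚ g *_) (dist-sym i j))
  (trans (cong sq (Σ-step i j)) (trans (flip (ℕtoℚ (toℕ i)) (ℕtoℚ (toℕ j))) (sym (cong sq (Σ-step j i)))))
  where
  flip : ∀ p q → (q - p) * (q - p) ≡ (p - q) * (p - q)
  flip = solve-∀ ℚ-ring

κ-refl : ∀ {g} (i : Fin g) → κ i i ≡ 0ℚ
κ-refl {g} i = trans (cong₂ (λ p q → ℕtoℚ g * p - q * q) (trans (Σ-cong (λ l → cancel² (le i l))) (Σ-zero g)) (trans (Σ-cong (λ l → cancel (le i l))) (Σ-zero g))) (vanish (ℕtoℚ g))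
  where
  cancel : ∀ p → p - p ≡ 0ℚ
  cancel = solve-∀ ℚ-ring
  cancel² : ∀ p → (p - p) * (p - p) ≡ 0ℚ
  cancel² = solve-∀ ℚ-ring
  vanish : ∀ N → N * 0ℚ - 0ℚ * 0ℚ ≡ 0ℚ
  vanish = solve-∀ ℚ-ring

-- Cauchy–Schwarz, from Σ_{l,k} (s_l - s_k)² ≥ 0.
κ-nonneg : ∀ {g} (i j : Fin g) → 0ℚ ≤ℚ κ i j
κ-nonneg {g} i j = subst (0ℚ ≤ℚ_) halve (0≤-* {½} (ℚₚ.nonNegative⁻¹ ½) (Σ-nonneg {f = λ l → Σℚ (λ k → sq (s l - s k))} λ l → Σ-nonneg λ k → 0≤-square (s l - s k)))
  where
  open ≡-Reasoning
  s = step i j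
  N = ℕtoℚ g
  S = Σℚ s
  Q = Σℚ (λ l → sq (s l))
  expand : ∀ p q → (p - q) * (p - q) ≡ (p * p + q * q) - (2ℚ * p) * q
  expand = solve-∀ ℚ-ring
  inner : ∀ l → Σℚ (λ k → sq (s l - s k)) ≡ (N * sq (s l) + Q) - 2ℚ * S * s l
  inner l = begin
    Σℚ (λ k → sq (s l - s k))                                     ≡⟨ Σ-cong (λ k → expand (s l) (s k)) ⟩
    Σℚ (λ k → (sq (s l) + sq (s k)) - (2ℚ * s l) * s k)           ≡⟨ Σ-- (λ k → sq (s l) + sq (s k)) (λ k → (2ℚ * s l) * s k) ⟩
    Σℚ (λ k → sq (s l) + sq (s k)) - Σℚ (λ k → (2ℚ * s l) * s k)  ≡⟨ cong₂ _-_ (trans (Σ-+ (λ _ → sq (s l)) (λ k → sq (s k))) (cong (_+ Q) (Σ-const g (sq (s l))))) (Σ-*ˡ (2ℚ * s l) s) ⟩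
    (N * sq (s l) + Q) - (2ℚ * s l) * S                           ≡⟨ cong (λ q → (N * sq (s l) + Q) - q) (swap (s l) S) ⟩
    (N * sq (s l) + Q) - 2ℚ * S * s l                             ∎
    where
    swap : ∀ p q → (2ℚ * p) * q ≡ 2ℚ * q * p
    swap = solve-∀ ℚ-ring
  arith : ∀ N Q S → ½ * ((N * Q + N * Q) - 2ℚ * S * S) ≡ N * Q - S * S
  arith = solve-∀ ℚ-ring
  halve : ½ * Σℚ (λ l → Σℚ (λ k → sq (s l - s k))) ≡ κ i j
  halve = trans (cong (½ *_) (begin
    Σℚ (λ l → Σℚ (λ k → sq (s l - s k)))                      ≡⟨ Σ-cong inner ⟩
    Σℚ (λ l → (N * sq (s l) + Q) - 2ℚ * S * s l)              ≡⟨ Σ-- (λ l → N * sq (s l) + Q) (λ l → 2ℚ * S * s l) ⟩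
    Σℚ (λ l → N * sq (s l) + Q) - Σℚ (λ l → 2ℚ * S * s l)     ≡⟨ cong₂ _-_ (trans (Σ-+ (λ l → N * sq (s l)) (λ _ → Q)) (cong₂ _+_ (Σ-*ˡ N (λ l → sq (s l))) (Σ-const g Q))) (Σ-*ˡ (2ℚ * S) s) ⟩
    (N * Q + N * Q) - 2ℚ * S * S                              ∎)) (arith N Q S)

-- Weighted kernel sums

module _ {n g} (f : Fin g → Fin n) (β : Fin n → Fin g) (β-f : ∀ i → β (f i) ≡ i) where

  private
    -- The indicator of the image of `f`, written as a sum over positions so that sums restricted to
    -- attachment vertices become sums over `Fin g`.
    root : Fin n → ℚ
    root u = Σℚ (λ i → δ (f i) u)

    Σ-root : ∀ h → Σℚ (λ u → root u * h u) ≡ Σℚ (λ i → h (f i))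
    Σ-root h = begin
      Σℚ (λ u → root u * h u)                      ≡⟨ Σ-cong (λ u → sym (Σ-*ʳ (h u) (λ i → δ (f i) u))) ⟩
      Σℚ (λ u → Σℚ (λ i → δ (f i) u * h u))        ≡⟨ Σ-swap (λ u i → δ (f i) u * h u) ⟩
      Σℚ (λ i → Σℚ (λ u → δ (f i) u * h u))        ≡⟨ Σ-cong (λ i → Σ-δ (f i) h) ⟩
      Σℚ (λ i → h (f i))                           ∎
      where open ≡-Reasoning

    root-f : ∀ {u} → f (β u) ≡ u → root u ≡ 1ℚ
    root-f {u} eq = trans (Σ-cong same) (Σ-δ-1 (β u))
      where
      same : ∀ i → δ (f i) u ≡ δ (β u) i
      same i with i Fin.≟ β u
      ... | yes refl = trans (δ-true eq) (sym (δ-refl (β u)))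
      ... | no ne = trans (δ-≢ (λ e → ne (trans (sym (β-f i)) (cong β e)))) (sym (δ-≢ (λ e → ne (sym e))))

    root-≢ : ∀ {u} → f (β u) ≢ u → root u ≡ 0ℚ
    root-≢ {u} ne = trans (Σ-cong λ i → δ-≢ λ e → ne (trans (cong f (trans (sym (cong β e)) (β-f i))) e)) (Σ-zero g)

    root-cases : ∀ u → (root u ≡ 1ℚ × f (β u) ≡ u) ⊎ root u ≡ 0ℚ
    root-cases u with f (β u) Fin.≟ u
    ... | yes eq = inj₁ (root-f eq , eq)
    ... | no ne = inj₂ (root-≢ ne)

  -- Expand Σ_{u,v} (d u - t 1_{im f}(u)) (1 - 1_{im f}(v)) k(β u, β v) ≥ 0.
  weighted-kernel-bound : (d : Fin n → ℚ) (t : ℚ) → (∀ u → 0ℚ ≤ℚ d u) → (∀ i → t ≤ℚ d (f i)) →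
    (k : Fin g → Fin g → ℚ) → (∀ i j → 0ℚ ≤ℚ k i j) → (∀ i j → k i j ≡ k j i) →
    (K : ℚ) → (∀ i → Σℚ (k i) ≡ K) →
    K * (Σℚ d + t * ℕtoℚ n - t * ℕtoℚ g) ≤ℚ Σℚ (λ u → Σℚ (λ v → d u * k (β u) (β v)))
  weighted-kernel-bound d t 0≤d t≤d k 0≤k k-sym K row =
    ≤-from-difference (Σ-nonneg {f = λ u → Σℚ (λ v → term u v)} λ u → Σ-nonneg λ v → 0≤-* (0≤-* (excess u) (off v)) (0≤k (β u) (β v)))
      (sym (begin
        Σℚ (λ u → Σℚ (λ v → term u v))
          ≡⟨ ΣΣ-cong (λ u v → expand (d u) t (root u) (root v) (k (β u) (β v))) ⟩
        Σℚ (λ u → Σℚ (λ v → (A u v - B u v) - (C u v - E u v)))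
          ≡⟨ trans (Σ-cong λ u → trans (Σ-- (λ v → A u v - B u v) (λ v → C u v - E u v)) (cong₂ _-_ (Σ-- (A u) (B u)) (Σ-- (C u) (E u))))
             (trans (Σ-- (λ u → Σℚ (A u) - Σℚ (B u)) (λ u → Σℚ (C u) - Σℚ (E u))) (cong₂ _-_ (Σ-- (λ u → Σℚ (A u)) (λ u → Σℚ (B u))) (Σ-- (λ u → Σℚ (C u)) (λ u → Σℚ (E u))))) ⟩
        (total - Σℚ (λ u → Σℚ (B u))) - (Σℚ (λ u → Σℚ (C u)) - Σℚ (λ u → Σℚ (E u)))
          ≡⟨ cong₂ _-_ (cong (λ q → total - q) ΣB) (cong₂ _-_ ΣC ΣE) ⟩
        (total - Σℚ d * K) - (t * (ℕtoℚ n * K) - t * (ℕtoℚ g * K))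
          ≡⟨ collect total (Σℚ d) t (ℕtoℚ n) (ℕtoℚ g) K ⟩
        total - K * (Σℚ d + t * ℕtoℚ n - t * ℕtoℚ g) ∎))
    where
    open ≡-Reasoning
    term A B C E : Fin n → Fin n → ℚ
    term u v = ((d u - t * root u) * (1ℚ - root v)) * k (β u) (β v)
    A u v = d u * k (β u) (β v)
    B u v = d u * (root v * k (β u) (β v))
    C u v = t * (root u * k (β u) (β v))
    E u v = t * (root u * (root v * k (β u) (β v)))
    total = Σℚ (λ u → Σℚ (A u))
    expand : ∀ d t m m′ k → ((d - t * m) * (1ℚ - m′)) * k ≡ (d * k - d * (m′ * k)) - (t * (m * k) - t * (m * (m′ * k)))
    expand = solve-∀ ℚ-ring
    collect : ∀ T D t n g K → (T - D * K) - (t * (n * K) - t * (g * K)) ≡ T - K * (D + t * n - t * g)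
    collect = solve-∀ ℚ-ring
    root-row : ∀ i → Σℚ (λ v → root v * k i (β v)) ≡ K
    root-row i = trans (Σ-root (λ v → k i (β v))) (trans (Σ-cong (λ j → cong (k i) (β-f j))) (row i))
    ΣB : Σℚ (λ u → Σℚ (B u)) ≡ Σℚ d * K
    ΣB = trans (Σ-cong (λ u → trans (Σ-*ˡ (d u) (λ v → root v * k (β u) (β v))) (cong (d u *_) (root-row (β u))))) (Σ-*ʳ K d)
    ΣC : Σℚ (λ u → Σℚ (C u)) ≡ t * (ℕtoℚ n * K)
    ΣC = trans (ΣΣ-*ˡ t (λ u v → root u * k (β u) (β v))) (cong (t *_)
      (trans (Σ-swap (λ u v → root u * k (β u) (β v)))
      (trans (Σ-cong (λ v → trans (Σ-cong (λ u → cong (root u *_) (k-sym (β u) (β v)))) (root-row (β v)))) (Σ-const n K))))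
    ΣE : Σℚ (λ u → Σℚ (E u)) ≡ t * (ℕtoℚ g * K)
    ΣE = trans (ΣΣ-*ˡ t (λ u v → root u * (root v * k (β u) (β v)))) (cong (t *_)
      (trans (Σ-cong (λ u → trans (Σ-*ˡ (root u) (λ v → root v * k (β u) (β v))) (cong (root u *_) (root-row (β u)))))
      (trans (Σ-root (λ _ → K)) (Σ-const g K))))
    excess : ∀ u → 0ℚ ≤ℚ d u - t * root u
    excess u with root-cases u
    ... | inj₁ (r , eq) = subst (λ q → 0ℚ ≤ℚ d u - q) (sym (trans (cong (t *_) r) (ℚₚ.*-identityʳ t)))
      (difference-nonneg (subst (λ x → t ≤ℚ d x) eq (t≤d (β u))))
    ... | inj₂ r = subst (λ q → 0ℚ ≤ℚ d u - q) (sym (trans (cong (t *_) r) (ℚₚ.*-zeroʳ t)))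
      (subst (0ℚ ≤ℚ_) (sym (ℚₚ.+-identityʳ (d u))) (0≤d u))
    off : ∀ v → 0ℚ ≤ℚ 1ℚ - root v
    off v with root-cases v
    ... | inj₁ (r , _) = subst (λ q → 0ℚ ≤ℚ 1ℚ - q) (sym r) ℚₚ.≤-refl
    ... | inj₂ r = subst (λ q → 0ℚ ≤ℚ 1ℚ - q) (sym r) (ℚₚ.nonNegative⁻¹ 1ℚ)

-- Sums over unordered pairs and edge counts

<ᵇ-true : ∀ {a b} → a ℕ.< b → (a ℕ.<ᵇ b) ≡ true
<ᵇ-true {a} {b} lt with a ℕ.<ᵇ b in eq
... | true = refl
... | false = ⊥-elim (subst T eq (ℕₚ.<⇒<ᵇ lt))

<ᵇ-false : ∀ {a b} → ¬ (a ℕ.< b) → (a ℕ.<ᵇ b) ≡ false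
<ᵇ-false {a} {b} ¬lt with a ℕ.<ᵇ b in eq
... | false = refl
... | true = ⊥-elim (¬lt (ℕₚ.<ᵇ⇒< a b (subst T (sym eq) tt)))

-- The weight of an unordered pair is distributed over its two orderings. The diagonal is zero, so
-- the ordered sum may include it.
Σ-pairs : ∀ {n} (a : Fin n → ℚ) (h : Fin n → Fin n → ℚ) → (∀ u v → h u v ≡ h v u) → (∀ u → h u u ≡ 0ℚ) →
  Σℚ (λ u → Σℚ (λ v → if toℕ u ℕ.<ᵇ toℕ v then (a u + a v) * h u v else 0ℚ)) ≡ Σℚ (λ u → Σℚ (λ v → a u * h u v))
Σ-pairs {n} a h h-sym h-diag = begin
  Σℚ (λ u → Σℚ (λ v → if toℕ u ℕ.<ᵇ toℕ v then (a u + a v) * h u v else 0ℚ))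
    ≡⟨ ΣΣ-cong (λ u v → trans (if-𝟙 (toℕ u ℕ.<ᵇ toℕ v) _) (split (lt u v) (a u) (a v) (h u v))) ⟩
  Σℚ (λ u → Σℚ (λ v → lt u v * (a u * h u v) + lt u v * (a v * h u v)))
    ≡⟨ ΣΣ-+ (λ u v → lt u v * (a u * h u v)) (λ u v → lt u v * (a v * h u v)) ⟩
  Σℚ (λ u → Σℚ (λ v → lt u v * (a u * h u v))) + Σℚ (λ u → Σℚ (λ v → lt u v * (a v * h u v)))
    ≡⟨ cong (Σℚ (λ u → Σℚ (λ v → lt u v * (a u * h u v))) +_) (Σ-swap (λ u v → lt u v * (a v * h u v))) ⟩
  Σℚ (λ u → Σℚ (λ v → lt u v * (a u * h u v))) + Σℚ (λ u → Σℚ (λ v → lt v u * (a u * h v u)))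
    ≡⟨ sym (ΣΣ-+ (λ u v → lt u v * (a u * h u v)) (λ u v → lt v u * (a u * h v u))) ⟩
  Σℚ (λ u → Σℚ (λ v → lt u v * (a u * h u v) + lt v u * (a u * h v u)))
    ≡⟨ ΣΣ-cong merge ⟩
  Σℚ (λ u → Σℚ (λ v → a u * h u v)) ∎
  where
  open ≡-Reasoning
  lt : Fin n → Fin n → ℚ
  lt u v = 𝟙 (toℕ u ℕ.<ᵇ toℕ v)
  split : ∀ b p q r → b * ((p + q) * r) ≡ b * (p * r) + b * (q * r)
  split = solve-∀ ℚ-ring
  left : ∀ p q → 1ℚ * p + 0ℚ * q ≡ p
  left = solve-∀ ℚ-ring
  right : ∀ p q → 0ℚ * q + 1ℚ * p ≡ p
  right = solve-∀ ℚ-ring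
  merge : ∀ u v → lt u v * (a u * h u v) + lt v u * (a u * h v u) ≡ a u * h u v
  merge u v with ℕₚ.<-cmp (toℕ u) (toℕ v)
  ... | tri< u<v _ v≮u rewrite <ᵇ-true u<v | <ᵇ-false v≮u = left (a u * h u v) (a u * h v u)
  ... | tri> u≮v _ v<u rewrite <ᵇ-true v<u | <ᵇ-false u≮v | h-sym v u = right (a u * h u v) (a u * h u v)
  ... | tri≈ _ u≡v _ rewrite Finₚ.toℕ-injective u≡v | h-diag v = vanish (lt v v) (a v)
    where
    vanish : ∀ b p → b * (p * 0ℚ) + b * (p * 0ℚ) ≡ p * 0ℚ
    vanish = solve-∀ ℚ-ring

edgeSum-const : ∀ {n} (D : EdgeSet n) c → edgeSum D (λ _ _ → c) ≡ edgeSum D (λ _ _ → 1ℚ) * c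
edgeSum-const D c = trans (Σ-cong λ w → trans (Σ-cong λ x → cong (_* c) (sym (ℚₚ.*-identityʳ (𝟙 (D w x))))) (Σ-*ʳ c (λ x → 𝟙 (D w x) * 1ℚ)))
  (Σ-*ʳ c (λ w → Σℚ (λ x → 𝟙 (D w x) * 1ℚ)))

degℚ : ∀ {n} → Graph n → Fin n → ℚ
degℚ G u = ℕtoℚ (deg G u)

degℚ-Σ : ∀ {n} (G : Graph n) u → degℚ G u ≡ Σℚ (λ x → 𝟙 (G u x))
degℚ-Σ G u = trans (ℕtoℚ-Σ (λ x → b2ℕ (G u x))) (Σ-cong λ x → b2ℕ-𝟙 (G u x))

Σ-degree : ∀ {n} (G : Graph n) → Σℚ (degℚ G) ≡ edgeSum G (λ _ _ → 1ℚ)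
Σ-degree G = Σ-cong λ u → trans (degℚ-Σ G u) (Σ-cong λ x → sym (ℚₚ.*-identityʳ (𝟙 (G u x))))

handshake : ∀ {n} (G : Graph n) → IsSimple G → edgeSum G (λ _ _ → 1ℚ) ≡ 2ℚ * ℕtoℚ (numEdges G)
handshake {n} G (G-sym , G-irr) = sym (begin
  2ℚ * ℕtoℚ (numEdges G)
    ≡⟨ cong (2ℚ *_) (trans (ℕtoℚ-Σ {n} _) (Σ-cong {n} λ u → trans (ℕtoℚ-Σ {n} _) (Σ-cong {n} λ v → entry u v))) ⟩
  2ℚ * Σℚ (λ u → Σℚ (λ v → if toℕ u ℕ.<ᵇ toℕ v then (½ + ½) * 𝟙 (G u v) else 0ℚ))
    -- Constant weight `½` gives each unordered pair weight 1, so counting edges becomes an instance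
    -- of `Σ-pairs`.
    ≡⟨ cong (2ℚ *_) (Σ-pairs (λ _ → ½) (λ u v → 𝟙 (G u v)) (λ u v → cong 𝟙 (G-sym u v)) (λ u → cong 𝟙 (G-irr u))) ⟩
  2ℚ * Σℚ (λ u → Σℚ (λ v → ½ * 𝟙 (G u v)))
    ≡⟨ sym (ΣΣ-*ˡ 2ℚ (λ u v → ½ * 𝟙 (G u v))) ⟩
  Σℚ (λ u → Σℚ (λ v → 2ℚ * (½ * 𝟙 (G u v))))
    ≡⟨ ΣΣ-cong (λ u v → whole (𝟙 (G u v))) ⟩
  edgeSum G (λ _ _ → 1ℚ) ∎)
  where
  open ≡-Reasoning
  whole : ∀ p → 2ℚ * (½ * p) ≡ p * 1ℚ
  whole = solve-∀ ℚ-ring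
  entry : ∀ u v → ℕtoℚ (b2ℕ ((toℕ u ℕ.<ᵇ toℕ v) ∧ G u v)) ≡ (if toℕ u ℕ.<ᵇ toℕ v then (½ + ½) * 𝟙 (G u v) else 0ℚ)
  entry u v with toℕ u ℕ.<ᵇ toℕ v
  ... | false = refl
  ... | true = trans (b2ℕ-𝟙 (G u v)) (sym (ℚₚ.*-identityˡ (𝟙 (G u v))))

if-mono : ∀ b {p q} → (b ≡ true → p ≤ℚ q) → (if b then p else 0ℚ) ≤ℚ (if b then q else 0ℚ)
if-mono true le = le refl
if-mono false _ = ℚₚ.≤-refl

degree-≥1 : ∀ {n} (G : Graph n) {u a} → G u a ≡ true → 1ℚ ≤ℚ degℚ G u
degree-≥1 G {u} {a} e = subst₂ _≤ℚ_ (Σ-δ-1 a) (sym (degℚ-Σ G u)) (Σ-mono bound)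
  where
  bound : ∀ x → δ a x ≤ℚ 𝟙 (G u x)
  bound x with a Fin.≟ x
  ... | yes refl rewrite e | δ-refl a = ℚₚ.≤-refl
  ... | no ne rewrite δ-≢ ne = 0≤𝟙 (G u x)

degree-≥2 : ∀ {n} (G : Graph n) {u a b} → a ≢ b → G u a ≡ true → G u b ≡ true → 2ℚ ≤ℚ degℚ G u
degree-≥2 G {u} {a} {b} a≢b ea eb = subst₂ _≤ℚ_ (trans (Σ-+ (δ a) (δ b)) (cong₂ _+_ (Σ-δ-1 a) (Σ-δ-1 b))) (sym (degℚ-Σ G u)) (Σ-mono bound)
  where
  bound : ∀ x → δ a x + δ b x ≤ℚ 𝟙 (G u x)
  bound x with a Fin.≟ x | b Fin.≟ x
  ... | yes refl | yes refl = ⊥-elim (a≢b refl)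
  ... | yes refl | no nb rewrite ea | δ-refl a | δ-≢ nb = ℚₚ.≤-refl
  ... | no na | yes refl rewrite eb | δ-refl b | δ-≢ na = ℚₚ.≤-refl
  ... | no na | no nb rewrite δ-≢ na | δ-≢ nb = 0≤𝟙 (G u x)

reciprocal : ∀ g → ∃ λ c → 0ℚ ≤ℚ c × c * ℕtoℚ (suc g) ≡ 1ℚ
reciprocal g = 1/ N , ℚₚ.nonNegative⁻¹ (1/ N) {{ℚₚ.pos⇒nonNeg (1/ N) {{ℚₚ.1/pos⇒pos N}}}} , ℚₚ.*-inverseˡ N
  where
  N = ℕtoℚ (suc g)
  instance
    N-positive : Positive N
    N-positive = positive (ℚₚ.<-≤-trans (ℚₚ.positive⁻¹ 1ℚ)
      (subst (1ℚ ≤ℚ_) (sym (ℕtoℚ-suc g)) (subst (_≤ℚ 1ℚ + ℕtoℚ g) (ℚₚ.+-identityʳ 1ℚ) (ℚₚ.+-monoʳ-≤ 1ℚ (0≤ℕtoℚ g)))))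
    N-nonZero : NonZero N
    N-nonZero = ℚₚ.pos⇒nonZero N

sixth : ℚ
sixth = ℤ.+ 1 / 6

-- The first two factors are the row sum of k (g - k) / g; the last is the total weight in
-- `weighted-kernel-bound` for `t = 2ℚ`, with `D` the degree sum.
cycleBound : ℚ → ℚ → ℚ → ℚ
cycleBound g D N = sixth * (g * g - 1ℚ) * (D + 2ℚ * N - 2ℚ * g)

-- Bicyclic graphs with two cycles

-- The indicator of `i ≢ j`, kept in the shape of the right-hand side of `bridge-energy`.
split₂ : Fin 2 → Fin 2 → ℚ
split₂ i j = sq (le i Fin.zero - le j Fin.zero)

split₂-sym : ∀ i j → split₂ i j ≡ split₂ j i
split₂-sym Fin.zero Fin.zero = refl
split₂-sym Fin.zero (Fin.suc Fin.zero) = refl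
split₂-sym (Fin.suc Fin.zero) Fin.zero = refl
split₂-sym (Fin.suc Fin.zero) (Fin.suc Fin.zero) = refl

split₂-row : ∀ i → Σℚ (split₂ i) ≡ 1ℚ
split₂-row Fin.zero = refl
split₂-row (Fin.suc Fin.zero) = refl

split₂-refl : ∀ i → split₂ i i ≡ 0ℚ
split₂-refl Fin.zero = refl
split₂-refl (Fin.suc Fin.zero) = refl

pair : ∀ {n} → Fin n → Fin n → Fin 2 → Fin n
pair x y Fin.zero = x
pair x y (Fin.suc Fin.zero) = y

ΣΣ-combine : ∀ {n} (d : Fin n → ℚ) (f g h : Fin n → Fin n → ℚ) {F} → Σℚ (λ i → Σℚ (λ j → d i * f i j)) ≡ F →
  Σℚ (λ i → Σℚ (λ j → d i * (½ * f i j + g i j + h i j))) ≡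
  ½ * F + Σℚ (λ i → Σℚ (λ j → d i * g i j)) + Σℚ (λ i → Σℚ (λ j → d i * h i j))
ΣΣ-combine d f g h {F} eq = begin
  Σℚ (λ i → Σℚ (λ j → d i * (½ * f i j + g i j + h i j)))
    ≡⟨ ΣΣ-cong (λ i j → distrib (d i) (f i j) (g i j) (h i j)) ⟩
  Σℚ (λ i → Σℚ (λ j → ½ * df i j + dg i j + dh i j))
    ≡⟨ ΣΣ-+ (λ i j → ½ * df i j + dg i j) dh ⟩
  Σℚ (λ i → Σℚ (λ j → ½ * df i j + dg i j)) + Σℚ (λ i → Σℚ (dh i))
    ≡⟨ cong (_+ Σℚ (λ i → Σℚ (dh i))) (trans (ΣΣ-+ (λ i j → ½ * df i j) dg)
         (cong (_+ Σℚ (λ i → Σℚ (dg i))) (trans (ΣΣ-*ˡ ½ df) (cong (½ *_) eq)))) ⟩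
  ½ * F + Σℚ (λ i → Σℚ (dg i)) + Σℚ (λ i → Σℚ (dh i)) ∎
  where
  open ≡-Reasoning
  df = λ i j → d i * f i j
  dg = λ i j → d i * g i j
  dh = λ i j → d i * h i j
  distrib : ∀ d p q r → d * (½ * p + q + r) ≡ ½ * (d * p) + d * q + d * r
  distrib = solve-∀ ℚ-ring

module CycleBound {n} {G : Graph n} (simple : IsSimple G) (connected : Connected G)
  {C C′ : EdgeSet n} (isCycle : IsCycle G C) (only : ∀ K → IsCycle G K → K ≐ C ⊎ K ≐ C′) where

  private
    G-sym = proj₁ simple
  open OnCycle {G = G} isCycle public
  open OneOfTwoCycles {G = G} G-sym isCycle only using (separated)

  branches : Branching G C f
  branches = branching f G-sym C-sym connected (C⊆G G-sym) ends separated
    where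
    ends : ∀ {u v} → C u v ≡ true → ∃ λ i → f i ≡ u
    ends {u} {v} c with C-sound u v c
    ... | i , inj₁ (p , _) = i , p
    ... | i , inj₂ (_ , q) = cnext i , q

  open Branching branches public

  degree-f : ∀ i → 2ℚ ≤ℚ degℚ G (f i)
  degree-f i = degree-≥2 G {a = f (cnext i)} {b = f p} (λ eq → cnext²-≢ p (trans (cong cnext cnext-p) (f-injective _ p eq)))
    (f-edge i) (trans (G-sym (f i) (f p)) (subst (λ j → G (f p) (f j) ≡ true) cnext-p (f-edge p)))
    where
    open Shift i
    -- Rotation by `g - 1`, the predecessor of `i`: the second neighbour of `f i` on the cycle.
    p = shift (2 ℕ.+ m)
    cnext-p : cnext p ≡ i
    cnext-p = trans (shift-suc (2 ℕ.+ m)) (trans shift-period shift-0)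

  c : ℚ
  c = proj₁ (reciprocal (2 ℕ.+ m))

  0≤c : 0ℚ ≤ℚ c
  0≤c = proj₁ (proj₂ (reciprocal (2 ℕ.+ m)))

  c*g : c * ℕtoℚ g ≡ 1ℚ
  c*g = proj₂ (proj₂ (reciprocal (2 ℕ.+ m)))

  ρ : Fin n → Fin n → ℚ
  ρ u v = c * κ (β u) (β v)

  edge-count : edgeSum C (λ _ _ → 1ℚ) ≡ 2ℚ * ℕtoℚ g
  edge-count = trans (edgeSum-cycle {G = G} isCycle (λ _ _ → 1ℚ)) (trans (Σ-const g (1ℚ + 1ℚ)) (ℚₚ.*-comm (ℕtoℚ g) 2ℚ))

  ρ-energy : ∀ {u v} → u ≢ v → (φ : Fin n → ℚ) → (∀ w → laplacian G φ w ≡ current u v w) →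
    2ℚ * ρ u v ≤ℚ edgeSum C (λ w x → sq (φ w - φ x))
  ρ-energy {u} {v} u≢v φ kirchhoff = subst₂ _≤ℚ_ (pull c (κ (β u) (β v)))
    (trans (sym (ℚₚ.*-assoc c (ℕtoℚ g) E)) (trans (cong (_* E) c*g) (ℚₚ.*-identityˡ E)))
    (*-monoˡ-≤ 0≤c (cycle-energy G-sym u≢v φ kirchhoff isCycle branches))
    where
    E = edgeSum C (λ w x → sq (φ w - φ x))
    pull : ∀ c k → c * (2ℚ * k) ≡ 2ℚ * (c * k)
    pull = solve-∀ ℚ-ring

  -- `weighted-kernel-bound` with `t = 2ℚ`, since an attachment vertex has two neighbours on the
  -- cycle, and with row sum g (g² - 1) / 6, divided by `g` through `c`.
  ρ-total : cycleBound (ℕtoℚ g) (Σℚ (degℚ G)) (ℕtoℚ n) ≤ℚ Σℚ (λ u → Σℚ (λ v → degℚ G u * ρ u v))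
  ρ-total = subst₂ _≤ℚ_ (trans (regroup c (ℕtoℚ g) X) (trans (cong (λ q → q * (sixth * (ℕtoℚ g * ℕtoℚ g - 1ℚ) * X)) c*g) (ℚₚ.*-identityˡ _)))
      (trans (sym (ΣΣ-*ˡ c (λ u v → degℚ G u * κ (β u) (β v)))) (ΣΣ-cong λ u v → pull c (degℚ G u) (κ (β u) (β v))))
    (*-monoˡ-≤ 0≤c (weighted-kernel-bound f β β-f (degℚ G) 2ℚ (λ u → 0≤ℕtoℚ (deg G u)) degree-f κ κ-nonneg κ-sym
      (sixth * (ℕtoℚ g * (ℕtoℚ g * ℕtoℚ g - 1ℚ))) (λ i → trans (sym (sixth-6 (Σℚ (κ i)))) (cong (sixth *_) (κ-row i)))))
    where
    X = Σℚ (degℚ G) + 2ℚ * ℕtoℚ n - 2ℚ * ℕtoℚ g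
    regroup : ∀ c g X → c * (sixth * (g * (g * g - 1ℚ)) * X) ≡ (c * g) * (sixth * (g * g - 1ℚ) * X)
    regroup = solve-∀ ℚ-ring
    sixth-6 : ∀ p → sixth * (6ℚ * p) ≡ p
    sixth-6 = solve-∀ ℚ-ring
    pull : ∀ c d k → c * (d * k) ≡ d * (c * k)
    pull = solve-∀ ℚ-ring

  ρ-sym : ∀ u v → ρ u v ≡ ρ v u
  ρ-sym u v = cong (c *_) (κ-sym (β u) (β v))

  ρ-refl : ∀ u → ρ u u ≡ 0ℚ
  ρ-refl u = trans (cong (c *_) (κ-refl (β u))) (ℚₚ.*-zeroʳ c)

module TwoCycleBound {n} {G : Graph n} (simple : IsSimple G) (connected : Connected G)
  {C₁ C₂ : EdgeSet n} (isCycle₁ : IsCycle G C₁) (isCycle₂ : IsCycle G C₂) (C₁≭C₂ : ¬ (C₁ ≐ C₂))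
  (only : ∀ K → IsCycle G K → K ≐ C₁ ⊎ K ≐ C₂) where

  private
    G-sym = proj₁ simple
    G-irr = proj₂ simple
    swap : ∀ K → IsCycle G K → K ≐ C₂ ⊎ K ≐ C₁
    swap K isK with only K isK
    ... | inj₁ eq = inj₂ eq
    ... | inj₂ eq = inj₁ eq
    module Y₁ = CycleBound simple connected isCycle₁ only
    module Y₂ = CycleBound simple connected isCycle₂ swap
    d = degℚ G
    N = ℕtoℚ n

  B : EdgeSet n
  B = (G ∖ C₁) ∖ C₂

  -- The cycles share no edge, so no edge is counted twice.
  edges-split : ∀ w x → 𝟙 (G w x) ≡ 𝟙 (B w x) + 𝟙 (C₁ w x) + 𝟙 (C₂ w x)
  edges-split w x with C₁ w x in c₁ | C₂ w x in c₂
  ... | true | true = ⊥-elim (cycles-disjoint G-sym isCycle₁ isCycle₂ only C₁≭C₂ c₁ c₂)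
  ... | true | false rewrite Y₁.C⊆G G-sym c₁ | ≢true {B w x} (λ h → true≢false c₁ (∖-removes (∖-⊆ h))) = refl
  ... | false | true rewrite Y₂.C⊆G G-sym c₂ | ≢true {B w x} (λ h → true≢false c₂ (∖-removes h)) = refl
  ... | false | false with G w x in e
  ... | true rewrite ∖-keeps {G = G ∖ C₁} {D = C₂} (∖-keeps {G = G} e c₁) c₂ = refl
  ... | false rewrite ≢true {B w x} (λ h → true≢false (∖-⊆ (∖-⊆ h)) e) = refl

  edgeSum-split : ∀ k → edgeSum G k ≡ edgeSum B k + edgeSum C₁ k + edgeSum C₂ k
  edgeSum-split k = begin
    edgeSum G k
      ≡⟨ ΣΣ-cong (λ w x → trans (cong (_* k w x) (edges-split w x)) (distrib (𝟙 (B w x)) (𝟙 (C₁ w x)) (𝟙 (C₂ w x)) (k w x))) ⟩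
    Σℚ (λ w → Σℚ (λ x → 𝟙 (B w x) * k w x + 𝟙 (C₁ w x) * k w x + 𝟙 (C₂ w x) * k w x))
      ≡⟨ trans (ΣΣ-+ (λ w x → 𝟙 (B w x) * k w x + 𝟙 (C₁ w x) * k w x) (λ w x → 𝟙 (C₂ w x) * k w x))
           (cong (_+ edgeSum C₂ k) (ΣΣ-+ (λ w x → 𝟙 (B w x) * k w x) (λ w x → 𝟙 (C₁ w x) * k w x))) ⟩
    edgeSum B k + edgeSum C₁ k + edgeSum C₂ k ∎
    where
    open ≡-Reasoning
    distrib : ∀ p q r k → (p + q + r) * k ≡ p * k + q * k + r * k
    distrib = solve-∀ ℚ-ring

  -- An edge on neither cycle lies on no cycle, so its removal separates its ends and yields two
  -- branches.
  bridge? : ∀ w x → (B w x ≡ true × w ≢ x × Branching G (edgeOf w x) (pair w x)) ⊎ B w x ≡ false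
  bridge? w x with B w x in b
  ... | false = inj₂ refl
  ... | true = inj₁ (refl , w≢x , branching (pair w x) G-sym (edgeOf-sym w x) connected edge⊆G ends separated)
    where
    Gwx : G w x ≡ true
    Gwx = ∖-⊆ (∖-⊆ b)
    w≢x : w ≢ x
    w≢x refl = true≢false Gwx (G-irr w)
    edge⊆G : edgeOf w x ⊆ᴳ G
    edge⊆G h with edgeOf-sound h
    ... | inj₁ (refl , refl) = Gwx
    ... | inj₂ (refl , refl) = trans (G-sym x w) Gwx
    ends : ∀ {u v} → edgeOf w x u v ≡ true → ∃ λ i → pair w x i ≡ u
    ends h with edgeOf-sound h
    ... | inj₁ (p , _) = Fin.zero , p
    ... | inj₂ (_ , q) = Fin.suc Fin.zero , q
    no-walk : ¬ Walk (G ∖ edgeOf w x) w x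
    no-walk = other-edge-bridge G-sym isCycle₁ isCycle₂ only G-irr Gwx (∖-removes (∖-⊆ b)) (∖-removes b)
    separated : ∀ {i j} → i ≢ j → ¬ Walk (G ∖ edgeOf w x) (pair w x i) (pair w x j)
    separated {Fin.zero} {Fin.zero} ne _ = ne refl
    separated {Fin.zero} {Fin.suc Fin.zero} _ p = no-walk p
    separated {Fin.suc Fin.zero} {Fin.zero} _ p = no-walk (reverseʷ (∖-sym G-sym (edgeOf-sym w x)) p)
    separated {Fin.suc Fin.zero} {Fin.suc Fin.zero} ne _ = ne refl

  -- 1 if the bridge wx separates u and v, else 0 (also when wx is not a bridge).
  τ : Fin n → Fin n → Fin n → Fin n → ℚ
  τ w x u v with bridge? w x
  ... | inj₁ (_ , _ , br) = split₂ (Branching.β br u) (Branching.β br v)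
  ... | inj₂ _ = 0ℚ

  τ-sym : ∀ w x u v → τ w x u v ≡ τ w x v u
  τ-sym w x u v with bridge? w x
  ... | inj₁ (_ , _ , br) = split₂-sym (Branching.β br u) (Branching.β br v)
  ... | inj₂ _ = refl

  τ-refl : ∀ w x u → τ w x u u ≡ 0ℚ
  τ-refl w x u with bridge? w x
  ... | inj₁ (_ , _ , br) = split₂-refl (Branching.β br u)
  ... | inj₂ _ = refl

  τ-energy : ∀ {u v} → u ≢ v → (φ : Fin n → ℚ) → (∀ w → laplacian G φ w ≡ current u v w) →
    ∀ w x → 𝟙 (B w x) * τ w x u v ≡ 𝟙 (B w x) * sq (φ w - φ x)
  τ-energy u≢v φ kirchhoff w x with bridge? w x
  ... | inj₁ (_ , w≢x , br) = cong (𝟙 (B w x) *_) (sym (bridge-energy G-sym u≢v φ kirchhoff w≢x br))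
  ... | inj₂ b rewrite b = sym (ℚₚ.*-zeroˡ (sq (φ w - φ x)))

  -- `weighted-kernel-bound` with two branches, row sum 1 and `t = 1ℚ`; once the degree sum is known
  -- to be 2 (n + 1), the bracket on the left equals 3n.
  τ-total : ∀ w x → 𝟙 (B w x) * (Σℚ d + N - 2ℚ) ≤ℚ 𝟙 (B w x) * Σℚ (λ u → Σℚ (λ v → d u * τ w x u v))
  τ-total w x with bridge? w x
  ... | inj₁ (b , _ , br) = *-monoˡ-≤ (0≤𝟙 (B w x)) (ℚₚ.≤-trans (ℚₚ.≤-reflexive (sym (simplify (Σℚ d) N)))
      (weighted-kernel-bound (pair w x) (Branching.β br) (Branching.β-f br) d 1ℚ (λ u → 0≤ℕtoℚ (deg G u)) degree-pair
        split₂ (λ i j → 0≤-square (le i Fin.zero - le j Fin.zero)) split₂-sym 1ℚ split₂-row))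
    where
    Gwx : G w x ≡ true
    Gwx = ∖-⊆ (∖-⊆ b)
    degree-pair : ∀ i → 1ℚ ≤ℚ d (pair w x i)
    degree-pair Fin.zero = degree-≥1 G Gwx
    degree-pair (Fin.suc Fin.zero) = degree-≥1 G (trans (G-sym x w) Gwx)
    simplify : ∀ D n → 1ℚ * (D + 1ℚ * n - 1ℚ * 2ℚ) ≡ D + n - 2ℚ
    simplify = solve-∀ ℚ-ring
  ... | inj₂ b = ℚₚ.≤-reflexive (trans (vanishing (Σℚ d + N - 2ℚ)) (sym (vanishing (Σℚ {n} (λ u → Σℚ {n} (λ v → d u * 0ℚ))))))
    where
    vanishing : ∀ q → 𝟙 (B w x) * q ≡ 0ℚ
    vanishing q = trans (cong (λ t → 𝟙 t * q) b) (ℚₚ.*-zeroˡ q)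

  ρ : Fin n → Fin n → ℚ
  ρ u v = ½ * edgeSum B (λ w x → τ w x u v) + Y₁.ρ u v + Y₂.ρ u v

  ρ-sym : ∀ u v → ρ u v ≡ ρ v u
  ρ-sym u v = cong₂ _+_ (cong₂ _+_ (cong (½ *_) (ΣΣ-cong λ w x → cong (𝟙 (B w x) *_) (τ-sym w x u v))) (Y₁.ρ-sym u v)) (Y₂.ρ-sym u v)

  ρ-refl : ∀ u → ρ u u ≡ 0ℚ
  ρ-refl u = trans (cong₂ _+_ (cong₂ _+_ (cong (½ *_) zeros) (Y₁.ρ-refl u)) (Y₂.ρ-refl u)) refl
    where
    zeros : edgeSum B (λ w x → τ w x u u) ≡ 0ℚ
    zeros = trans (Σ-cong λ w → trans (Σ-cong λ x → trans (cong (𝟙 (B w x) *_) (τ-refl w x u)) (ℚₚ.*-zeroʳ (𝟙 (B w x)))) (Σ-zero n)) (Σ-zero n)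

  -- By Green's identity with the potential as its own test function, `r` is half of the ordered
  -- energy sum; its parts over bridges and over the two cycles are bounded separately, for
  -- whichever potential witnesses `r`.
  resistance-≥ : ∀ {u v r} → u ≢ v → IsResistance G u v r → ρ u v ≤ℚ r
  resistance-≥ {u} {v} u≢v (φ , kirchhoff , refl) = subst₂ _≤ℚ_ (collect EB (Y₁.ρ u v) (Y₂.ρ u v)) (halve (φ u - φ v))
    (*-monoˡ-≤ {r = ½} (ℚₚ.nonNegative⁻¹ ½) (begin
      EB + 2ℚ * Y₁.ρ u v + 2ℚ * Y₂.ρ u v
        ≤⟨ ℚₚ.+-mono-≤ (ℚₚ.+-mono-≤ (ℚₚ.≤-reflexive (ΣΣ-cong (τ-energy u≢v φ kirchhoff)))
             (Y₁.ρ-energy u≢v φ kirchhoff)) (Y₂.ρ-energy u≢v φ kirchhoff) ⟩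
      edgeSum B energy + edgeSum C₁ energy + edgeSum C₂ energy
        ≡⟨ sym (edgeSum-split energy) ⟩
      edgeSum G energy
        ≡⟨ green G-sym u≢v φ kirchhoff φ ⟩
      2ℚ * (φ u - φ v) ∎))
    where
    open ℚₚ.≤-Reasoning
    EB = edgeSum B (λ w x → τ w x u v)
    energy : Fin n → Fin n → ℚ
    energy w x = sq (φ w - φ x)
    collect : ∀ p q r → ½ * (p + 2ℚ * q + 2ℚ * r) ≡ ½ * p + q + r
    collect = solve-∀ ℚ-ring
    halve : ∀ p → ½ * (2ℚ * p) ≡ p
    halve = solve-∀ ℚ-ring

  bridges : ℚ
  bridges = edgeSum B (λ _ _ → 1ℚ)

  ρ-total : ½ * (bridges * (Σℚ d + N - 2ℚ))
      + cycleBound (ℕtoℚ Y₁.g) (Σℚ d) N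
      + cycleBound (ℕtoℚ Y₂.g) (Σℚ d) N
    ≤ℚ Σℚ (λ u → Σℚ (λ v → d u * ρ u v))
  ρ-total = ℚₚ.≤-trans (ℚₚ.+-mono-≤ (ℚₚ.+-mono-≤ bridge-part Y₁.ρ-total) Y₂.ρ-total) (ℚₚ.≤-reflexive (sym total))
    where
    open ≡-Reasoning
    bridge-part : ½ * (bridges * (Σℚ d + N - 2ℚ)) ≤ℚ ½ * edgeSum B (λ w x → Σℚ (λ u → Σℚ (λ v → d u * τ w x u v)))
    bridge-part = *-monoˡ-≤ {r = ½} (ℚₚ.nonNegative⁻¹ ½)
      (ℚₚ.≤-trans (ℚₚ.≤-reflexive (sym (edgeSum-const B (Σℚ d + N - 2ℚ)))) (ΣΣ-mono τ-total))
    pull : ∀ d b t → d * (b * t) ≡ b * (d * t)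
    pull = solve-∀ ℚ-ring
    pull-Σ : ∀ u v → d u * edgeSum B (λ w x → τ w x u v) ≡ edgeSum B (λ w x → d u * τ w x u v)
    pull-Σ u v = trans (sym (ΣΣ-*ˡ (d u) (λ w x → 𝟙 (B w x) * τ w x u v))) (ΣΣ-cong λ w x → pull (d u) (𝟙 (B w x)) (τ w x u v))
    exchange : Σℚ (λ u → Σℚ (λ v → d u * edgeSum B (λ w x → τ w x u v))) ≡ edgeSum B (λ w x → Σℚ (λ u → Σℚ (λ v → d u * τ w x u v)))
    exchange = begin
      Σℚ (λ u → Σℚ (λ v → d u * edgeSum B (λ w x → τ w x u v)))
        ≡⟨ ΣΣ-cong pull-Σ ⟩
      Σℚ (λ u → Σℚ (λ v → Σℚ (λ w → Σℚ (λ x → b w x u v))))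
        ≡⟨ Σ-cong (λ u → Σ-swap (λ v w → Σℚ (λ x → b w x u v))) ⟩
      Σℚ (λ u → Σℚ (λ w → Σℚ (λ v → Σℚ (λ x → b w x u v))))
        ≡⟨ Σ-swap (λ u w → Σℚ (λ v → Σℚ (λ x → b w x u v))) ⟩
      Σℚ (λ w → Σℚ (λ u → Σℚ (λ v → Σℚ (λ x → b w x u v))))
        ≡⟨ ΣΣ-cong (λ w u → Σ-swap (λ v x → b w x u v)) ⟩
      Σℚ (λ w → Σℚ (λ u → Σℚ (λ x → Σℚ (λ v → b w x u v))))
        ≡⟨ Σ-cong (λ w → Σ-swap (λ u x → Σℚ (λ v → b w x u v))) ⟩
      Σℚ (λ w → Σℚ (λ x → Σℚ (λ u → Σℚ (λ v → b w x u v))))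
        ≡⟨ ΣΣ-cong (λ w x → ΣΣ-*ˡ (𝟙 (B w x)) (λ u v → d u * τ w x u v)) ⟩
      edgeSum B (λ w x → Σℚ (λ u → Σℚ (λ v → d u * τ w x u v))) ∎
      where
      b : Fin n → Fin n → Fin n → Fin n → ℚ
      b w x u v = 𝟙 (B w x) * (d u * τ w x u v)
    total : Σℚ (λ u → Σℚ (λ v → d u * ρ u v)) ≡
      ½ * edgeSum B (λ w x → Σℚ (λ u → Σℚ (λ v → d u * τ w x u v)))
        + Σℚ (λ u → Σℚ (λ v → d u * Y₁.ρ u v)) + Σℚ (λ u → Σℚ (λ v → d u * Y₂.ρ u v))
    total = ΣΣ-combine d (λ u v → edgeSum B (λ w x → τ w x u v)) Y₁.ρ Y₂.ρ exchange

  D_R-≥ : ∀ {x} → HasDR G x → Σℚ (λ u → Σℚ (λ v → d u * ρ u v)) ≤ℚ x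
  D_R-≥ (R , isR , refl) = ℚₚ.≤-trans (ℚₚ.≤-reflexive (sym (Σ-pairs d ρ ρ-sym ρ-refl))) (ΣΣ-mono bound)
    where
    bound : ∀ u v → (if toℕ u ℕ.<ᵇ toℕ v then (d u + d v) * ρ u v else 0ℚ) ≤ℚ
                    (if toℕ u ℕ.<ᵇ toℕ v then ℕtoℚ (deg G u ℕ.+ deg G v) * R u v else 0ℚ)
    bound u v = if-mono (toℕ u ℕ.<ᵇ toℕ v) λ lt → let u<v = ℕₚ.<ᵇ⇒< (toℕ u) (toℕ v) (subst T (sym lt) tt) in
      ℚₚ.≤-trans (*-monoˡ-≤ {ρ u v} {R u v} {d u + d v} (0≤-+ (0≤ℕtoℚ (deg G u)) (0≤ℕtoℚ (deg G v)))
          (resistance-≥ (λ u≡v → ℕₚ.<-irrefl (cong toℕ u≡v) u<v) (isR u v u<v)))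
        (ℚₚ.≤-reflexive (cong (_* R u v) (sym (ℕtoℚ-+ (deg G u) (deg G v)))))

  -- The edge count enters twice: it fixes the degree sum (`Σd`) and it ties the number `b` of
  -- bridges to the cycle lengths (`N≡`).
  lower-bound : numEdges G ≡ suc n → ∀ {x} → HasDR G x → DRvalue n ≤ℚ x
  lower-bound edges hasDR = ℚₚ.≤-trans (ℚₚ.≤-reflexive (sym value≡)) (ℚₚ.≤-trans
      (ℚₚ.+-monoʳ-≤ (ℕtoℚ 3 * N * b) (ℚₚ.+-mono-≤ (cycle-term Y₁.m b (Y₂.m) N 0≤b n₁) (cycle-term Y₂.m b Y₁.m N 0≤b n₂)))
      (ℚₚ.≤-trans (ℚₚ.≤-reflexive (sym total≡)) (ℚₚ.≤-trans ρ-total (D_R-≥ hasDR))))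
    where
    open ≡-Reasoning
    M₁ = ℕtoℚ Y₁.m
    M₂ = ℕtoℚ Y₂.m
    b : ℚ
    b = ½ * bridges
    -- A minorant of `W` linear in the excess length `M`: the exact value at a triangle plus `3 * N`
    -- per further edge, the price of a bridge. The sum of all contributions then depends on
    -- `b + M₁ + M₂` only, which is `N - 5`.
    Target : ℚ → ℚ → ℚ
    Target M N = (ℤ.+ 16 / 3) * (N - 1ℚ) + ℕtoℚ 3 * N * M
    W : ℚ → ℚ → ℚ
    W M N = cycleBound (ℕtoℚ 3 + M) (2ℚ * (1ℚ + N)) N
    0≤b : 0ℚ ≤ℚ b
    0≤b = 0≤-* {½} (ℚₚ.nonNegative⁻¹ ½) (Σ-nonneg {f = λ w → Σℚ (λ x → 𝟙 (B w x) * 1ℚ)} λ w → Σ-nonneg λ x → 0≤-* (0≤𝟙 (B w x)) (ℚₚ.nonNegative⁻¹ 1ℚ))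
    Σd : Σℚ d ≡ 2ℚ * (1ℚ + N)
    Σd = trans (Σ-degree G) (trans (handshake G simple) (cong (2ℚ *_) (trans (cong ℕtoℚ edges) (ℕtoℚ-suc n))))
    N≡ : N ≡ b + (ℕtoℚ 3 + M₁) + (ℕtoℚ 3 + M₂) - 1ℚ
    N≡ = begin
      N                                                             ≡⟨ halve N ⟩
      ½ * (2ℚ * (1ℚ + N)) - 1ℚ                                      ≡⟨ cong (λ q → ½ * q - 1ℚ) (sym (trans (sym (Σ-degree G)) Σd)) ⟩
      ½ * edgeSum G (λ _ _ → 1ℚ) - 1ℚ                               ≡⟨ cong (λ q → ½ * q - 1ℚ) (edgeSum-split (λ _ _ → 1ℚ)) ⟩
      ½ * (bridges + edgeSum C₁ (λ _ _ → 1ℚ) + edgeSum C₂ (λ _ _ → 1ℚ)) - 1ℚ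
        ≡⟨ cong₂ (λ p q → ½ * (bridges + p + q) - 1ℚ) (trans Y₁.edge-count (cong (2ℚ *_) (ℕtoℚ-+ 3 Y₁.m))) (trans Y₂.edge-count (cong (2ℚ *_) (ℕtoℚ-+ 3 Y₂.m))) ⟩
      ½ * (bridges + 2ℚ * (ℕtoℚ 3 + M₁) + 2ℚ * (ℕtoℚ 3 + M₂)) - 1ℚ  ≡⟨ distrib bridges M₁ M₂ ⟩
      b + (ℕtoℚ 3 + M₁) + (ℕtoℚ 3 + M₂) - 1ℚ                        ∎
      where
      halve : ∀ N → N ≡ ½ * (2ℚ * (1ℚ + N)) - 1ℚ
      halve = solve-∀ ℚ-ring
      distrib : ∀ b p q → ½ * (b + 2ℚ * (ℕtoℚ 3 + p) + 2ℚ * (ℕtoℚ 3 + q)) - 1ℚ ≡ ½ * b + (ℕtoℚ 3 + p) + (ℕtoℚ 3 + q) - 1ℚ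
      distrib = solve-∀ ℚ-ring
    n₁ : N ≡ M₁ + (b + M₂) + ℕtoℚ 5
    n₁ = trans N≡ (arith b M₁ M₂)
      where
      arith : ∀ b p q → b + (ℕtoℚ 3 + p) + (ℕtoℚ 3 + q) - 1ℚ ≡ p + (b + q) + ℕtoℚ 5
      arith = solve-∀ ℚ-ring
    n₂ : N ≡ M₂ + (b + M₁) + ℕtoℚ 5
    n₂ = trans N≡ (arith b M₁ M₂)
      where
      arith : ∀ b p q → b + (ℕtoℚ 3 + p) + (ℕtoℚ 3 + q) - 1ℚ ≡ q + (b + p) + ℕtoℚ 5
      arith = solve-∀ ℚ-ring
    -- Integrality is essential here: the product is negative strictly between 0 and 1.
    0≤M[M-1] : ∀ m → 0ℚ ≤ℚ ℕtoℚ m * (ℕtoℚ m - 1ℚ)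
    0≤M[M-1] zero = ℚₚ.≤-reflexive (sym (ℚₚ.*-zeroˡ (0ℚ - 1ℚ)))
    0≤M[M-1] (suc m) = 0≤-* (0≤ℕtoℚ (suc m)) (subst (0ℚ ≤ℚ_) (sym (trans (cong (_- 1ℚ) (ℕtoℚ-suc m)) (cancel (ℕtoℚ m)))) (0≤ℕtoℚ m))
      where
      cancel : ∀ p → (1ℚ + p) - 1ℚ ≡ p
      cancel = solve-∀ ℚ-ring
    -- Writing `N` as `M + S + 5` with slack `S = b + M′` turns the difference into one third of M³
    -- + 5M (M - 1) + S (2M² + 3M), whose terms are all nonnegative; it vanishes for a triangle.
    cycle-term : ∀ m b m′ N → 0ℚ ≤ℚ b → N ≡ ℕtoℚ m + (b + ℕtoℚ m′) + ℕtoℚ 5 → Target (ℕtoℚ m) N ≤ℚ W (ℕtoℚ m) N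
    cycle-term m b m′ _ 0≤b refl = ≤-from-difference
      (0≤-* {ℤ.+ 1 / 3} (ℚₚ.nonNegative⁻¹ (ℤ.+ 1 / 3)) (0≤-+ (0≤-+
        (0≤-* (0≤-* (0≤ℕtoℚ m) (0≤ℕtoℚ m)) (0≤ℕtoℚ m))
        (0≤-* (0≤ℕtoℚ 5) (0≤M[M-1] m)))
        (0≤-* (0≤-+ 0≤b (0≤ℕtoℚ m′)) (0≤-+ (0≤-* (0≤ℕtoℚ 2) (0≤-* (0≤ℕtoℚ m) (0≤ℕtoℚ m))) (0≤-* (0≤ℕtoℚ 3) (0≤ℕtoℚ m))))))
      (arith (ℕtoℚ m) (b + ℕtoℚ m′))
      where
      arith : ∀ M S → (ℤ.+ 1 / 6) * ((ℕtoℚ 3 + M) * (ℕtoℚ 3 + M) - 1ℚ) * (2ℚ * (1ℚ + (M + S + ℕtoℚ 5)) + 2ℚ * (M + S + ℕtoℚ 5) - 2ℚ * (ℕtoℚ 3 + M))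
          - ((ℤ.+ 16 / 3) * ((M + S + ℕtoℚ 5) - 1ℚ) + ℕtoℚ 3 * (M + S + ℕtoℚ 5) * M)
        ≡ (ℤ.+ 1 / 3) * (M * M * M + ℕtoℚ 5 * (M * (M - 1ℚ)) + S * (2ℚ * (M * M) + ℕtoℚ 3 * M))
      arith = solve-∀ ℚ-ring
    value≡ : ℕtoℚ 3 * N * b + (Target M₁ N + Target M₂ N) ≡ DRvalue n
    value≡ = begin
      ℕtoℚ 3 * N * b + (Target M₁ N + Target M₂ N)
        ≡⟨ arith N b M₁ M₂ ⟩
      ℕtoℚ 3 * N * ((b + (ℕtoℚ 3 + M₁) + (ℕtoℚ 3 + M₂) - 1ℚ) - ℕtoℚ 5) + (ℤ.+ 32 / 3) * (N - 1ℚ)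
        ≡⟨ cong (λ q → ℕtoℚ 3 * N * (q - ℕtoℚ 5) + (ℤ.+ 32 / 3) * (N - 1ℚ)) (sym N≡) ⟩
      ℕtoℚ 3 * N * (N - ℕtoℚ 5) + (ℤ.+ 32 / 3) * (N - 1ℚ)
        ≡⟨ arith′ N ⟩
      ℕtoℚ 3 * (N * N) - (ℤ.+ 13 / 3) * N - ℤ.+ 32 / 3
        ≡⟨ cong (λ q → q - (ℤ.+ 13 / 3) * N - ℤ.+ 32 / 3) (sym (trans (ℕtoℚ-* 3 (n ℕ.* n)) (cong (ℕtoℚ 3 *_) (ℕtoℚ-* n n)))) ⟩
      DRvalue n ∎
      where
      arith : ∀ N b p q → ℕtoℚ 3 * N * b + (((ℤ.+ 16 / 3) * (N - 1ℚ) + ℕtoℚ 3 * N * p) + ((ℤ.+ 16 / 3) * (N - 1ℚ) + ℕtoℚ 3 * N * q))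
        ≡ ℕtoℚ 3 * N * ((b + (ℕtoℚ 3 + p) + (ℕtoℚ 3 + q) - 1ℚ) - ℕtoℚ 5) + (ℤ.+ 32 / 3) * (N - 1ℚ)
      arith = solve-∀ ℚ-ring
      arith′ : ∀ N → ℕtoℚ 3 * N * (N - ℕtoℚ 5) + (ℤ.+ 32 / 3) * (N - 1ℚ) ≡ ℕtoℚ 3 * (N * N) - (ℤ.+ 13 / 3) * N - ℤ.+ 32 / 3
      arith′ = solve-∀ ℚ-ring
    total≡ : ½ * (bridges * (Σℚ d + N - 2ℚ))
        + cycleBound (ℕtoℚ Y₁.g) (Σℚ d) N
        + cycleBound (ℕtoℚ Y₂.g) (Σℚ d) N
      ≡ ℕtoℚ 3 * N * b + (W M₁ N + W M₂ N)
    total≡ = begin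
      ½ * (bridges * (Σℚ d + N - 2ℚ)) + cycleBound (ℕtoℚ Y₁.g) (Σℚ d) N + cycleBound (ℕtoℚ Y₂.g) (Σℚ d) N
        ≡⟨ cong₂ _+_ (cong₂ _+_ (cong (λ D → ½ * (bridges * (D + N - 2ℚ))) Σd)
             (cong₂ (λ g D → cycleBound g D N) (ℕtoℚ-+ 3 Y₁.m) Σd)) (cong₂ (λ g D → cycleBound g D N) (ℕtoℚ-+ 3 Y₂.m) Σd) ⟩
      ½ * (bridges * (2ℚ * (1ℚ + N) + N - 2ℚ)) + W M₁ N + W M₂ N
        ≡⟨ ℚₚ.+-assoc (½ * (bridges * (2ℚ * (1ℚ + N) + N - 2ℚ))) (W M₁ N) (W M₂ N) ⟩
      ½ * (bridges * (2ℚ * (1ℚ + N) + N - 2ℚ)) + (W M₁ N + W M₂ N)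
        ≡⟨ cong (_+ (W M₁ N + W M₂ N)) (arith bridges N) ⟩
      ℕtoℚ 3 * N * b + (W M₁ N + W M₂ N) ∎
      where
      arith : ∀ b N → ½ * (b * (2ℚ * (1ℚ + N) + N - 2ℚ)) ≡ ℕtoℚ 3 * N * (½ * b)
      arith = solve-∀ ℚ-ring

-- The extremal graph

pattern v₀ = Fin.zero
pattern v₁ = Fin.suc Fin.zero
pattern v₂ = Fin.suc (Fin.suc Fin.zero)
pattern v₃ = Fin.suc (Fin.suc (Fin.suc Fin.zero))
pattern v₄ = Fin.suc (Fin.suc (Fin.suc (Fin.suc Fin.zero)))
pattern leaf p = Fin.suc (Fin.suc (Fin.suc (Fin.suc (Fin.suc p))))

module _ {k : ℕ} where

  private
    n = 5 ℕ.+ k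
    S = S33 n
    K = ℕtoℚ k

  ⅔ ⅓ : ℚ
  ⅔ = ℤ.+ 2 / 3
  ⅓ = ℤ.+ 1 / 3

  -- Potential of a unit current from u to the common vertex v₀, which is grounded.
  potential : Fin n → Fin n → ℚ
  potential v₁ v₁ = ⅔
  potential v₁ v₂ = ⅓
  potential v₂ v₁ = ⅓
  potential v₂ v₂ = ⅔
  potential v₃ v₃ = ⅔
  potential v₃ v₄ = ⅓
  potential v₄ v₃ = ⅓
  potential v₄ v₄ = ⅔
  potential (leaf p) (leaf q) = δ p q
  potential _ _ = 0ℚ

  leaves-nonadjacent : ∀ p q → S (leaf p) (leaf q) ≡ false
  leaves-nonadjacent p q with toℕ p ℕ.<ᵇ toℕ q | toℕ q ℕ.<ᵇ toℕ p
  ... | true | _ = refl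
  ... | false | true = refl
  ... | false | false = refl

  laplacian-leaf : ∀ φ q → laplacian S φ (leaf q) ≡ φ (leaf q) - φ v₀
  laplacian-leaf φ q = trans (cong (λ s → (φ (leaf q) - φ v₀) + (0ℚ + (0ℚ + (0ℚ + (0ℚ + s)))))
      (trans (Σ-cong (λ r → cong (λ b → if b then φ (leaf q) - φ (leaf r) else 0ℚ) (leaves-nonadjacent q r))) (Σ-zero k)))
    (ℚₚ.+-identityʳ (φ (leaf q) - φ v₀))

  -- Only the number of leaves is variable, so an entry at one of the five named vertices computes
  -- once its sum over leaves is collapsed.
  laplacian-potential : ∀ u w → laplacian S (potential u) w ≡ δ u w - δ v₀ w
  laplacian-potential v₀ v₀ rewrite Σ-zero k = refl
  laplacian-potential v₀ v₁ rewrite Σ-zero k = refl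
  laplacian-potential v₀ v₂ rewrite Σ-zero k = refl
  laplacian-potential v₀ v₃ rewrite Σ-zero k = refl
  laplacian-potential v₀ v₄ rewrite Σ-zero k = refl
  laplacian-potential v₀ (leaf q) = laplacian-leaf (potential v₀) q
  laplacian-potential v₁ v₀ rewrite Σ-zero k = refl
  laplacian-potential v₁ v₁ rewrite Σ-zero k = refl
  laplacian-potential v₁ v₂ rewrite Σ-zero k = refl
  laplacian-potential v₁ v₃ rewrite Σ-zero k = refl
  laplacian-potential v₁ v₄ rewrite Σ-zero k = refl
  laplacian-potential v₁ (leaf q) = laplacian-leaf (potential v₁) q
  laplacian-potential v₂ v₀ rewrite Σ-zero k = refl
  laplacian-potential v₂ v₁ rewrite Σ-zero k = refl
  laplacian-potential v₂ v₂ rewrite Σ-zero k = refl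
  laplacian-potential v₂ v₃ rewrite Σ-zero k = refl
  laplacian-potential v₂ v₄ rewrite Σ-zero k = refl
  laplacian-potential v₂ (leaf q) = laplacian-leaf (potential v₂) q
  laplacian-potential v₃ v₀ rewrite Σ-zero k = refl
  laplacian-potential v₃ v₁ rewrite Σ-zero k = refl
  laplacian-potential v₃ v₂ rewrite Σ-zero k = refl
  laplacian-potential v₃ v₃ rewrite Σ-zero k = refl
  laplacian-potential v₃ v₄ rewrite Σ-zero k = refl
  laplacian-potential v₃ (leaf q) = laplacian-leaf (potential v₃) q
  laplacian-potential v₄ v₀ rewrite Σ-zero k = refl
  laplacian-potential v₄ v₁ rewrite Σ-zero k = refl
  laplacian-potential v₄ v₂ rewrite Σ-zero k = refl
  laplacian-potential v₄ v₃ rewrite Σ-zero k = refl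
  laplacian-potential v₄ v₄ rewrite Σ-zero k = refl
  laplacian-potential v₄ (leaf q) = laplacian-leaf (potential v₄) q
  laplacian-potential (leaf p) v₁ rewrite Σ-zero k = refl
  laplacian-potential (leaf p) v₂ rewrite Σ-zero k = refl
  laplacian-potential (leaf p) v₃ rewrite Σ-zero k = refl
  laplacian-potential (leaf p) v₄ rewrite Σ-zero k = refl
  -- At the centre the sum over leaves is not zero: it carries the unit current arriving from leaf
  -- `p`.
  laplacian-potential (leaf p) v₀ = cong (λ s → 0ℚ + (0ℚ + (0ℚ + (0ℚ + (0ℚ + s)))))
    (trans (Σ-- (λ _ → 0ℚ) (δ p)) (cong₂ _-_ (Σ-zero k) (Σ-δ-1 p)))
  laplacian-potential (leaf p) (leaf q) = laplacian-leaf (potential (leaf p)) q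

  laplacian-diff : ∀ (G : Graph n) φ ψ w → laplacian G (λ x → φ x - ψ x) w ≡ laplacian G φ w - laplacian G ψ w
  laplacian-diff G φ ψ w = trans (Σ-cong term) (Σ-- (λ x → if G w x then φ w - φ x else 0ℚ) (λ x → if G w x then ψ w - ψ x else 0ℚ))
    where
    regroup : ∀ a b c d → (a - b) - (c - d) ≡ (a - c) - (b - d)
    regroup = solve-∀ ℚ-ring
    term : ∀ x → (if G w x then (φ w - ψ w) - (φ x - ψ x) else 0ℚ) ≡ (if G w x then φ w - φ x else 0ℚ) - (if G w x then ψ w - ψ x else 0ℚ)
    term x with G w x
    ... | true = regroup (φ w) (ψ w) (φ x) (ψ x)
    ... | false = refl

  -- Superposition: in `potential u - potential v` the currents extracted at `v₀` cancel, leaving a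
  -- unit current from `u` to `v`. As a matrix, `potential` restricted to the other vertices inverts
  -- the Laplacian with the row and column of `v₀` removed.
  resistance : Fin n → Fin n → ℚ
  resistance u v = (potential u u - potential v u) - (potential u v - potential v v)

  isResistance : ∀ {u v} → u ≢ v → IsResistance S u v (resistance u v)
  isResistance {u} {v} u≢v = (λ w → potential u w - potential v w) , kirchhoff , refl
    where
    cancel : ∀ a b c → (a - c) - (b - c) ≡ a - b
    cancel = solve-∀ ℚ-ring
    kirchhoff : ∀ w → laplacian S (λ x → potential u x - potential v x) w ≡ current u v w
    kirchhoff w = trans (laplacian-diff S (potential u) (potential v) w)
      (trans (cong₂ _-_ (laplacian-potential u w) (laplacian-potential v w))
      (trans (cancel (δ u w) (δ v w) (δ v₀ w)) (sym (current-δ u≢v w))))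

  potential-sym : ∀ u v → potential u v ≡ potential v u
  potential-sym v₀ v₀ = refl
  potential-sym v₀ v₁ = refl
  potential-sym v₀ v₂ = refl
  potential-sym v₀ v₃ = refl
  potential-sym v₀ v₄ = refl
  potential-sym v₀ (leaf q) = refl
  potential-sym v₁ v₀ = refl
  potential-sym v₁ v₁ = refl
  potential-sym v₁ v₂ = refl
  potential-sym v₁ v₃ = refl
  potential-sym v₁ v₄ = refl
  potential-sym v₁ (leaf q) = refl
  potential-sym v₂ v₀ = refl
  potential-sym v₂ v₁ = refl
  potential-sym v₂ v₂ = refl
  potential-sym v₂ v₃ = refl
  potential-sym v₂ v₄ = refl
  potential-sym v₂ (leaf q) = refl
  potential-sym v₃ v₀ = refl
  potential-sym v₃ v₁ = refl
  potential-sym v₃ v₂ = refl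
  potential-sym v₃ v₃ = refl
  potential-sym v₃ v₄ = refl
  potential-sym v₃ (leaf q) = refl
  potential-sym v₄ v₀ = refl
  potential-sym v₄ v₁ = refl
  potential-sym v₄ v₂ = refl
  potential-sym v₄ v₃ = refl
  potential-sym v₄ v₄ = refl
  potential-sym v₄ (leaf q) = refl
  potential-sym (leaf p) v₀ = refl
  potential-sym (leaf p) v₁ = refl
  potential-sym (leaf p) v₂ = refl
  potential-sym (leaf p) v₃ = refl
  potential-sym (leaf p) v₄ = refl
  potential-sym (leaf p) (leaf q) = δ-sym p q

  resistance-sym : ∀ u v → resistance u v ≡ resistance v u
  resistance-sym u v = flip (potential u u) (potential v u) (potential u v) (potential v v)
    where
    flip : ∀ a b c d → (a - b) - (c - d) ≡ (d - c) - (b - a)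
    flip = solve-∀ ℚ-ring

  resistance-refl : ∀ u → resistance u u ≡ 0ℚ
  resistance-refl u = cancel (potential u u)
    where
    cancel : ∀ a → (a - a) - (a - a) ≡ 0ℚ
    cancel = solve-∀ ℚ-ring

  trace : ℚ
  trace = (ℤ.+ 8 / 3) + K

  Σ-potential-diagonal : Σℚ (λ v → potential v v) ≡ trace
  Σ-potential-diagonal = trans (cong (λ s → 0ℚ + (⅔ + (⅔ + (⅔ + (⅔ + s)))))
      (trans (Σ-cong {k} δ-refl) (trans (Σ-const k 1ℚ) (ℚₚ.*-identityʳ K)))) (collect K)
    where
    collect : ∀ s → 0ℚ + ((ℤ.+ 2 / 3) + ((ℤ.+ 2 / 3) + ((ℤ.+ 2 / 3) + ((ℤ.+ 2 / 3) + s)))) ≡ (ℤ.+ 8 / 3) + s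
    collect = solve-∀ ℚ-ring

  -- By symmetry of `potential` a resistance is the sum of two diagonal entries minus twice an
  -- off-diagonal one, so a row sum needs only a diagonal entry, the trace and a row sum of
  -- `potential`.
  Σ-resistance : ∀ u {s} → Σℚ (potential u) ≡ s → Σℚ (resistance u) ≡ (ℕtoℚ 5 + K) * potential u u + trace - 2ℚ * s
  Σ-resistance u {s} row = begin
    Σℚ (resistance u)
      ≡⟨ Σ-cong (λ v → trans (cong (λ q → (potential u u - q) - (potential u v - potential v v)) (potential-sym v u)) (regroup (potential u u) (potential u v) (potential v v))) ⟩
    Σℚ {n} (λ v → (potential u u + potential v v) - 2ℚ * potential u v)
      ≡⟨ Σ-- (λ v → potential u u + potential v v) (λ v → 2ℚ * potential u v) ⟩
    Σℚ {n} (λ v → potential u u + potential v v) - Σℚ {n} (λ v → 2ℚ * potential u v)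
      ≡⟨ cong₂ _-_ (trans (Σ-+ (λ _ → potential u u) (λ v → potential v v))
           (cong₂ _+_ (trans (Σ-const n (potential u u)) (cong (_* potential u u) (ℕtoℚ-+ 5 k))) Σ-potential-diagonal))
         (trans (Σ-*ˡ 2ℚ (potential u)) (cong (2ℚ *_) row)) ⟩
    (ℕtoℚ 5 + K) * potential u u + trace - 2ℚ * s ∎
    where
    open ≡-Reasoning
    regroup : ∀ a b c → (a - b) - (b - c) ≡ (a + c) - 2ℚ * b
    regroup = solve-∀ ℚ-ring

  triangle-row : ∀ {u} → u ≡ v₁ ⊎ u ≡ v₂ ⊎ u ≡ v₃ ⊎ u ≡ v₄ → Σℚ (potential u) ≡ 1ℚ
  triangle-row (inj₁ refl) rewrite Σ-zero k = refl
  triangle-row (inj₂ (inj₁ refl)) rewrite Σ-zero k = refl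
  triangle-row (inj₂ (inj₂ (inj₁ refl))) rewrite Σ-zero k = refl
  triangle-row (inj₂ (inj₂ (inj₂ refl))) rewrite Σ-zero k = refl

  centre-row : Σℚ (potential v₀) ≡ 0ℚ
  centre-row rewrite Σ-zero k = refl

  leaf-row : ∀ p → Σℚ (potential (leaf p)) ≡ 1ℚ
  leaf-row p rewrite Σ-δ-1 p = refl

  triangle-degree : ∀ {u} → u ≡ v₁ ⊎ u ≡ v₂ ⊎ u ≡ v₃ ⊎ u ≡ v₄ → degℚ S u ≡ 2ℚ
  triangle-degree {u} u-in = trans (degℚ-Σ S u) (at u-in)
    where
    at : ∀ {u} → u ≡ v₁ ⊎ u ≡ v₂ ⊎ u ≡ v₃ ⊎ u ≡ v₄ → Σℚ (λ x → 𝟙 (S u x)) ≡ 2ℚ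
    at (inj₁ refl) rewrite Σ-zero k = refl
    at (inj₂ (inj₁ refl)) rewrite Σ-zero k = refl
    at (inj₂ (inj₂ (inj₁ refl))) rewrite Σ-zero k = refl
    at (inj₂ (inj₂ (inj₂ refl))) rewrite Σ-zero k = refl

  centre-degree : degℚ S v₀ ≡ ℕtoℚ 4 + K
  centre-degree = trans (degℚ-Σ S v₀) (trans (cong (λ s → 0ℚ + (1ℚ + (1ℚ + (1ℚ + (1ℚ + s)))))
      (trans (Σ-const k 1ℚ) (ℚₚ.*-identityʳ K))) (collect K))
    where
    collect : ∀ s → 0ℚ + (1ℚ + (1ℚ + (1ℚ + (1ℚ + s)))) ≡ ℕtoℚ 4 + s
    collect = solve-∀ ℚ-ring

  leaf-degree : ∀ p → degℚ S (leaf p) ≡ 1ℚ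
  leaf-degree p = trans (degℚ-Σ S (leaf p)) (cong (λ s → 1ℚ + (0ℚ + (0ℚ + (0ℚ + (0ℚ + s)))))
    (trans (Σ-cong (λ q → cong 𝟙 (leaves-nonadjacent p q))) (Σ-zero k)))

  hasDR-S33 : HasDR S (DRvalue n)
  hasDR-S33 = resistance , (λ u v u<v → isResistance λ u≡v → ℕₚ.<-irrefl (cong toℕ u≡v) u<v) , sym (begin
    Σℚ (λ u → Σℚ (λ v → if toℕ u ℕ.<ᵇ toℕ v then ℕtoℚ (deg S u ℕ.+ deg S v) * resistance u v else 0ℚ))
      ≡⟨ ΣΣ-cong (λ u v → cong (λ q → if toℕ u ℕ.<ᵇ toℕ v then q * resistance u v else 0ℚ) (ℕtoℚ-+ (deg S u) (deg S v))) ⟩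
    Σℚ (λ u → Σℚ (λ v → if toℕ u ℕ.<ᵇ toℕ v then (degℚ S u + degℚ S v) * resistance u v else 0ℚ))
      ≡⟨ Σ-pairs (degℚ S) resistance resistance-sym resistance-refl ⟩
    Σℚ (λ u → Σℚ (λ v → degℚ S u * resistance u v))
      ≡⟨ Σ-cong (λ u → Σ-*ˡ (degℚ S u) (resistance u)) ⟩
    Σℚ (λ u → degℚ S u * Σℚ (resistance u))
      ≡⟨ cong₂ _+_ (cong₂ _*_ centre-degree (Σ-resistance v₀ centre-row)) (cong₂ _+_ (triangle (inj₁ refl) refl) (cong₂ _+_ (triangle (inj₂ (inj₁ refl)) refl)
           (cong₂ _+_ (triangle (inj₂ (inj₂ (inj₁ refl))) refl) (cong₂ _+_ (triangle (inj₂ (inj₂ (inj₂ refl))) refl) leaves)))) ⟩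
    -- Three kinds of vertices: the centre of degree `4 + k`, four triangle vertices contributing
    -- `t` each, and `k` leaves.
    (ℕtoℚ 4 + K) * ((ℕtoℚ 5 + K) * 0ℚ + trace - 2ℚ * 0ℚ) + (t + (t + (t + (t + K * ((ℕtoℚ 5 + K) * 1ℚ + trace - 2ℚ * 1ℚ)))))
      ≡⟨ arith K ⟩
    ℕtoℚ 3 * ((ℕtoℚ 5 + K) * (ℕtoℚ 5 + K)) - (ℤ.+ 13 / 3) * (ℕtoℚ 5 + K) - ℤ.+ 32 / 3
      ≡⟨ sym (cong₂ (λ p q → p - (ℤ.+ 13 / 3) * q - ℤ.+ 32 / 3)
           (trans (ℕtoℚ-* 3 (n ℕ.* n)) (cong (ℕtoℚ 3 *_) (trans (ℕtoℚ-* n n) (cong₂ _*_ (ℕtoℚ-+ 5 k) (ℕtoℚ-+ 5 k))))) (ℕtoℚ-+ 5 k)) ⟩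
    DRvalue n ∎)
    where
    open ≡-Reasoning
    t : ℚ
    t = 2ℚ * ((ℕtoℚ 5 + K) * ⅔ + trace - 2ℚ * 1ℚ)
    triangle : ∀ {u} → u ≡ v₁ ⊎ u ≡ v₂ ⊎ u ≡ v₃ ⊎ u ≡ v₄ → potential u u ≡ ⅔ → degℚ S u * Σℚ (resistance u) ≡ t
    triangle {u} u-in eq = cong₂ _*_ (triangle-degree u-in)
      (trans (Σ-resistance u (triangle-row u-in)) (cong (λ q → (ℕtoℚ 5 + K) * q + trace - 2ℚ * 1ℚ) eq))
    leaves : Σℚ (λ p → degℚ S (leaf p) * Σℚ (resistance (leaf p))) ≡ K * ((ℕtoℚ 5 + K) * 1ℚ + trace - 2ℚ * 1ℚ)
    leaves = trans (Σ-cong λ p → trans (cong₂ _*_ (leaf-degree p) (trans (Σ-resistance (leaf p) (leaf-row p))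
        (cong (λ q → (ℕtoℚ 5 + K) * q + trace - 2ℚ * 1ℚ) (δ-refl p)))) (ℚₚ.*-identityˡ _))
      (Σ-const k ((ℕtoℚ 5 + K) * 1ℚ + trace - 2ℚ * 1ℚ))
    arith : ∀ K → (ℕtoℚ 4 + K) * ((ℕtoℚ 5 + K) * 0ℚ + ((ℤ.+ 8 / 3) + K) - 2ℚ * 0ℚ)
        + (2ℚ * ((ℕtoℚ 5 + K) * (ℤ.+ 2 / 3) + ((ℤ.+ 8 / 3) + K) - 2ℚ * 1ℚ) + (2ℚ * ((ℕtoℚ 5 + K) * (ℤ.+ 2 / 3) + ((ℤ.+ 8 / 3) + K) - 2ℚ * 1ℚ)
        + (2ℚ * ((ℕtoℚ 5 + K) * (ℤ.+ 2 / 3) + ((ℤ.+ 8 / 3) + K) - 2ℚ * 1ℚ) + (2ℚ * ((ℕtoℚ 5 + K) * (ℤ.+ 2 / 3) + ((ℤ.+ 8 / 3) + K) - 2ℚ * 1ℚ)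
        + K * ((ℕtoℚ 5 + K) * 1ℚ + ((ℤ.+ 8 / 3) + K) - 2ℚ * 1ℚ)))))
      ≡ ℕtoℚ 3 * ((ℕtoℚ 5 + K) * (ℕtoℚ 5 + K)) - (ℤ.+ 13 / 3) * (ℕtoℚ 5 + K) - ℤ.+ 32 / 3
    arith = solve-∀ ℚ-ring

theorem4p1 : ∀ (n : ℕ) → 5 ≤ n →
    HasDR (S33 n) (DRvalue n) ×
    (∀ (G : Graph n) → IsSimple G → Connected G → numEdges G ≡ suc n →
       ExactlyTwoCycles G → ∀ (x : ℚ) → HasDR G x → DRvalue n ≤ℚ x)
theorem4p1 _ (s≤s (s≤s (s≤s (s≤s (s≤s (z≤n {k})))))) = hasDR-S33 {k} ,
  λ { G simple connected edges (C₁ , C₂ , isCycle₁ , isCycle₂ , C₁≭C₂ , only) x hasDR →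
      TwoCycleBound.lower-bound simple connected isCycle₁ isCycle₂ C₁≭C₂ only edges hasDR }
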